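{- Let $0 < \varepsilon < 1/2$ and let $W\geq 1$ be an integer. Set $\lambda = \frac{\varepsilon}{100W}$. Let $\beta \geq \beta^- + 2$ (with $\beta\geq 3$) be integers such that $\frac{\beta + 6W}{\log(\beta + 6W)} \geq 2 W^2\lambda^{ -2}$ and $\beta^- - 6W \geq (1 - \lambda) \cdot (\beta + 6W)$. Let $G$ be an edge-weighted multi-graph with integer edge weights in $\{1,\dots,W\}$ and capacities $\{b_v\}$ (with no bound on the number of parallel edges), and let $\overline{G}$ be its relevant subgraph. Then any $(\beta, \beta^-)$-$w$-$b$-EDCS $H$ of $\overline{G}$ contains a $b$-matching $M_H$ such that $\left(2 - \frac{1}{2W} + \varepsilon\right)\cdot w(M_H) \geq w(M_G)$, where $M_G$ is a maximum weight $b$-matching of $G$.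
   Context: A weighted multi-graph $G=(V,E)$ has a multi-set of weighted edges $(u,v,k)$ with $u\neq v$ and weight $k\in\{1,\dots,W\}$; each vertex $v$ has a positive integer capacity $b_v$; arbitrarily many parallel edges are allowed. The relevant edges between $u$ and $v$ are the $\min(b_u,b_v)$ edges of $G$ between $u$ and $v$ of largest weights (all of them if there are fewer); the relevant subgraph $\overline{G}$ consists of all relevant edges. A $b$-matching is a multi-set $M$ of edges with at most $b_v$ edges of $M$ incident to each $v$; $w(M)$ is its total weight. For a subgraph $H$, $\delta_H(v)$ is the multi-set of edges of $H$ incident to $v$ and $\mathbf{w}\!\deg_H(v)=\sum_{e\in\delta_H(v)}w(e)$. A subgraph $H$ of a multi-graph $F$ is a $(\beta,\beta^-)$-$w$-$b$-EDCS of $F$ if (i) for every edge $(u,v,w_{uv})\in H$, $\frac{\mathbf{w}\!\deg_H(u)}{b_u}+\frac{\mathbf{w}\!\deg_H(v)}{b_v}\leq\beta\cdot w_{uv}$, and (ii) for every edge $(u,v,w_{uv})\in F\setminus H$, $\frac{\mathbf{w}\!\deg_H(u)}{b_u}+\frac{\mathbf{w}\!\deg_H(v)}{b_v}\geq\beta^-\cdot w_{uv}$. -}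

module Defs where

open import Data.Nat as ℕ using (ℕ; zero; suc; _⊓_; _!)
open import Data.Integer using (+_)
open import Data.Rational as ℚ using (ℚ; 0ℚ; 1ℚ; _/_)
open import Data.Fin using (Fin; _≟_)
open import Data.Bool using (Bool; _∧_; _∨_)
open import Data.List using (List; []; _∷_; _++_; length; map; filterᵇ)
open import Data.Nat.ListAction using (sum)
open import Data.List.Membership.Propositional using (_∈_)
open import Data.List.Relation.Binary.Permutation.Propositional using (_↭_)
open import Data.Product using (Σ; _×_; ∃)
open import Data.Sum using (_⊎_)
open import Relation.Nullary using (¬_)
open import Relation.Nullary.Decidable using (⌊_⌋)
open import Relation.Binary.PropositionalEquality using (_≡_)

ℕtoℚ : ℕ → ℚ
ℕtoℚ m = + m / 1

-- a / d as a rational; only ever used with d > 0 (capacities are positive)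
ratio : ℕ → ℕ → ℚ
ratio a zero    = 0ℚ
ratio a (suc d) = + a / suc d

pow : ℚ → ℕ → ℚ
pow q zero    = 1ℚ
pow q (suc k) = q ℚ.* pow q k

expPartial : ℚ → ℕ → ℚ
expPartial q zero    = 1ℚ
expPartial q (suc K) = expPartial q K ℚ.+ (pow q (suc K) ℚ.* ratio 1 (suc K !))

-- "x ≤ exp q" for rational q > 0 and rational x:
-- exp q is the supremum of the (strictly increasing) partial sums, and is
-- irrational for rational q ≠ 0, so  x ≤ exp q  iff some partial sum is ≥ x.
ExpAtLeast : ℚ → ℚ → Set
ExpAtLeast q x = ∃ λ K → x ℚ.≤ expPartial q K

record Edge (n : ℕ) : Set where
  constructor edge
  field
    u  : Fin n
    v  : Fin n
    wt : ℕ
open Edge public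

-- a multi-graph is a multi-set (list up to permutation) of edges
MultiGraph : ℕ → Set
MultiGraph n = List (Edge n)

WellFormed : ∀ {n} → ℕ → MultiGraph n → Set
WellFormed W G = ∀ e → e ∈ G → ¬ (u e ≡ v e) × 1 ℕ.≤ wt e × wt e ℕ.≤ W

betweenᵇ : ∀ {n} → Fin n → Fin n → Edge n → Bool
betweenᵇ x y e = (⌊ u e ≟ x ⌋ ∧ ⌊ v e ≟ y ⌋) ∨ (⌊ u e ≟ y ⌋ ∧ ⌊ v e ≟ x ⌋)

incidentᵇ : ∀ {n} → Fin n → Edge n → Bool
incidentᵇ x e = ⌊ u e ≟ x ⌋ ∨ ⌊ v e ≟ x ⌋

δ : ∀ {n} → MultiGraph n → Fin n → MultiGraph n
δ H x = filterᵇ (incidentᵇ x) H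

edgesBetween : ∀ {n} → MultiGraph n → Fin n → Fin n → MultiGraph n
edgesBetween H x y = filterᵇ (betweenᵇ x y) H

weight : ∀ {n} → MultiGraph n → ℕ
weight M = sum (map wt M)

deg : ∀ {n} → MultiGraph n → Fin n → ℕ
deg H x = length (δ H x)

wdeg : ∀ {n} → MultiGraph n → Fin n → ℕ
wdeg H x = weight (δ H x)

SplitOf : ∀ {n} → MultiGraph n → MultiGraph n → MultiGraph n → Set
SplitOf F H R = F ↭ (H ++ R)

SubMultiset : ∀ {n} → MultiGraph n → MultiGraph n → Set
SubMultiset H F = ∃ λ R → SplitOf F H R

-- Gbar is the relevant subgraph of G w.r.t. capacities b:
-- Gbar ⊆ G (with complement R), and for every pair x,y the edges of Gbar
-- between x and y are min(b_x, b_y) edges of G between x and y of largest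
-- weight (all of them if fewer): their number is min(b_x,b_y,#edges) and
-- every dropped edge between the same endpoints is no heavier than every
-- kept one.
IsRelevantSubgraph : ∀ {n} → (Fin n → ℕ) → MultiGraph n → MultiGraph n → Set
IsRelevantSubgraph b G Gbar = ∃ λ R → SplitOf G Gbar R
  × (∀ x y → length (edgesBetween Gbar x y)
               ≡ (b x ⊓ b y) ⊓ length (edgesBetween G x y))
  × (∀ e e′ → e ∈ Gbar → e′ ∈ R → betweenᵇ (u e) (v e) e′ ≡ Data.Bool.true
       → wt e′ ℕ.≤ wt e)

IsBMatching : ∀ {n} → (Fin n → ℕ) → MultiGraph n → Set
IsBMatching b M = ∀ x → deg M x ℕ.≤ b x

IsBMatchingOf : ∀ {n} → (Fin n → ℕ) → MultiGraph n → MultiGraph n → Set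
IsBMatchingOf b G M = SubMultiset M G × IsBMatching b M

IsMaxBMatching : ∀ {n} → (Fin n → ℕ) → MultiGraph n → MultiGraph n → Set
IsMaxBMatching b G M = IsBMatchingOf b G M
  × (∀ M′ → IsBMatchingOf b G M′ → weight M′ ℕ.≤ weight M)

edgeLoad : ∀ {n} → (Fin n → ℕ) → MultiGraph n → Edge n → ℚ
edgeLoad b H e = ratio (wdeg H (u e)) (b (u e)) ℚ.+ ratio (wdeg H (v e)) (b (v e))

IsEDCS : ∀ {n} → (Fin n → ℕ) → ℕ → ℕ → MultiGraph n → MultiGraph n → Set
IsEDCS b β β⁻ F H = ∃ λ R → SplitOf F H R
  × (∀ e → e ∈ H → edgeLoad b H e ℚ.≤ ℕtoℚ β ℚ.* ℕtoℚ (wt e))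
  × (∀ e → e ∈ R → ℕtoℚ β⁻ ℚ.* ℕtoℚ (wt e) ℚ.≤ edgeLoad b H e)

{-# OPTIONS --safe #-}
-- Split every vertex v into b v slots, so that a maximum b-matching M of relevant
-- edges becomes a matching, and spread the other edges of H so evenly that each
-- slot carries about wdeg v / b v. A vector-balancing argument then signs the slots,
-- oppositely along M, so that the edges of H between opposite signs form a bipartite
-- graph H″ in which almost every slot keeps half its weighted degree; errors are
-- controlled in the ℓ² sense only, which suffices and needs no concentration bound.
-- By Egerváry's theorem (proved by an auction followed by rounding) H″ has a matching
-- and an integral vertex cover y of equal weight. Put r = wdeg / b - β y. Edges of H″
-- satisfy r + r ≤ 0, while an edge of M outside H that y fails to cover by g satisfies
-- r + r ≳ β g; weighing the slots with r > 0 against those with r < 0 by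
-- (W - 1) β + |r| bounds the total of g by (1 - 1/(2W)) times the weight of y.
-- The logarithm in the hypothesis on β is not used to its full extent: all that is
-- needed is that ε² (β + 6W) exceeds a constant times W².
module Submission where

open import Defs
open import Level using (0ℓ)
open import Function using (_∘_; id)
open import Function.Bundles using (module Equivalence)
open import Data.Bool as Bool using (Bool; true; false; if_then_else_; not)
import Data.Bool.Properties as Bool
open import Data.Empty using (⊥; ⊥-elim)
open import Data.Nat as ℕ using (ℕ; zero; suc; s≤s; z≤n)
import Data.Nat.Properties as ℕ
import Data.Nat.DivMod as ℕ
open import Data.Nat.Divisibility using (divides)
open import Data.Nat.ListAction using (sum)
import Data.Integer as ℤ
import Data.Integer.Properties as ℤ
open import Data.Rational as ℚ using (ℚ; 0ℚ; ½; 1ℚ; _+_; _*_; _-_; -_; _≤_; _<_)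
import Data.Rational.Properties as ℚ
import Data.Rational.Unnormalised as ℚᵘ
import Data.Rational.Unnormalised.Properties as ℚᵘ
open import Data.Fin as Fin using (Fin; _≟_)
open import Data.List as List using (List; []; _∷_; _++_; length; map; filter; filterᵇ; allFin; upTo)
import Data.List.Properties as List
open import Data.List.Membership.Propositional using (_∈_; find; lose)
open import Data.List.Membership.Propositional.Properties using (∈-allFin; ∈-map⁺; ∈-++⁺ˡ; ∈-++⁺ʳ; ∈-++⁻; ∈-∃++; ∈-filter⁺; ∈-filter⁻; ∈-upTo⁻)
open import Data.List.Relation.Unary.All as All using (All; []; _∷_)
open import Data.List.Relation.Unary.AllPairs as AllPairs using (AllPairs; []; _∷_)
import Data.List.Relation.Unary.AllPairs.Properties as AllPairs
open import Data.List.Relation.Unary.Any using (here; there; any?)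
open import Data.List.Relation.Binary.Permutation.Propositional as ↭ using (_↭_; ↭-refl; ↭-sym; ↭-trans; ↭-reflexive; prep; swap)
import Data.List.Relation.Binary.Permutation.Propositional.Properties as ↭
open import Data.Product using (Σ; _×_; ∃; _,_; proj₁; proj₂)
open import Data.Sum using (_⊎_; inj₁; inj₂)
open import Relation.Nullary using (¬_; Dec; yes; no)
open import Relation.Nullary.Decidable using (⌊_⌋; dec⇒maybe; ¬?; _×-dec_)
open import Relation.Binary.PropositionalEquality using (_≡_; _≢_; refl; sym; trans; cong; cong₂; subst; subst₂; module ≡-Reasoning)
open import Tactic.RingSolver using (solve-∀)
open import Tactic.RingSolver.Core.AlmostCommutativeRing using (AlmostCommutativeRing; fromCommutativeRing)

-- The dual has to be integral, which forces a bipartite graph. Signs are opposed along M so that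
-- its edges inside H survive in H″ and get covered; only its edges outside H remain to be paid for.
-- Halving costs nothing, since the edge inequalities of H″ are summed over vertices, where all
-- degrees shrink by the same factor. The vertex weights make both sides tight. With C = (W - 1) β,
-- if an edge is uncovered by an integer g ≥ 1 and its positive parts satisfy a + b ≥ β g, then a (C
-- + a) + b (C + b) ≥ (W - 1/2) β² g, with equality at g = 1, a = b = β / 2. A vertex with r = -ρ <
-- 0 contributes (β y - ρ)(C + ρ) ≤ (W - 1/2)² β² y / W. The quotient of the two constants is 1 -
-- 1/(2W). As for the errors, the deviation of a degree is multiplied by at most (2W - 1) β, and
-- only at vertices met by edges of M outside H or in the support of y, of which there are O(w(M)).
-- Its squares sum to at most 16 W w(H) = O(β W² w(M)), so the relative error is of order W / √β.

ring : AlmostCommutativeRing 0ℓ 0ℓ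
ring = fromCommutativeRing ℚ.+-*-commutativeRing (λ q → dec⇒maybe (0ℚ ℚ.≟ q))

-- Inequalities over the rationals

2ℚ : ℚ
2ℚ = 1ℚ + 1ℚ

-- The form in which nearly every inequality below is certified: the slack `s` is written out as a
-- sum of visibly nonnegative terms, and the ring solver checks the identity.
≤-by : ∀ {a b s} → 0ℚ ≤ s → b ≡ a + s → a ≤ b
≤-by {a} {b} {s} 0≤s eq = subst₂ _≤_ (ℚ.+-identityʳ a) (sym eq) (ℚ.+-monoʳ-≤ a 0≤s)

0≤- : ∀ {a b} → a ≤ b → 0ℚ ≤ b - a
0≤- {a} {b} a≤b = subst (_≤ b - a) (ℚ.+-inverseʳ a) (ℚ.+-monoˡ-≤ (- a) a≤b)

0≤+ : ∀ {a b} → 0ℚ ≤ a → 0ℚ ≤ b → 0ℚ ≤ a + b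
0≤+ = ℚ.+-mono-≤

*-monoˡ : ∀ {a b c} → 0ℚ ≤ c → a ≤ b → c * a ≤ c * b
*-monoˡ {c = c} 0≤c = ℚ.*-monoˡ-≤-nonNeg c {{ℚ.nonNegative 0≤c}}

0≤* : ∀ {a b} → 0ℚ ≤ a → 0ℚ ≤ b → 0ℚ ≤ a * b
0≤* {a} {b} 0≤a 0≤b = subst (_≤ a * b) (ℚ.*-zeroʳ a) (*-monoˡ 0≤a 0≤b)

*-mono : ∀ {a b c d} → 0ℚ ≤ a → 0ℚ ≤ d → a ≤ b → c ≤ d → a * c ≤ b * d
*-mono {a} {b} {c} {d} 0≤a 0≤d a≤b c≤d =
  ≤-by (0≤+ (0≤* (0≤- a≤b) 0≤d) (0≤* 0≤a (0≤- c≤d))) (eq a b c d)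
  where
  eq : ∀ a b c d → b * d ≡ a * c + ((b - a) * d + a * (d - c))
  eq = solve-∀ ring

0≤² : ∀ a → 0ℚ ≤ a * a
0≤² a with ℚ.≤-total 0ℚ a
... | inj₁ 0≤a = 0≤* 0≤a 0≤a
... | inj₂ a≤0 = subst (0ℚ ≤_) (eq a) (0≤* (0≤- a≤0) (0≤- a≤0))
  where
  eq : ∀ a → (0ℚ - a) * (0ℚ - a) ≡ a * a
  eq = solve-∀ ring

0≤1 : 0ℚ ≤ 1ℚ
0≤1 = ℚ.nonNegative⁻¹ 1ℚ

0≤2 : 0ℚ ≤ 2ℚ
0≤2 = 0≤+ 0≤1 0≤1

*-cancelˡ-≤ : ∀ {a b c} → 0ℚ < c → c * a ≤ c * b → a ≤ b
*-cancelˡ-≤ {c = c} 0<c = ℚ.*-cancelˡ-≤-pos c {{ℚ.positive 0<c}}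

0<* : ∀ {a b} → 0ℚ < a → 0ℚ < b → 0ℚ < a * b
0<* {a} {b} 0<a 0<b = subst (_< a * b) (ℚ.*-zeroʳ a) (ℚ.*-monoʳ-<-pos a {{ℚ.positive 0<a}} 0<b)

≰-< : ∀ {a b} → a < b → ¬ b ≤ a
≰-< a<b b≤a = ℚ.<-irrefl refl (ℚ.<-≤-trans a<b b≤a)

-- Casts of naturals

abstract

  -- ℕtoℚ computes a gcd, so it is kept from unfolding.
  nat : ℕ → ℚ
  nat = ℕtoℚ

  nat≡ℕtoℚ : ∀ m → nat m ≡ ℕtoℚ m
  nat≡ℕtoℚ m = refl

  nat-0 : nat 0 ≡ 0ℚ
  nat-0 = refl

  nat-1 : nat 1 ≡ 1ℚ
  nat-1 = refl

  toℚᵘ-cast : ∀ m → ℚ.toℚᵘ (nat m) ℚᵘ.≃ ℚᵘ.mkℚᵘ (ℤ.+ m) 0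
  toℚᵘ-cast m = ℚ.toℚᵘ-fromℚᵘ (ℚᵘ.mkℚᵘ (ℤ.+ m) 0)

  cast-+ : ∀ m n → nat (m ℕ.+ n) ≡ nat m + nat n
  cast-+ m n = ℚ.toℚᵘ-injective (ℚᵘ.≃-trans (toℚᵘ-cast (m ℕ.+ n)) (ℚᵘ.≃-sym
    (ℚᵘ.≃-trans (ℚ.toℚᵘ-homo-+ (nat m) (nat n)) (ℚᵘ.≃-trans (ℚᵘ.+-cong (toℚᵘ-cast m) (toℚᵘ-cast n))
      (ℚᵘ.*≡* (cong (ℤ._* ℤ.+ 1) (trans (cong₂ ℤ._+_ (ℤ.*-identityʳ (ℤ.+ m)) (ℤ.*-identityʳ (ℤ.+ n))) (sym (ℤ.pos-+ m n)))))))))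

  cast-* : ∀ m n → nat (m ℕ.* n) ≡ nat m * nat n
  cast-* m n = ℚ.toℚᵘ-injective (ℚᵘ.≃-trans (toℚᵘ-cast (m ℕ.* n)) (ℚᵘ.≃-sym
    (ℚᵘ.≃-trans (ℚ.toℚᵘ-homo-* (nat m) (nat n)) (ℚᵘ.≃-trans (ℚᵘ.*-cong (toℚᵘ-cast m) (toℚᵘ-cast n))
      (ℚᵘ.*≡* (cong (ℤ._* ℤ.+ 1) (sym (ℤ.pos-* m n))))))))

  cast-≤ : ∀ {m n} → m ℕ.≤ n → nat m ≤ nat n
  cast-≤ {m} {n} m≤n = ℚ.toℚᵘ-cancel-≤ (ℚᵘ.≤-respˡ-≃ (ℚᵘ.≃-sym (toℚᵘ-cast m)) (ℚᵘ.≤-respʳ-≃ (ℚᵘ.≃-sym (toℚᵘ-cast n))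
    (ℚᵘ.*≤* (ℤ.*-monoʳ-≤-nonNeg (ℤ.+ 1) (ℤ.+≤+ m≤n)))))

  cast-< : ∀ {m n} → m ℕ.< n → nat m < nat n
  cast-< {m} {n} m<n = ℚ.toℚᵘ-cancel-< (ℚᵘ.<-respˡ-≃ (ℚᵘ.≃-sym (toℚᵘ-cast m)) (ℚᵘ.<-respʳ-≃ (ℚᵘ.≃-sym (toℚᵘ-cast n))
    (ℚᵘ.*<* (ℤ.*-monoʳ-<-pos (ℤ.+ 1) (ℤ.+<+ m<n)))))

cast-cancel-≤ : ∀ {m n} → nat m ≤ nat n → m ℕ.≤ n
cast-cancel-≤ {m} {n} h with m ℕ.≤? n
... | yes m≤n = m≤n
... | no m≰n  = ⊥-elim (≰-< (cast-< (ℕ.≰⇒> m≰n)) h)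

cast-cancel-< : ∀ {m n} → nat m < nat n → m ℕ.< n
cast-cancel-< {m} {n} h with n ℕ.≤? m
... | yes n≤m = ⊥-elim (≰-< h (cast-≤ n≤m))
... | no n≰m  = ℕ.≰⇒> n≰m

cast-suc : ∀ m → nat (suc m) ≡ 1ℚ + nat m
cast-suc m = trans (cast-+ 1 m) (cong (_+ nat m) nat-1)

0≤cast : ∀ m → 0ℚ ≤ nat m
0≤cast m = subst (_≤ nat m) nat-0 (cast-≤ z≤n)

1≤cast : ∀ {m} → 1 ℕ.≤ m → 1ℚ ≤ nat m
1≤cast {m} 1≤m = subst (_≤ nat m) nat-1 (cast-≤ 1≤m)

0<cast : ∀ {m} → 1 ℕ.≤ m → 0ℚ < nat m
0<cast 1≤m = ℚ.<-≤-trans (ℚ.positive⁻¹ 1ℚ) (1≤cast 1≤m)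

abstract

  toℚᵘ-ratio : ∀ a d → ℚ.toℚᵘ (ratio a (suc d)) ℚᵘ.≃ ℚᵘ.mkℚᵘ (ℤ.+ a) d
  toℚᵘ-ratio a d = ℚ.toℚᵘ-fromℚᵘ (ℚᵘ.mkℚᵘ (ℤ.+ a) d)

  ratio-* : ∀ a d → 1 ℕ.≤ d → ratio a d * nat d ≡ nat a
  ratio-* a (suc d) _ = ℚ.toℚᵘ-injective (ℚᵘ.≃-trans (ℚ.toℚᵘ-homo-* (ratio a (suc d)) (nat (suc d)))
    (ℚᵘ.≃-trans (ℚᵘ.*-cong (toℚᵘ-ratio a d) (toℚᵘ-cast (suc d))) (ℚᵘ.≃-trans
      (ℚᵘ.*≡* (trans (ℤ.*-identityʳ _) (cong (λ k → ℤ.+ a ℤ.* ℤ.+ suc k) (sym (ℕ.*-identityʳ d))))) (ℚᵘ.≃-sym (toℚᵘ-cast a)))))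

0≤ratio : ∀ a d → 0ℚ ≤ ratio a d
0≤ratio a zero    = ℚ.≤-refl
0≤ratio a (suc d) = ℚ.toℚᵘ-cancel-≤ (ℚᵘ.≤-respʳ-≃ (ℚᵘ.≃-sym (toℚᵘ-ratio a d))
  (ℚᵘ.*≤* (subst (ℤ._≤_ (ℤ.+ 0)) (sym (ℤ.*-identityʳ (ℤ.+ a))) (ℤ.+≤+ z≤n))))

cast*ratio1 : ∀ d → 1 ℕ.≤ d → nat d * ratio 1 d ≡ 1ℚ
cast*ratio1 d 1≤d = trans (ℚ.*-comm (nat d) (ratio 1 d)) (trans (ratio-* 1 d 1≤d) nat-1)

ratio≡ : ∀ a d → 1 ℕ.≤ d → ratio a d ≡ nat a * ratio 1 d
ratio≡ a d 1≤d = begin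
  ratio a d  ≡⟨ sym (ℚ.*-identityʳ _) ⟩
  ratio a d * 1ℚ  ≡⟨ cong (ratio a d *_) (sym (cast*ratio1 d 1≤d)) ⟩
  ratio a d * (nat d * ratio 1 d)  ≡⟨ sym (ℚ.*-assoc (ratio a d) (nat d) (ratio 1 d)) ⟩
  ratio a d * nat d * ratio 1 d    ≡⟨ cong (_* ratio 1 d) (ratio-* a d 1≤d) ⟩
  nat a * ratio 1 d  ∎
  where open ≡-Reasoning

-- Finite sums and indicators

∑ : ∀ {A : Set} → List A → (A → ℚ) → ℚ
∑ []       f = 0ℚ
∑ (x ∷ xs) f = f x + ∑ xs f

∑-0 : ∀ {A : Set} (xs : List A) → ∑ xs (λ _ → 0ℚ) ≡ 0ℚ
∑-0 []       = refl
∑-0 (x ∷ xs) = trans (ℚ.+-identityˡ (∑ xs (λ _ → 0ℚ))) (∑-0 xs)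

module _ {A : Set} where

  ∑-cong∈ : ∀ (xs : List A) {f g} → (∀ x → x ∈ xs → f x ≡ g x) → ∑ xs f ≡ ∑ xs g
  ∑-cong∈ []       h = refl
  ∑-cong∈ (x ∷ xs) h = cong₂ _+_ (h x (here refl)) (∑-cong∈ xs (λ y y∈ → h y (there y∈)))

  ∑-cong : ∀ (xs : List A) {f g} → (∀ x → f x ≡ g x) → ∑ xs f ≡ ∑ xs g
  ∑-cong xs h = ∑-cong∈ xs (λ x _ → h x)

  ∑-mono∈ : ∀ (xs : List A) {f g} → (∀ x → x ∈ xs → f x ≤ g x) → ∑ xs f ≤ ∑ xs g
  ∑-mono∈ []       h = ℚ.≤-refl
  ∑-mono∈ (x ∷ xs) h = ℚ.+-mono-≤ (h x (here refl)) (∑-mono∈ xs (λ y y∈ → h y (there y∈)))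

  ∑-mono : ∀ (xs : List A) {f g} → (∀ x → f x ≤ g x) → ∑ xs f ≤ ∑ xs g
  ∑-mono xs h = ∑-mono∈ xs (λ x _ → h x)

  0≤∑∈ : ∀ (xs : List A) {f} → (∀ x → x ∈ xs → 0ℚ ≤ f x) → 0ℚ ≤ ∑ xs f
  0≤∑∈ xs {f} h = subst (_≤ ∑ xs f) (∑-0 xs) (∑-mono∈ xs h)

  0≤∑ : ∀ (xs : List A) {f} → (∀ x → 0ℚ ≤ f x) → 0ℚ ≤ ∑ xs f
  0≤∑ xs h = 0≤∑∈ xs (λ x _ → h x)

  ∑-+ : ∀ (xs : List A) f g → ∑ xs (λ x → f x + g x) ≡ ∑ xs f + ∑ xs g
  ∑-+ []       f g = refl
  ∑-+ (x ∷ xs) f g = trans (cong (λ s → f x + g x + s) (∑-+ xs f g)) (eq (f x) (g x) (∑ xs f) (∑ xs g))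
    where
    eq : ∀ a b c d → a + b + (c + d) ≡ a + c + (b + d)
    eq = solve-∀ ring

  ∑-*ˡ : ∀ (xs : List A) c f → ∑ xs (λ x → c * f x) ≡ c * ∑ xs f
  ∑-*ˡ []       c f = sym (ℚ.*-zeroʳ c)
  ∑-*ˡ (x ∷ xs) c f = trans (cong (c * f x +_) (∑-*ˡ xs c f)) (sym (ℚ.*-distribˡ-+ c (f x) (∑ xs f)))

  ∑-*ʳ : ∀ (xs : List A) c f → ∑ xs (λ x → f x * c) ≡ ∑ xs f * c
  ∑-*ʳ xs c f = trans (∑-cong xs (λ x → ℚ.*-comm (f x) c)) (trans (∑-*ˡ xs c f) (ℚ.*-comm c (∑ xs f)))

  ∑-- : ∀ (xs : List A) f g → ∑ xs (λ x → f x - g x) ≡ ∑ xs f - ∑ xs g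
  ∑-- []       f g = refl
  ∑-- (x ∷ xs) f g = trans (cong (λ s → f x - g x + s) (∑-- xs f g)) (eq (f x) (g x) (∑ xs f) (∑ xs g))
    where
    eq : ∀ a b c d → a - b + (c - d) ≡ a + c - (b + d)
    eq = solve-∀ ring

  ∑-swap : ∀ {B : Set} (xs : List A) (ys : List B) (f : A → B → ℚ) →
    ∑ xs (λ x → ∑ ys (f x)) ≡ ∑ ys (λ y → ∑ xs (λ x → f x y))
  ∑-swap []       ys f = sym (∑-0 ys)
  ∑-swap (x ∷ xs) ys f = trans (cong (λ s → ∑ ys (f x) + s) (∑-swap xs ys f)) (sym (lem ys))
    where
    g = λ y → ∑ xs (λ x → f x y)
    eq : ∀ a b c d → a + b + (c + d) ≡ a + c + (b + d)
    eq = solve-∀ ring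
    lem : ∀ ys → ∑ ys (λ y → f x y + g y) ≡ ∑ ys (f x) + ∑ ys g
    lem []       = refl
    lem (y ∷ ys) = trans (cong (λ s → f x y + g y + s) (lem ys)) (eq (f x y) (g y) (∑ ys (f x)) (∑ ys g))

  ∑-++ : ∀ (xs ys : List A) f → ∑ (xs ++ ys) f ≡ ∑ xs f + ∑ ys f
  ∑-++ []       ys f = sym (ℚ.+-identityˡ _)
  ∑-++ (x ∷ xs) ys f = trans (cong (f x +_) (∑-++ xs ys f)) (sym (ℚ.+-assoc (f x) (∑ xs f) (∑ ys f)))

  ∑-↭ : ∀ {xs ys : List A} f → xs ↭ ys → ∑ xs f ≡ ∑ ys f
  ∑-↭ f ↭.refl  = refl
  ∑-↭ f (prep x p)  = cong (f x +_) (∑-↭ f p)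
  ∑-↭ f (swap {xs} {ys} x y p)        = trans (cong (λ s → f x + (f y + s)) (∑-↭ f p)) (eq (f x) (f y) (∑ ys f))
    where
    eq : ∀ a b c → a + (b + c) ≡ b + (a + c)
    eq = solve-∀ ring
  ∑-↭ f (↭.trans p q)  = trans (∑-↭ f p) (∑-↭ f q)

  ∑-↭++ : ∀ {xs ys zs : List A} f → xs ↭ ys ++ zs → ∑ xs f ≡ ∑ ys f + ∑ zs f
  ∑-↭++ {ys = ys} {zs} f p = trans (∑-↭ f p) (∑-++ ys zs f)

  ∑-map : ∀ {B : Set} (h : B → A) (xs : List B) f → ∑ (map h xs) f ≡ ∑ xs (f ∘ h)
  ∑-map h []       f = refl
  ∑-map h (x ∷ xs) f = cong (f (h x) +_) (∑-map h xs f)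

  ∑-cast : ∀ (xs : List A) (f : A → ℕ) → nat (sum (map f xs)) ≡ ∑ xs (nat ∘ f)
  ∑-cast []       f = nat-0
  ∑-cast (x ∷ xs) f = trans (cast-+ (f x) (sum (map f xs))) (cong (nat (f x) +_) (∑-cast xs f))

  ∑-1 : ∀ (xs : List A) → ∑ xs (λ _ → 1ℚ) ≡ nat (length xs)
  ∑-1 []       = sym nat-0
  ∑-1 (x ∷ xs) = trans (cong (1ℚ +_) (∑-1 xs)) (sym (cast-suc (length xs)))

  ≤∑ : ∀ (xs : List A) {f x} → (∀ y → 0ℚ ≤ f y) → x ∈ xs → f x ≤ ∑ xs f
  ≤∑ (x ∷ xs) {f} h (here refl) = subst (_≤ f x + ∑ xs f) (ℚ.+-identityʳ (f x)) (ℚ.+-monoʳ-≤ (f x) (0≤∑ xs h))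
  ≤∑ (y ∷ xs) {f} {x} h (there x∈) = subst (_≤ f y + ∑ xs f) (ℚ.+-identityˡ (f x)) (ℚ.+-mono-≤ (h y) (≤∑ xs h x∈))

  -- Minimising only where `h` is positive lets one search serve two purposes: averaging, with `h` a
  -- weight, and the auction, with `h` marking the edges at one left vertex.
  argmin : ∀ (xs : List A) (h f : A → ℚ) →
    (∃ λ x → x ∈ xs × 0ℚ < h x × ∀ y → y ∈ xs → 0ℚ < h y → f x ≤ f y) ⊎ (∀ y → y ∈ xs → h y ≤ 0ℚ)
  argmin []       h f = inj₂ (λ _ ())
  argmin (x ∷ xs) h f with 0ℚ ℚ.<? h x | argmin xs h f
  ... | no ¬0<  | inj₂ none = inj₂ λ { y (here refl) → ℚ.≮⇒≥ ¬0< ; y (there y∈) → none y y∈ }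
  ... | no ¬0<  | inj₁ (z , z∈ , 0<z , min) =
    inj₁ (z , there z∈ , 0<z , λ { y (here refl) 0<y → ⊥-elim (¬0< 0<y) ; y (there y∈) → min y y∈ })
  ... | yes 0<x | inj₂ none =
    inj₁ (x , here refl , 0<x , λ { y (here refl) _ → ℚ.≤-refl ; y (there y∈) 0<y → ⊥-elim (≰-< 0<y (none y y∈)) })
  ... | yes 0<x | inj₁ (z , z∈ , 0<z , min) with ℚ.≤-total (f x) (f z)
  ...   | inj₁ x≤z = inj₁ (x , here refl , 0<x , λ { y (here refl) _ → ℚ.≤-refl ; y (there y∈) 0<y → ℚ.≤-trans x≤z (min y y∈ 0<y) })
  ...   | inj₂ z≤x = inj₁ (z , there z∈ , 0<z , λ { y (here refl) _ → z≤x ; y (there y∈) → min y y∈ })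

  -- The minimum of `f` over the support of `h` cannot exceed the `h`-weighted mean. This is the
  -- pigeonhole principle behind every choice of a slot.
  average : ∀ (xs : List A) (h f : A → ℚ) c → (∀ x → 0ℚ ≤ h x) → 0ℚ < ∑ xs h →
    ∑ xs (λ x → h x * f x) ≤ c * ∑ xs h → ∃ λ x → 0ℚ < h x × f x ≤ c
  average xs h f c 0≤h 0<∑ ∑≤ with argmin xs h f
  ... | inj₂ none = ⊥-elim (≰-< 0<∑ (subst (∑ xs h ≤_) (∑-0 xs) (∑-mono∈ xs none)))
  ... | inj₁ (x , _ , 0<hx , min) = x , 0<hx , *-cancelˡ-≤ 0<∑ (begin
    ∑ xs h * f x  ≡⟨ sym (∑-*ʳ xs (f x) h) ⟩
    ∑ xs (λ y → h y * f x)    ≤⟨ ∑-mono∈ xs termwise ⟩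
    ∑ xs (λ y → h y * f y)    ≤⟨ ∑≤ ⟩
    c * ∑ xs h  ≡⟨ ℚ.*-comm c (∑ xs h) ⟩
    ∑ xs h * c  ∎)
    where
    open ℚ.≤-Reasoning
    termwise : ∀ y → y ∈ xs → h y * f x ≤ h y * f y
    termwise y y∈ with 0ℚ ℚ.<? h y
    ... | yes 0<hy = *-monoˡ (0≤h y) (min y y∈ 0<hy)
    ... | no ¬0<hy = ℚ.≤-reflexive (trans (cong (_* f x) hy≡0) (trans (ℚ.*-zeroˡ (f x)) (sym (trans (cong (_* f y) hy≡0) (ℚ.*-zeroˡ (f y))))))
      where
      hy≡0 : h y ≡ 0ℚ
      hy≡0 = ℚ.≤-antisym (ℚ.≮⇒≥ ¬0<hy) (0≤h y)

⟨_⟩ : Bool → ℚ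
⟨ b ⟩ = if b then 1ℚ else 0ℚ

0≤⟨⟩ : ∀ b → 0ℚ ≤ ⟨ b ⟩
0≤⟨⟩ true  = 0≤1
0≤⟨⟩ false = ℚ.≤-refl

∑-filter : ∀ {A : Set} (t : A → Bool) xs f → ∑ (filterᵇ t xs) f ≡ ∑ xs (λ x → ⟨ t x ⟩ * f x)
∑-filter t []       f = refl
∑-filter t (x ∷ xs) f with t x
... | true  = cong₂ _+_ (sym (ℚ.*-identityˡ (f x))) (∑-filter t xs f)
... | false = trans (∑-filter t xs f) (sym (trans (cong (_+ _) (ℚ.*-zeroˡ (f x))) (ℚ.+-identityˡ _)))

filter-split : ∀ {A : Set} (t : A → Bool) xs → xs ↭ filterᵇ t xs ++ filterᵇ (not ∘ t) xs
filter-split t []       = ↭-refl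
filter-split t (x ∷ xs) with t x
... | true  = prep x (filter-split t xs)
... | false = ↭-trans (prep x (filter-split t xs)) (↭-sym (↭.shift x (filterᵇ t xs) _))

ι : ∀ {n} → Fin n → Fin n → ℚ
ι p q = ⟨ ⌊ p ≟ q ⌋ ⟩

ι-refl : ∀ {n} (p : Fin n) → ι p p ≡ 1ℚ
ι-refl p with p ≟ p
... | yes _ = refl
... | no p≢p = ⊥-elim (p≢p refl)

ι-≢ : ∀ {n} {p q : Fin n} → p ≢ q → ι p q ≡ 0ℚ
ι-≢ {p = p} {q} p≢q with p ≟ q
... | yes p≡q = ⊥-elim (p≢q p≡q)
... | no _ = refl

0≤ι : ∀ {n} (p q : Fin n) → 0ℚ ≤ ι p q
0≤ι p q = 0≤⟨⟩ ⌊ p ≟ q ⌋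

0<ι⇒≡ : ∀ {n} {p q : Fin n} → 0ℚ < ι p q → p ≡ q
0<ι⇒≡ {p = p} {q} h with p ≟ q
... | yes p≡q = p≡q
... | no _ = ⊥-elim (ℚ.<-irrefl refl h)

ι-sym : ∀ {n} (p q : Fin n) → ι p q ≡ ι q p
ι-sym p q with p ≟ q
... | yes refl = sym (ι-refl p)
... | no p≢q = sym (ι-≢ (λ q≡p → p≢q (sym q≡p)))

ι-suc : ∀ {n} (p q : Fin n) → ι (Fin.suc p) (Fin.suc q) ≡ ι p q
ι-suc p q with p ≟ q
... | yes refl = refl
... | no p≢q = refl

∑ᶠ : ∀ {n} → (Fin n → ℚ) → ℚ
∑ᶠ {n} = ∑ (allFin n)

allFin-suc : ∀ n → allFin (suc n) ≡ Fin.zero ∷ map Fin.suc (allFin n)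
allFin-suc n = cong (Fin.zero ∷_) (sym (List.map-tabulate id Fin.suc))

∑ᶠ-suc : ∀ {n} (f : Fin (suc n) → ℚ) → ∑ᶠ f ≡ f Fin.zero + ∑ᶠ (f ∘ Fin.suc)
∑ᶠ-suc {n} f = trans (cong (λ xs → ∑ xs f) (allFin-suc n)) (cong (f Fin.zero +_) (∑-map Fin.suc (allFin n) f))

∑-ι : ∀ {n} (p : Fin n) (f : Fin n → ℚ) → ∑ᶠ (λ q → ι p q * f q) ≡ f p
∑-ι {suc n} Fin.zero f = trans (∑ᶠ-suc (λ q → ι Fin.zero q * f q)) (trans
  (cong₂ _+_ (ℚ.*-identityˡ (f Fin.zero)) (trans (∑-cong (allFin n) (λ q → ℚ.*-zeroˡ (f (Fin.suc q)))) (∑-0 (allFin n)))) (ℚ.+-identityʳ (f Fin.zero)))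
∑-ι {suc n} (Fin.suc p) f = trans (∑ᶠ-suc (λ q → ι (Fin.suc p) q * f q)) (trans
  (cong₂ _+_ (ℚ.*-zeroˡ (f Fin.zero)) (trans (∑-cong (allFin n) (λ q → cong (_* f (Fin.suc q)) (ι-suc p q))) (∑-ι p (f ∘ Fin.suc))))
  (ℚ.+-identityˡ _))

-- Weighted degrees

-- Being a sum of two indicators, this is convenient for exchanging sums, but it counts a loop
-- twice, unlike `incidentᵇ`; hence the recurring `NoLoops`.
inc : ∀ {n} → Edge n → Fin n → ℚ
inc e x = ι (u e) x + ι (v e) x

wq : ∀ {n} → Edge n → ℚ
wq e = nat (wt e)

one : ∀ {n} → Edge n → ℚ
one _ = 1ℚ

dg : ∀ {n} → (Edge n → ℚ) → MultiGraph n → Fin n → ℚ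
dg c L x = ∑ L (λ e → inc e x * c e)

NoLoops : ∀ {n} → MultiGraph n → Set
NoLoops L = ∀ e → e ∈ L → u e ≢ v e

0≤inc : ∀ {n} (e : Edge n) x → 0ℚ ≤ inc e x
0≤inc e x = 0≤+ (0≤ι (u e) x) (0≤ι (v e) x)

∑-inc : ∀ {n} (e : Edge n) (f : Fin n → ℚ) → ∑ᶠ (λ x → inc e x * f x) ≡ f (u e) + f (v e)
∑-inc {n} e f = trans (∑-cong (allFin n) (λ x → ℚ.*-distribʳ-+ (f x) (ι (u e) x) (ι (v e) x)))
  (trans (∑-+ (allFin n) _ _) (cong₂ _+_ (∑-ι (u e) f) (∑-ι (v e) f)))

-- Double counting: an edge contributes once at each end. It carries inequalities per edge over to
-- sums over vertices and back.
∑-dg : ∀ {n} c (L : MultiGraph n) (f : Fin n → ℚ) → ∑ᶠ (λ x → dg c L x * f x) ≡ ∑ L (λ e → c e * (f (u e) + f (v e)))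
∑-dg {n} c L f = begin
  ∑ᶠ (λ x → dg c L x * f x)  ≡⟨ ∑-cong (allFin n) (λ x → sym (∑-*ʳ L (f x) _)) ⟩
  ∑ᶠ (λ x → ∑ L (λ e → inc e x * c e * f x))      ≡⟨ ∑-swap (allFin n) L _ ⟩
  ∑ L (λ e → ∑ᶠ (λ x → inc e x * c e * f x))      ≡⟨ ∑-cong L (λ e → trans (∑-cong (allFin n) (λ x → eq (inc e x) (c e) (f x)))
                        (trans (∑-*ˡ (allFin n) (c e) _) (cong (c e *_) (∑-inc e f)))) ⟩
  ∑ L (λ e → c e * (f (u e) + f (v e)))  ∎
  where
  open ≡-Reasoning
  eq : ∀ a b c → a * b * c ≡ b * (a * c)
  eq = solve-∀ ring

inc≡incident : ∀ {n} (e : Edge n) x → u e ≢ v e → inc e x ≡ ⟨ incidentᵇ x e ⟩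
inc≡incident e x u≢v with u e ≟ x | v e ≟ x
... | yes u≡x | yes v≡x = ⊥-elim (u≢v (trans u≡x (sym v≡x)))
... | yes _   | no _    = refl
... | no _    | yes _   = refl
... | no _    | no _    = refl

weight-∑ : ∀ {n} (L : MultiGraph n) → nat (weight L) ≡ ∑ L wq
weight-∑ L = ∑-cast L wt

dg-δ : ∀ {n} c (L : MultiGraph n) x → NoLoops L → ∑ (δ L x) c ≡ dg c L x
dg-δ c L x nl = trans (∑-filter (incidentᵇ x) L c) (∑-cong∈ L (λ e e∈ → cong (_* c e) (sym (inc≡incident e x (nl e e∈)))))

cast-deg : ∀ {n} (L : MultiGraph n) x → NoLoops L → nat (deg L x) ≡ dg one L x
cast-deg L x nl = trans (sym (∑-1 (δ L x))) (dg-δ one L x nl)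

cast-wdeg : ∀ {n} (L : MultiGraph n) x → NoLoops L → nat (wdeg L x) ≡ dg wq L x
cast-wdeg L x nl = trans (weight-∑ (δ L x)) (dg-δ wq L x nl)

-- The weighted vertex-cover inequality

¼ : ℚ
¼ = ½ * ½

0≤½ : 0ℚ ≤ ½
0≤½ = ℚ.nonNegative⁻¹ ½

0≤¼ : 0ℚ ≤ ¼
0≤¼ = 0≤* 0≤½ 0≤½

abstract

  -- The positive part of `t` with a jump of height `C` at zero; it weighs a vertex by `C + |r|` on
  -- one side of the sign of r.
  φ⁺ : ℚ → ℚ → ℚ
  φ⁺ C t with 0ℚ ℚ.<? t
  ... | yes _ = C + t
  ... | no _  = 0ℚ

  φ⁺-cases : ∀ C t → (0ℚ < t × φ⁺ C t ≡ C + t) ⊎ (t ≤ 0ℚ × φ⁺ C t ≡ 0ℚ)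
  φ⁺-cases C t with 0ℚ ℚ.<? t
  ... | yes 0<t = inj₁ (0<t , refl)
  ... | no ¬0<t = inj₂ (ℚ.≮⇒≥ ¬0<t , refl)

0≤φ⁺ : ∀ {C} t → 0ℚ ≤ C → 0ℚ ≤ φ⁺ C t
0≤φ⁺ {C} t 0≤C with φ⁺-cases C t
... | inj₁ (0<t , eq) = subst (0ℚ ≤_) (sym eq) (0≤+ 0≤C (ℚ.<⇒≤ 0<t))
... | inj₂ (_ , eq)   = ℚ.≤-reflexive (sym eq)

φ⁺-mono : ∀ {C s t} → 0ℚ ≤ C → s ≤ t → φ⁺ C s ≤ φ⁺ C t
φ⁺-mono {C} {s} {t} 0≤C s≤t with φ⁺-cases C s | φ⁺-cases C t
... | inj₂ (_ , eq)   | _ = subst (_≤ φ⁺ C t) (sym eq) (0≤φ⁺ t 0≤C)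
... | inj₁ (_ , eq)   | inj₁ (_ , eq′) = subst₂ _≤_ (sym eq) (sym eq′) (ℚ.+-monoʳ-≤ C s≤t)
... | inj₁ (0<s , _)  | inj₂ (t≤0 , _) = ⊥-elim (≰-< 0<s (ℚ.≤-trans s≤t t≤0))

-- The hypothesis says both `s ≤ - t` and `t ≤ - s`, so monotonicity bounds the term of each end by
-- that of the opposite end.
φ⁺-edge : ∀ C s t a b → 0ℚ ≤ C → a ≤ 1ℚ → b ≤ 1ℚ → s + t ≤ 0ℚ →
  a * φ⁺ C s + b * φ⁺ C t ≤ φ⁺ C (- s) + φ⁺ C (- t)
φ⁺-edge C s t a b 0≤C a≤1 b≤1 s+t≤0 =
  ℚ.≤-trans (ℚ.+-mono-≤ (shrink a s (- t) a≤1 (≤-by (0≤- s+t≤0) (eq₁ s t))) (shrink b t (- s) b≤1 (≤-by (0≤- s+t≤0) (eq₂ s t))))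
    (ℚ.≤-reflexive (ℚ.+-comm (φ⁺ C (- t)) (φ⁺ C (- s))))
  where
  eq₁ : ∀ s t → - t ≡ s + (0ℚ - (s + t))
  eq₁ = solve-∀ ring
  eq₂ : ∀ s t → - s ≡ t + (0ℚ - (s + t))
  eq₂ = solve-∀ ring
  shrink : ∀ a s t → a ≤ 1ℚ → s ≤ t → a * φ⁺ C s ≤ φ⁺ C t
  shrink a s t a≤1 s≤t = ℚ.≤-trans
    (subst₂ _≤_ (ℚ.*-comm (φ⁺ C s) a) (ℚ.*-identityʳ (φ⁺ C s)) (*-monoˡ (0≤φ⁺ s 0≤C) a≤1)) (φ⁺-mono 0≤C s≤t)

module Scalar (w iW β : ℚ) (1≤w : 1ℚ ≤ w) (0≤iW : 0ℚ ≤ iW) (w*iW : w * iW ≡ 1ℚ) (0<β : 0ℚ < β) where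

  -- Since |D - β y| ≤ β W, the weight C + |r| is at most (W - 1) β + W β, which is `c * β`.
  C c : ℚ
  C = (w - 1ℚ) * β
  c = 2ℚ * w - 1ℚ

  0≤β : 0ℚ ≤ β
  0≤β = ℚ.<⇒≤ 0<β

  0≤w-1 : 0ℚ ≤ w - 1ℚ
  0≤w-1 = 0≤- 1≤w

  0≤w : 0ℚ ≤ w
  0≤w = ℚ.≤-trans 0≤1 1≤w

  0≤C : 0ℚ ≤ C
  0≤C = 0≤* 0≤w-1 0≤β

  0<c : 0ℚ < c
  0<c = ℚ.<-≤-trans (ℚ.positive⁻¹ 1ℚ) (≤-by (0≤+ 0≤w-1 0≤w-1) (eq w))
    where
    eq : ∀ w → 2ℚ * w - 1ℚ ≡ 1ℚ + ((w - 1ℚ) + (w - 1ℚ))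
    eq = solve-∀ ring

  0≤c : 0ℚ ≤ c
  0≤c = ℚ.<⇒≤ 0<c

  -- With ρ = β y - d this is 4 W (β y - ρ) ((W - 1) β + ρ) ≤ (2 W - 1)² β² y, an equality at y = W, ρ = β / 2.
  B-bound : ∀ d y → 0ℚ ≤ y → (y ≡ w) ⊎ (1ℚ + y ≤ w) →
    d * φ⁺ C (- (d - β * y)) ≤ ¼ * c * c * iW * β * β * y
  B-bound d y 0≤y y-case with φ⁺-cases C (- (d - β * y)) | y-case
  ... | inj₂ (_ , eq)    | _  = subst (_≤ ¼ * c * c * iW * β * β * y) (sym (trans (cong (d *_) eq) (ℚ.*-zeroʳ d)))
        (0≤* (0≤* (0≤* (0≤* (0≤* (0≤* 0≤¼ 0≤c) 0≤c) 0≤iW) 0≤β) 0≤β) 0≤y)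
  ... | inj₁ (_ , eq)    | inj₁ refl = ≤-by (0≤² (½ * c * β - d))
        (trans (eq₁ c iW β w) (trans (cong (λ z → ¼ * c * c * β * β * z) w*iW)
          (trans (eq₂ w β d) (cong (λ z → d * z + (½ * c * β - d) * (½ * c * β - d)) (sym eq)))))
    where
    eq₁ : ∀ c iW β w → ¼ * c * c * iW * β * β * w ≡ ¼ * c * c * β * β * (w * iW)
    eq₁ = solve-∀ ring
    eq₂ : ∀ w β d → ¼ * (2ℚ * w - 1ℚ) * (2ℚ * w - 1ℚ) * β * β * 1ℚ ≡
      d * ((w - 1ℚ) * β + - (d - β * w)) + (½ * (2ℚ * w - 1ℚ) * β - d) * (½ * (2ℚ * w - 1ℚ) * β - d)
    eq₂ = solve-∀ ring
  ... | inj₁ (0<-r , eq) | inj₂ y+1≤w = ≤-by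
        (0≤+ (0≤* (ℚ.<⇒≤ 0<-r) (0≤+ (0≤* 0≤β (0≤- y+1≤w)) (ℚ.<⇒≤ 0<-r)))
             (0≤* (0≤* 0≤¼ 0≤iW) (0≤* (0≤* 0≤β 0≤β) 0≤y)))
        (trans (eq₁ w iW β y) (trans (cong (λ z → (w * z - z) * β * β * y + ¼ * iW * β * β * y) w*iW)
          (trans (eq₂ w iW β y d) (cong (λ z → d * z + ((- (d - β * y)) * (β * (w - (1ℚ + y)) + (- (d - β * y))) + ¼ * iW * (β * β * y))) (sym eq)))))
    where
    eq₁ : ∀ w iW β y → ¼ * (2ℚ * w - 1ℚ) * (2ℚ * w - 1ℚ) * iW * β * β * y ≡
      (w * (w * iW) - w * iW) * β * β * y + ¼ * iW * β * β * y
    eq₁ = solve-∀ ring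
    eq₂ : ∀ w iW β y d → (w * 1ℚ - 1ℚ) * β * β * y + ¼ * iW * β * β * y ≡
      d * ((w - 1ℚ) * β + - (d - β * y)) +
      ((- (d - β * y)) * (β * (w - (1ℚ + y)) + (- (d - β * y))) + ¼ * iW * (β * β * y))
    eq₂ = solve-∀ ring

  -- At most one of the two values of `φ⁺` is nonzero, and it is at most `c * β`. If r > 0, then m²
  -- ≤ m. If r < 0, then y is positive, hence at least 1. The factor `m + y` is what keeps the total
  -- error proportional to the weight of the matching.
  difference-bound : ∀ d y m → 0ℚ ≤ d → d ≤ β * w → 0ℚ ≤ y → y ≤ w → (y ≡ 0ℚ) ⊎ (1ℚ ≤ y) → 0ℚ ≤ m → m ≤ 1ℚ →
    (φ⁺ C (- (d - β * y)) - m * φ⁺ C (d - β * y)) * (φ⁺ C (- (d - β * y)) - m * φ⁺ C (d - β * y)) ≤ (c * β) * (c * β) * (m + y)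
  difference-bound d y m 0≤d d≤ 0≤y y≤w y-case 0≤m m≤1 with φ⁺-cases C (d - β * y) | φ⁺-cases C (- (d - β * y))
  ... | inj₂ (_ , eq) | inj₂ (_ , eq′) = subst (_≤ (c * β) * (c * β) * (m + y)) (sym (trans (cong₂ (λ a b → (b - m * a) * (b - m * a)) eq eq′) (zero-eq m)))
          (0≤* (0≤² (c * β)) (0≤+ 0≤m 0≤y))
    where
    zero-eq : ∀ m → (0ℚ - m * 0ℚ) * (0ℚ - m * 0ℚ) ≡ 0ℚ
    zero-eq = solve-∀ ring
  ... | inj₁ (0<r , _) | inj₁ (0<-r , _) = ⊥-elim (≰-< 0<r (≤-by (ℚ.<⇒≤ 0<-r) (sym (ℚ.+-inverseʳ (d - β * y)))))
  ... | inj₁ (0<r , eq) | inj₂ (_ , eq′) = begin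
      _  ≡⟨ cong₂ (λ a b → (b - m * a) * (b - m * a)) eq eq′ ⟩
      (0ℚ - m * s) * (0ℚ - m * s)  ≡⟨ square-eq m s ⟩
      s * s * (m * m)  ≤⟨ *-mono (0≤² s) (0≤+ 0≤m 0≤y) (*-mono 0≤s (0≤* 0≤c 0≤β) s≤ s≤) m²≤ ⟩
      (c * β) * (c * β) * (m + y)  ∎
    where
    open ℚ.≤-Reasoning
    s = C + (d - β * y)
    square-eq : ∀ m s → (0ℚ - m * s) * (0ℚ - m * s) ≡ s * s * (m * m)
    square-eq = solve-∀ ring
    0≤s : 0ℚ ≤ s
    0≤s = 0≤+ 0≤C (ℚ.<⇒≤ 0<r)
    s-eq : ∀ w β d y → (2ℚ * w - 1ℚ) * β ≡ (w - 1ℚ) * β + (d - β * y) + ((β * w - d) + β * y)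
    s-eq = solve-∀ ring
    s≤ : s ≤ c * β
    s≤ = ≤-by (0≤+ (0≤- d≤) (0≤* 0≤β 0≤y)) (s-eq w β d y)
    m-eq : ∀ m y → m + y ≡ m * m + (m * (1ℚ - m) + y)
    m-eq = solve-∀ ring
    m²≤ : m * m ≤ m + y
    m²≤ = ≤-by (0≤+ (0≤* 0≤m (0≤- m≤1)) 0≤y) (m-eq m y)
  ... | inj₂ (_ , eq) | inj₁ (0<-r , eq′) = begin
      _  ≡⟨ cong₂ (λ a b → (b - m * a) * (b - m * a)) eq eq′ ⟩
      (s - m * 0ℚ) * (s - m * 0ℚ)  ≡⟨ square-eq m s ⟩
      s * s * 1ℚ  ≤⟨ *-mono (0≤² s) (0≤+ 0≤m 0≤y) (*-mono 0≤s (0≤* 0≤c 0≤β) s≤ s≤) (1≤ y-case) ⟩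
      (c * β) * (c * β) * (m + y)  ∎
    where
    open ℚ.≤-Reasoning
    s = C + - (d - β * y)
    square-eq : ∀ m s → (s - m * 0ℚ) * (s - m * 0ℚ) ≡ s * s * 1ℚ
    square-eq = solve-∀ ring
    0≤s : 0ℚ ≤ s
    0≤s = 0≤+ 0≤C (ℚ.<⇒≤ 0<-r)
    s-eq : ∀ w β d y → (2ℚ * w - 1ℚ) * β ≡ (w - 1ℚ) * β + - (d - β * y) + (β * (w - y) + d)
    s-eq = solve-∀ ring
    s≤ : s ≤ c * β
    s≤ = ≤-by (0≤+ (0≤* 0≤β (0≤- y≤w)) 0≤d) (s-eq w β d y)
    zero-eq : ∀ β d → 0ℚ ≡ - (d - β * 0ℚ) + d
    zero-eq = solve-∀ ring
    one-eq : ∀ m y → m + y ≡ 1ℚ + (m + (y - 1ℚ))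
    one-eq = solve-∀ ring
    1≤ : (y ≡ 0ℚ) ⊎ (1ℚ ≤ y) → 1ℚ ≤ m + y
    1≤ (inj₁ refl) = ⊥-elim (≰-< 0<-r (≤-by 0≤d (zero-eq β d)))
    1≤ (inj₂ 1≤y)  = ≤-by (0≤+ 0≤m (0≤- 1≤y)) (one-eq m y)

  -- Here `a` is the positive part of r, and d = r + β y ≥ r, so the factor d may be lowered to it.
  positive-part : ∀ d y → 0ℚ ≤ y → ∃ λ a → 0ℚ ≤ a × d - β * y ≤ a × a * (C + a) ≤ d * φ⁺ C (d - β * y)
  positive-part d y 0≤y with φ⁺-cases C (d - β * y)
  ... | inj₁ (0<r , eq) = d - β * y , ℚ.<⇒≤ 0<r , ℚ.≤-refl ,
        subst (λ z → (d - β * y) * (C + (d - β * y)) ≤ d * z) (sym eq) (≤-by (0≤* (0≤* 0≤β 0≤y) (0≤+ 0≤C (ℚ.<⇒≤ 0<r))) (eq₁ β d y C))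
    where
    eq₁ : ∀ β d y C → d * (C + (d - β * y)) ≡ (d - β * y) * (C + (d - β * y)) + β * y * (C + (d - β * y))
    eq₁ = solve-∀ ring
  ... | inj₂ (r≤0 , eq) = 0ℚ , ℚ.≤-refl , r≤0 , ℚ.≤-reflexive (trans (ℚ.*-zeroˡ (C + 0ℚ)) (sym (trans (cong (d *_) eq) (ℚ.*-zeroʳ d))))

  -- A covered edge makes the left side nonpositive. Otherwise integrality gives a gap of at least
  -- 1, and the convex quadratic in the two positive parts is bounded below by a tangent.
  U-bound : ∀ β⁻ l x d d′ y y′ → 0ℚ ≤ l → β - β⁻ ≤ l * β → 0ℚ ≤ x → 0ℚ ≤ y → 0ℚ ≤ y′ →
    (x ≤ y + y′) ⊎ (1ℚ ≤ x - (y + y′)) → β⁻ * x ≤ d + d′ →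
    ½ * c * (β * β) * (x - (y + y′) - 2ℚ * l * x) ≤ d * φ⁺ C (d - β * y) + d′ * φ⁺ C (d′ - β * y′)
  U-bound β⁻ l x d d′ y y′ 0≤l gap 0≤x 0≤y 0≤y′ cases load = ℚ.≤-trans (bound cases) (ℚ.+-mono-≤ a≤ b≤)
    where
    P = positive-part d y 0≤y
    Q = positive-part d′ y′ 0≤y′
    a = proj₁ P
    b = proj₁ Q
    0≤a = proj₁ (proj₂ P)
    0≤b = proj₁ (proj₂ Q)
    r≤a = proj₁ (proj₂ (proj₂ P))
    r≤b = proj₁ (proj₂ (proj₂ Q))
    a≤ = proj₂ (proj₂ (proj₂ P))
    b≤ = proj₂ (proj₂ (proj₂ Q))
    covered-eq : ∀ s k x y l → s ≡ k * (x - y - l) + (s + k * (y - x + l))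
    covered-eq = solve-∀ ring
    -- The tangent at a = b = β / 2, where the bound is attained for a gap of exactly 1; the
    -- remainder is two squares.
    eq₁ : ∀ a b w β → a * ((w - 1ℚ) * β + a) + b * ((w - 1ℚ) * β + b) ≡
      w * β * (a + b) - ½ * (β * β) + (½ * ((a - b) * (a - b)) + ½ * ((a + b - β) * (a + b - β)))
    eq₁ = solve-∀ ring
    eq₂ : ∀ a b w β s t → w * β * (a + b) - ½ * (β * β) ≡ w * β * (s + t) - ½ * (β * β) + w * β * ((a - s) + (b - t))
    eq₂ = solve-∀ ring
    -- A gap of at least 1 absorbs the constant β² / 2. The loss w l β² x from β⁻ in place of β is
    -- at most (2w - 1) l β² x, whence the factor 2 in front of `l`.
    eq₃ : ∀ w β β⁻ l x d d′ y y′ → w * β * ((d - β * y) + (d′ - β * y′)) - ½ * (β * β) ≡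
      ½ * (2ℚ * w - 1ℚ) * (β * β) * (x - (y + y′) - 2ℚ * l * x) +
      (w * β * (d + d′ - β⁻ * x) + ½ * (β * β) * (x - (y + y′) - 1ℚ) + w * β * x * (l * β - (β - β⁻)) + (w - 1ℚ) * l * (β * β * x))
    eq₃ = solve-∀ ring
    bound : (x ≤ y + y′) ⊎ (1ℚ ≤ x - (y + y′)) → ½ * c * (β * β) * (x - (y + y′) - 2ℚ * l * x) ≤ a * (C + a) + b * (C + b)
    bound (inj₁ covered) = ≤-by (0≤+ (0≤+ (0≤* 0≤a (0≤+ 0≤C 0≤a)) (0≤* 0≤b (0≤+ 0≤C 0≤b)))
        (0≤* (0≤* (0≤* 0≤½ 0≤c) (0≤* 0≤β 0≤β)) (0≤+ (0≤- covered) (0≤* (0≤* 0≤2 0≤l) 0≤x))))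
      (covered-eq (a * (C + a) + b * (C + b)) (½ * c * (β * β)) x (y + y′) (2ℚ * l * x))
    bound (inj₂ uncovered) = ℚ.≤-trans
      (≤-by (0≤+ (0≤+ (0≤+ (0≤* (0≤* 0≤w 0≤β) (0≤- load)) (0≤* (0≤* 0≤½ (0≤² β)) (0≤- uncovered)))
              (0≤* (0≤* (0≤* 0≤w 0≤β) 0≤x) (0≤- gap))) (0≤* (0≤* 0≤w-1 0≤l) (0≤* (0≤² β) 0≤x)))
            (eq₃ w β β⁻ l x d d′ y y′))
      (ℚ.≤-trans (≤-by (0≤* (0≤* 0≤w 0≤β) (0≤+ (0≤- r≤a) (0≤- r≤b))) (eq₂ a b w β (d - β * y) (d′ - β * y′)))
        (≤-by (0≤+ (0≤* 0≤½ (0≤² (a - b))) (0≤* 0≤½ (0≤² (a + b - β)))) (eq₁ a b w β)))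

0≤dg : ∀ {n} c (L : MultiGraph n) p → (∀ e → 0ℚ ≤ c e) → 0ℚ ≤ dg c L p
0≤dg c L p 0≤c = 0≤∑ L (λ e → 0≤* (0≤inc e p) (0≤c e))

dg-++ : ∀ {n} c (K L : MultiGraph n) p → dg c (K ++ L) p ≡ dg c K p + dg c L p
dg-++ c K L p = ∑-++ K L (λ e → inc e p * c e)

cast-cover : ∀ {n} (y : Fin n → ℕ) (e : Edge n) → wt e ℕ.≤ y (u e) ℕ.+ y (v e) → wq e ≤ nat (y (u e)) + nat (y (v e))
cast-cover y e h = subst (wq e ≤_) (cast-+ (y (u e)) (y (v e))) (cast-≤ h)

-- In use, `H` is the bipartite graph H″, `K ++ U` the matching on slots with `K` inside `H`, and
-- `D` the even share of the weighted degree. The number `τ` balances the two halves of the AM-GM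
-- step and is fixed only in the final estimate.
module Cover
  {N : ℕ} (W : ℕ) (1≤W : 1 ℕ.≤ W) (β β⁻ l τ iτ : ℚ) (0<β : 0ℚ < β) (0≤l : 0ℚ ≤ l)
  (0<τ : 0ℚ < τ) (τ*iτ : τ * iτ ≡ 1ℚ) (β-gap : β - β⁻ ≤ l * β)
  (D : Fin N → ℚ) (0≤D : ∀ p → 0ℚ ≤ D p) (D≤ : ∀ p → D p ≤ β * nat W)
  (y : Fin N → ℕ) (y≤W : ∀ p → y p ℕ.≤ W)
  (H K U : MultiGraph N)
  (H-load : ∀ e → e ∈ H → D (u e) + D (v e) ≤ β * wq e)
  (U-load : ∀ e → e ∈ U → β⁻ * wq e ≤ D (u e) + D (v e))
  (H-cover : ∀ e → e ∈ H → wt e ℕ.≤ y (u e) ℕ.+ y (v e))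
  (K-cover : ∀ e → e ∈ K → wt e ℕ.≤ y (u e) ℕ.+ y (v e))
  (matching : ∀ p → dg one (K ++ U) p ≤ 1ℚ)
  where

  private
    w iW : ℚ
    w = nat W
    iW = ratio 1 W

    open Scalar w iW β (1≤cast 1≤W) (0≤ratio 1 W) (cast*ratio1 W 1≤W) 0<β

    y′ r μ : Fin N → ℚ
    y′ p = nat (y p)
    r p = D p - β * y′ p
    μ = dg one U

    0≤y′ : ∀ p → 0ℚ ≤ y′ p
    0≤y′ p = 0≤cast (y p)

    0≤μ : ∀ p → 0ℚ ≤ μ p
    0≤μ p = 0≤dg one U p (λ _ → 0≤1)

    μ≤1 : ∀ p → μ p ≤ 1ℚ
    μ≤1 p = ℚ.≤-trans (≤-by (0≤dg one K p (λ _ → 0≤1)) (trans (dg-++ one K U p) (ℚ.+-comm (dg one K p) (μ p)))) (matching p)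

    A B : Fin N → ℚ
    A p = μ p * φ⁺ C (r p)
    B p = φ⁺ C (- r p)

  -- This would vanish if `H` kept exactly half of the target degree at every slot.
  excess : Fin N → ℚ
  excess p = 2ℚ * dg wq H p - D p

  private
    edge-bound : ∀ e → e ∈ H → wq e * (A (u e) + A (v e)) ≤ wq e * (B (u e) + B (v e))
    edge-bound e e∈ = *-monoˡ (0≤cast (wt e)) (φ⁺-edge C (r (u e)) (r (v e)) (μ (u e)) (μ (v e)) 0≤C (μ≤1 (u e)) (μ≤1 (v e))
      (≤-by (0≤+ (0≤- (H-load e e∈)) (0≤* 0≤β (0≤- (cast-cover y e (H-cover e e∈)))))
            (eq (D (u e)) (D (v e)) β (wq e) (y′ (u e)) (y′ (v e)))))
      where
      eq : ∀ d d′ β w y y′ → 0ℚ ≡ (d - β * y) + (d′ - β * y′) + ((β * w - (d + d′)) + β * ((y + y′) - w))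
      eq = solve-∀ ring

    degree-bound : ∑ᶠ (λ p → dg wq H p * A p) ≤ ∑ᶠ (λ p → dg wq H p * B p)
    degree-bound = subst₂ _≤_ (sym (∑-dg wq H A)) (sym (∑-dg wq H B)) (∑-mono∈ H edge-bound)

    y-cases : ∀ p → (y′ p ≡ w) ⊎ (1ℚ + y′ p ≤ w)
    y-cases p with y p ℕ.≟ W
    ... | yes y≡W = inj₁ (cong nat y≡W)
    ... | no y≢W  = inj₂ (subst (_≤ w) (cast-suc (y p)) (cast-≤ (ℕ.≤∧≢⇒< (y≤W p) y≢W)))

    y-zero : ∀ p → (y′ p ≡ 0ℚ) ⊎ (1ℚ ≤ y′ p)
    y-zero p with y p
    ... | zero  = inj₁ nat-0
    ... | suc k = inj₂ (1≤cast (s≤s z≤n))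

    -- AM-GM, as 2 (E/2) (τ t) ≤ (E/2)² + τ² t²
    error-bound : ∀ p → excess p * (B p - A p) ≤ c * β * (τ * (μ p + y′ p) + ¼ * iτ * (excess p * excess p))
    error-bound p = *-cancelˡ-≤ (0<* (0<* 0<c 0<β) 0<τ)
      (≤-by (0≤+ (0≤² (½ * (c * β) * excess p - τ * (B p - A p))) (0≤* (0≤² τ) (0≤- difference)))
        (trans (eq₁ (c * β) τ iτ (μ p + y′ p) (excess p))
          (trans (cong (λ z → (c * β) * (c * β) * (τ * τ * (μ p + y′ p)) + ¼ * z * (c * β) * (c * β) * (excess p * excess p)) τ*iτ)
            (eq₂ (c * β) τ (μ p + y′ p) (excess p) (B p - A p)))))
      where
      difference : (B p - A p) * (B p - A p) ≤ (c * β) * (c * β) * (μ p + y′ p)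
      difference = difference-bound (D p) (y′ p) (μ p) (0≤D p) (D≤ p) (0≤y′ p) (cast-≤ (y≤W p)) (y-zero p) (0≤μ p) (μ≤1 p)
      eq₁ : ∀ k τ iτ m e → k * τ * (k * (τ * m + ¼ * iτ * (e * e))) ≡ k * k * (τ * τ * m) + ¼ * (τ * iτ) * k * k * (e * e)
      eq₁ = solve-∀ ring
      eq₂ : ∀ k τ m e t → k * k * (τ * τ * m) + ¼ * 1ℚ * k * k * (e * e) ≡
        k * τ * (e * t) + ((½ * k * e - τ * t) * (½ * k * e - τ * t) + τ * τ * (k * k * m - t * t))
      eq₂ = solve-∀ ring

    gap : Edge N → ℚ
    gap e = wq e - (y′ (u e) + y′ (v e))

    gap-cases : ∀ e → (wq e ≤ y′ (u e) + y′ (v e)) ⊎ (1ℚ ≤ gap e)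
    gap-cases e with wt e ℕ.≤? y (u e) ℕ.+ y (v e)
    ... | yes h = inj₁ (cast-cover y e h)
    ... | no ¬h = inj₂ (≤-by (0≤- step) (eq (wq e) (y′ (u e) + y′ (v e))))
      where
      step : 1ℚ + (y′ (u e) + y′ (v e)) ≤ wq e
      step = subst (_≤ wq e) (trans (cast-suc (y (u e) ℕ.+ y (v e))) (cong (1ℚ +_) (cast-+ (y (u e)) (y (v e))))) (cast-≤ (ℕ.≰⇒> ¬h))
      eq : ∀ w y → w - y ≡ 1ℚ + (w - (1ℚ + y))
      eq = solve-∀ ring

    U-weight : ℚ
    U-weight = ∑ U wq

    -- The factor μ in `A` is the degree in `U`, so double counting turns the right side into a sum
    -- over the edges of `U`.
    total-gap : ½ * c * (β * β) * (∑ U gap - 2ℚ * l * U-weight) ≤ ∑ᶠ (λ p → D p * A p)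
    total-gap = begin
      ½ * c * (β * β) * (∑ U gap - 2ℚ * l * U-weight)  ≡⟨ cong (λ z → ½ * c * (β * β) * (∑ U gap - z)) (sym (∑-*ˡ U (2ℚ * l) wq)) ⟩
      ½ * c * (β * β) * (∑ U gap - ∑ U (λ e → 2ℚ * l * wq e))     ≡⟨ cong (½ * c * (β * β) *_) (sym (∑-- U gap (λ e → 2ℚ * l * wq e))) ⟩
      ½ * c * (β * β) * ∑ U (λ e → gap e - 2ℚ * l * wq e)  ≡⟨ sym (∑-*ˡ U (½ * c * (β * β)) _) ⟩
      ∑ U (λ e → ½ * c * (β * β) * (gap e - 2ℚ * l * wq e))       ≤⟨ ∑-mono∈ U (λ e e∈ → ℚ.≤-trans
                        (U-bound β⁻ l (wq e) (D (u e)) (D (v e)) (y′ (u e)) (y′ (v e)) 0≤l β-gap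
                        (0≤cast (wt e)) (0≤y′ (u e)) (0≤y′ (v e)) (gap-cases e) (U-load e e∈))
                        (ℚ.≤-reflexive (sym (ℚ.*-identityˡ (D (u e) * φ⁺ C (r (u e)) + D (v e) * φ⁺ C (r (v e))))))) ⟩
      ∑ U (λ e → 1ℚ * (D (u e) * φ⁺ C (r (u e)) + D (v e) * φ⁺ C (r (v e))))
                        ≡⟨ sym (∑-dg one U (λ p → D p * φ⁺ C (r p))) ⟩
      ∑ᶠ (λ p → μ p * (D p * φ⁺ C (r p)))  ≡⟨ ∑-cong (allFin N) (λ p → eq (μ p) (D p) (φ⁺ C (r p))) ⟩
      ∑ᶠ (λ p → D p * A p)  ∎
      where
      open ℚ.≤-Reasoning
      eq : ∀ a b c → a * (b * c) ≡ b * (a * c)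
      eq = solve-∀ ring

    Y X : ℚ
    Y = ∑ᶠ y′
    X = ∑ᶠ (λ p → excess p * excess p)

    -- Writing D as twice the degree minus the excess, D (A - B) becomes 2 deg (A - B) + excess (B -
    -- A). The first term is nonpositive once summed, and the second is the error.
    pointwise : ∀ p → D p * A p ≤ ¼ * c * c * iW * β * β * y′ p + c * β * (τ * (μ p + y′ p) + ¼ * iτ * (excess p * excess p))
                                    + 2ℚ * (dg wq H p * A p - dg wq H p * B p)
    pointwise p = ≤-by (0≤+ (0≤- (B-bound (D p) (y′ p) (0≤y′ p) (y-cases p))) (0≤- (error-bound p)))
      (eq (D p) (A p) (B p) (dg wq H p) (¼ * c * c * iW * β * β * y′ p) (c * β * (τ * (μ p + y′ p) + ¼ * iτ * (excess p * excess p))))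
      where
      eq : ∀ d a b h s t → s + t + 2ℚ * (h * a - h * b) ≡ d * a + ((s - d * b) + (t - (2ℚ * h - d) * (b - a)))
      eq = solve-∀ ring

    total-degree : ∑ᶠ (λ p → D p * A p) ≤ ¼ * c * c * iW * β * β * Y + c * β * (τ * (2ℚ * ∑ U one + Y) + ¼ * iτ * X)
    total-degree = begin
      ∑ᶠ (λ p → D p * A p)  ≤⟨ ∑-mono (allFin N) pointwise ⟩
      ∑ᶠ (λ p → s₁ p + s₂ p + s₃ p)  ≡⟨ trans (∑-+ (allFin N) (λ p → s₁ p + s₂ p) s₃) (cong (_+ ∑ᶠ s₃) (∑-+ (allFin N) s₁ s₂)) ⟩
      ∑ᶠ s₁ + ∑ᶠ s₂ + ∑ᶠ s₃  ≤⟨ ≤-by (0≤- s₃≤0) (eq (∑ᶠ s₁ + ∑ᶠ s₂) (∑ᶠ s₃)) ⟩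
      ∑ᶠ s₁ + ∑ᶠ s₂  ≡⟨ cong₂ _+_ (∑-*ˡ (allFin N) (¼ * c * c * iW * β * β) y′) s₂≡ ⟩
      ¼ * c * c * iW * β * β * Y + c * β * (τ * (2ℚ * ∑ U one + Y) + ¼ * iτ * X) ∎
      where
      open ℚ.≤-Reasoning
      s₁ s₂ s₃ : Fin N → ℚ
      s₁ p = ¼ * c * c * iW * β * β * y′ p
      s₂ p = c * β * (τ * (μ p + y′ p) + ¼ * iτ * (excess p * excess p))
      s₃ p = 2ℚ * (dg wq H p * A p - dg wq H p * B p)
      eq : ∀ a b → a ≡ a + b + (0ℚ - b)
      eq = solve-∀ ring
      eq₃ : ∀ a b → 0ℚ ≡ 2ℚ * (a - b) + 2ℚ * (b - a)
      eq₃ = solve-∀ ring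
      s₃≤0 : ∑ᶠ s₃ ≤ 0ℚ
      s₃≤0 = ℚ.≤-trans (ℚ.≤-reflexive (trans (∑-*ˡ (allFin N) 2ℚ _) (cong (2ℚ *_) (∑-- (allFin N) _ _))))
        (≤-by (0≤* 0≤2 (0≤- degree-bound)) (eq₃ (∑ᶠ (λ p → dg wq H p * A p)) (∑ᶠ (λ p → dg wq H p * B p))))
      ∑μ : ∑ᶠ μ ≡ 2ℚ * ∑ U one
      ∑μ = trans (∑-cong (allFin N) (λ p → sym (ℚ.*-identityʳ (μ p)))) (trans (∑-dg one U (λ _ → 1ℚ))
        (trans (∑-cong U (λ _ → refl)) (∑-*ˡ U 2ℚ one)))
      s₂≡ : ∑ᶠ s₂ ≡ c * β * (τ * (2ℚ * ∑ U one + Y) + ¼ * iτ * X)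
      s₂≡ = trans (∑-*ˡ (allFin N) (c * β) _) (cong (c * β *_) (trans (∑-+ (allFin N) _ _)
        (cong₂ _+_ (trans (∑-*ˡ (allFin N) τ _) (cong (τ *_) (trans (∑-+ (allFin N) μ y′) (cong (_+ Y) ∑μ)))) (∑-*ˡ (allFin N) (¼ * iτ) _))))

    -- Weak duality with a deficit: every slot is used at most once, so the covering values along
    -- the matching add up to at most `Y`, and an edge of `U` may exceed its cover by its gap.
    matching-weight : ∑ K wq + ∑ U wq ≤ Y + ∑ U gap
    matching-weight = begin
      ∑ K wq + ∑ U wq  ≤⟨ ℚ.+-monoˡ-≤ (∑ U wq) (∑-mono∈ K (λ e e∈ → cast-cover y e (K-cover e e∈))) ⟩
      ∑ K s + ∑ U wq  ≡⟨ cong (∑ K s +_) (∑-cong U (λ e → eq (wq e) (s e))) ⟩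
      ∑ K s + ∑ U (λ e → s e + gap e)       ≡⟨ cong (∑ K s +_) (∑-+ U s gap) ⟩
      ∑ K s + (∑ U s + ∑ U gap)  ≡⟨ sym (ℚ.+-assoc (∑ K s) (∑ U s) (∑ U gap)) ⟩
      ∑ K s + ∑ U s + ∑ U gap  ≡⟨ cong (_+ ∑ U gap) (sym (∑-++ K U s)) ⟩
      ∑ (K ++ U) s + ∑ U gap  ≡⟨ cong (_+ ∑ U gap) (trans (∑-cong (K ++ U) (λ e → sym (ℚ.*-identityˡ (s e)))) (sym (∑-dg one (K ++ U) y′))) ⟩
      ∑ᶠ (λ p → dg one (K ++ U) p * y′ p) + ∑ U gap
                        ≤⟨ ℚ.+-monoˡ-≤ (∑ U gap) (∑-mono (allFin N) (λ p →
                        ℚ.≤-trans (*-mono (0≤dg one (K ++ U) p (λ _ → 0≤1)) (0≤y′ p) (matching p) ℚ.≤-refl) (ℚ.≤-reflexive (ℚ.*-identityˡ (y′ p))))) ⟩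
      Y + ∑ U gap  ∎
      where
      open ℚ.≤-Reasoning
      s : Edge N → ℚ
      s e = y′ (u e) + y′ (v e)
      eq : ∀ w s → w ≡ s + (w - s)
      eq = solve-∀ ring

  -- Divided by the factor on the left, the main term on the right becomes c / (2W) = 1 - 1/(2W)
  -- times `Y`.
  cover-inequality : ½ * c * (β * β) * (∑ K wq + ∑ U wq - Y - 2ℚ * l * ∑ U wq) ≤
    ¼ * c * c * iW * β * β * Y + c * β * (τ * (2ℚ * ∑ U one + Y) + ¼ * iτ * X)
  cover-inequality = ℚ.≤-trans
    (ℚ.≤-trans (*-monoˡ (0≤* (0≤* 0≤½ 0≤c) (0≤² β)) (≤-by (0≤- matching-weight) (eq (∑ K wq + ∑ U wq) Y (∑ U gap) (2ℚ * l * U-weight)))) total-gap) total-degree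
    where
    eq : ∀ m y g x → g - x ≡ m - y - x + (y + g - m)
    eq = solve-∀ ring

-- Bipartite matching duality

search : ∀ {A : Set} {P : A → Set} → (∀ x → Dec (P x)) → ∀ xs → (∃ λ x → x ∈ xs × P x) ⊎ (∀ x → x ∈ xs → ¬ P x)
search P? xs with any? P? xs
... | yes p = inj₁ (find p)
... | no ¬p = inj₂ (λ x x∈ px → ¬p (lose x∈ px))

∈-↭∷ : ∀ {A : Set} {x : A} {xs} → x ∈ xs → ∃ λ ys → xs ↭ x ∷ ys
∈-↭∷ {x = x} x∈ with ∈-∃++ x∈
... | ys , zs , refl = ys ++ zs , ↭.shift x ys zs

-- Membership alone says nothing about multiplicities. Irreflexivity makes the entries of `S`
-- distinct, so they can be taken out of `xs` one at a time.
submultiset : ∀ {A : Set} {R : A → A → Set} → (∀ {x y} → R x y → x ≢ y) →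
  ∀ {S xs : List A} → AllPairs R S → (∀ x → x ∈ S → x ∈ xs) → ∃ λ T → xs ↭ S ++ T
submultiset irr {[]}    {xs} []        S⊆ = xs , ↭-refl
submultiset irr {x ∷ S} {xs} (px ∷ pS) S⊆ with ∈-↭∷ (S⊆ x (here refl))
... | ys , xs↭ with submultiset irr {S} {ys} pS S⊆ys
  where
  S⊆ys : ∀ y → y ∈ S → y ∈ ys
  S⊆ys y y∈ with ↭.∈-resp-↭ xs↭ (S⊆ y (there y∈))
  ... | here y≡x  = ⊥-elim (irr (All.lookup px y∈) (sym y≡x))
  ... | there y∈′ = y∈′
...   | T , ys↭ = T , ↭-trans xs↭ (prep x ys↭)

bump : ∀ {n} → Fin n → (Fin n → ℕ) → Fin n → ℕ
bump a p v = if ⌊ a ≟ v ⌋ then suc (p v) else p v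

bump-≥ : ∀ {n} (a : Fin n) p v → p v ℕ.≤ bump a p v
bump-≥ a p v with a ≟ v
... | yes _ = ℕ.n≤1+n (p v)
... | no _  = ℕ.≤-refl

bump-≡ : ∀ {n} (a : Fin n) p → bump a p a ≡ suc (p a)
bump-≡ a p with a ≟ a
... | yes _ = refl
... | no a≢a = ⊥-elim (a≢a refl)

bump-≢ : ∀ {n} {a v : Fin n} p → a ≢ v → bump a p v ≡ p v
bump-≢ {a = a} {v} p a≢v with a ≟ v
... | yes a≡v = ⊥-elim (a≢v a≡v)
... | no _ = refl

∑-bump : ∀ {n} (a : Fin n) p → ∑ᶠ (λ v → nat (bump a p v)) ≡ 1ℚ + ∑ᶠ (λ v → nat (p v))
∑-bump {n} a p = begin
  ∑ᶠ (λ v → nat (bump a p v))  ≡⟨ ∑-cong (allFin n) pointwise ⟩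
  ∑ᶠ (λ v → ι a v * 1ℚ + nat (p v))     ≡⟨ ∑-+ (allFin n) (λ v → ι a v * 1ℚ) (λ v → nat (p v)) ⟩
  ∑ᶠ (λ v → ι a v * 1ℚ) + _  ≡⟨ cong (_+ ∑ᶠ (λ v → nat (p v))) (∑-ι a (λ _ → 1ℚ)) ⟩
  1ℚ + ∑ᶠ (λ v → nat (p v))  ∎
  where
  open ≡-Reasoning
  pointwise : ∀ v → nat (bump a p v) ≡ ι a v * 1ℚ + nat (p v)
  pointwise v with a ≟ v
  ... | yes _ = cast-suc (p v)
  ... | no _  = sym (ℚ.+-identityˡ (nat (p v)))

-- The accounting side of complementary slackness: a dual that vanishes off the matched vertices is
-- paid for by the matching edges.
∑-support : ∀ {A : Set} {n} (k : A → Fin n) S (g : Fin n → ℚ) → (∀ v → 0ℚ ≤ g v) →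
  (∀ v → (g v ≡ 0ℚ) ⊎ ∃ λ s → s ∈ S × k s ≡ v) → ∑ᶠ g ≤ ∑ S (λ s → g (k s))
∑-support {n = n} k S g 0≤g support = begin
  ∑ᶠ g  ≤⟨ ∑-mono (allFin n) pointwise ⟩
  ∑ᶠ (λ v → ∑ S (λ s → ι (k s) v * g v)) ≡⟨ ∑-swap (allFin n) S _ ⟩
  ∑ S (λ s → ∑ᶠ (λ v → ι (k s) v * g v)) ≡⟨ ∑-cong S (λ s → ∑-ι (k s) g) ⟩
  ∑ S (λ s → g (k s))  ∎
  where
  open ℚ.≤-Reasoning
  0≤term : ∀ v s → 0ℚ ≤ ι (k s) v * g v
  0≤term v s = 0≤* (0≤ι (k s) v) (0≤g v)
  pointwise : ∀ v → g v ≤ ∑ S (λ s → ι (k s) v * g v)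
  pointwise v with support v
  ... | inj₁ g≡0 = ℚ.≤-trans (ℚ.≤-reflexive g≡0) (0≤∑ S (0≤term v))
  ... | inj₂ (s , s∈ , refl) = ℚ.≤-trans
        (ℚ.≤-reflexive (sym (trans (cong (_* g (k s)) (ι-refl (k s))) (ℚ.*-identityˡ (g (k s)))))) (≤∑ S (0≤term (k s)) s∈)

-- An auction with unit price steps

module Auction {A : Set} {N : ℕ} (l r : A → Fin N) (w : A → ℕ) (es : List A) where

  Disjoint : A → A → Set
  Disjoint e f = l e ≢ l f × r e ≢ r f

  -- `best` is complementary slackness up to one unit, the size of a price step. `priced` persists
  -- because a right vertex, once matched, only ever changes its partner.
  record State : Set where
    field
      S      : List A
      p      : Fin N → ℕ
      S⊆     : ∀ e → e ∈ S → e ∈ es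
      disj   : AllPairs Disjoint S
      priced : ∀ v → 1 ℕ.≤ p v → ∃ λ e → e ∈ S × r e ≡ v
      best   : ∀ e f → e ∈ S → f ∈ es → l f ≡ l e → w f ℕ.+ p (r e) ℕ.≤ suc (w e) ℕ.+ p (r f)
      afford : ∀ e → e ∈ S → p (r e) ℕ.≤ w e

  module _ (s : State) where
    open State s

    Assigned : A → Set
    Assigned e = ∃ λ f → f ∈ S × l f ≡ l e

    Stop : Set
    Stop = ∀ e → e ∈ es → Assigned e ⊎ (w e ℕ.≤ p (r e))

    unassigned? : ∀ e → Dec (¬ (∃ λ f → f ∈ S × l f ≡ l e))
    unassigned? e with search (λ f → l f ≟ l e) S
    ... | inj₁ h = no (λ ¬h → ¬h h)
    ... | inj₂ h = yes (λ { (f , f∈ , eq) → h f f∈ eq })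

    -- The bidder evicts the present partner of the right end. Raising that one price makes it one
    -- unit worse for the new edge, which was optimal before, and can only make the alternatives of
    -- other bidders less attractive.
    assign : ∀ e → e ∈ es → ¬ Assigned e → p (r e) ℕ.< w e →
      (∀ f → f ∈ es → l f ≡ l e → w f ℕ.+ p (r e) ℕ.≤ w e ℕ.+ p (r f)) → State
    assign e e∈ un profit maximal = record
      { S      = S′
      ; p      = bump (r e) p
      ; S⊆     = λ { f (here refl) → e∈ ; f (there f∈) → S⊆ f (proj₁ (kept f∈)) }
      ; disj   = All.tabulate (λ {f} f∈ → (λ eq → un (f , proj₁ (kept f∈) , sym eq)) , (λ eq → proj₂ (kept f∈) (sym eq)))
                 ∷ AllPairs.filter⁺ (λ f → ¬? (r f ≟ r e)) disj
      ; priced = priced′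
      ; best   = best′
      ; afford = afford′
      }
      where
      S′ : List A
      S′ = e ∷ filter (λ f → ¬? (r f ≟ r e)) S
      kept : ∀ {f} → f ∈ filter (λ f → ¬? (r f ≟ r e)) S → f ∈ S × r f ≢ r e
      kept = ∈-filter⁻ (λ f → ¬? (r f ≟ r e))
      priced′ : ∀ v → 1 ℕ.≤ bump (r e) p v → ∃ λ f → f ∈ S′ × r f ≡ v
      priced′ v 1≤ with r e ≟ v
      ... | yes re≡v = e , here refl , re≡v
      ... | no re≢v with priced v 1≤
      ...   | f , f∈ , rf≡v = f , there (∈-filter⁺ (λ f → ¬? (r f ≟ r e)) f∈ (λ eq → re≢v (trans (sym eq) rf≡v))) , rf≡v
      best′ : ∀ g f → g ∈ S′ → f ∈ es → l f ≡ l g → w f ℕ.+ bump (r e) p (r g) ℕ.≤ suc (w g) ℕ.+ bump (r e) p (r f)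
      best′ g f (here refl) f∈ eq = ℕ.≤-trans (ℕ.≤-reflexive (trans (cong (w f ℕ.+_) (bump-≡ (r e) p)) (ℕ.+-suc (w f) (p (r e)))))
        (ℕ.≤-trans (s≤s (maximal f f∈ eq)) (ℕ.+-monoʳ-≤ (suc (w e)) (bump-≥ (r e) p (r f))))
      best′ g f (there g∈) f∈ eq = ℕ.≤-trans (ℕ.≤-reflexive (cong (w f ℕ.+_) (bump-≢ p (λ re≡ → proj₂ (kept g∈) (sym re≡)))))
        (ℕ.≤-trans (best g f (proj₁ (kept g∈)) f∈ eq) (ℕ.+-monoʳ-≤ (suc (w g)) (bump-≥ (r e) p (r f))))
      afford′ : ∀ g → g ∈ S′ → bump (r e) p (r g) ℕ.≤ w g
      afford′ g (here refl) = subst (ℕ._≤ w e) (sym (bump-≡ (r e) p)) profit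
      afford′ g (there g∈)  = subst (ℕ._≤ w g) (sym (bump-≢ p (λ re≡ → proj₂ (kept g∈) (sym re≡)))) (afford g (proj₁ (kept g∈)))

    Raised : Set
    Raised = ∃ λ s′ → ∑ᶠ (λ v → nat (State.p s′ v)) ≡ 1ℚ + ∑ᶠ (λ v → nat (p v))

    -- Among the edges at the left end of `e₀`, the one of largest profit is chosen; its profit is
    -- at least that of `e₀`, hence positive.
    bid : ∀ e₀ → e₀ ∈ es → ¬ Assigned e₀ → p (r e₀) ℕ.< w e₀ → Raised
    bid e₀ e₀∈ un profit₀ = from-argmin (argmin es (λ e → ι (l e) (l e₀)) (λ e → nat (p (r e)) - nat (w e)))
      where
      from-argmin : (∃ λ e → e ∈ es × 0ℚ < ι (l e) (l e₀) × ∀ f → f ∈ es → 0ℚ < ι (l f) (l e₀) → nat (p (r e)) - nat (w e) ≤ nat (p (r f)) - nat (w f))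
        ⊎ (∀ e → e ∈ es → ι (l e) (l e₀) ≤ 0ℚ) → Raised
      from-argmin (inj₂ none) = ⊥-elim (≰-< (ℚ.positive⁻¹ 1ℚ) (subst (_≤ 0ℚ) (ι-refl (l e₀)) (none e₀ e₀∈)))
      from-argmin (inj₁ (e , e∈ , same , minimal)) = assign e e∈ un′ profit maximal , ∑-bump (r e) p
        where
        l≡ : l e ≡ l e₀
        l≡ = 0<ι⇒≡ same
        un′ : ¬ Assigned e
        un′ (f , f∈ , eq) = un (f , f∈ , trans eq l≡)
        eq₁ : ∀ a b c d → b + c ≡ d + a + (c - d - (a - b))
        eq₁ = solve-∀ ring
        maximal : ∀ f → f ∈ es → l f ≡ l e → w f ℕ.+ p (r e) ℕ.≤ w e ℕ.+ p (r f)
        maximal f f∈ eq = cast-cancel-≤ (subst₂ _≤_ (sym (cast-+ (w f) (p (r e)))) (sym (cast-+ (w e) (p (r f))))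
          (≤-by (0≤- (minimal f f∈ (subst (0ℚ <_) (sym (trans (cong (λ x → ι x (l e₀)) (trans eq l≡)) (ι-refl (l e₀)))) (ℚ.positive⁻¹ 1ℚ))))
            (eq₁ (nat (p (r e))) (nat (w e)) (nat (p (r f))) (nat (w f)))))
        profit : p (r e) ℕ.< w e
        profit = ℕ.+-cancelˡ-< (w e₀) (p (r e)) (w e) (ℕ.≤-<-trans (maximal e₀ e₀∈ (sym l≡))
          (subst (w e ℕ.+ p (r e₀) ℕ.<_) (ℕ.+-comm (w e) (w e₀)) (ℕ.+-monoʳ-< (w e) profit₀)))

    step : Stop ⊎ Raised
    step with search (λ e → unassigned? e ×-dec (suc (p (r e)) ℕ.≤? w e)) es
    ... | inj₁ (e₀ , e₀∈ , un , profit) = inj₂ (bid e₀ e₀∈ un profit)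
    ... | inj₂ none = inj₁ stop
      where
      stop : Stop
      stop e e∈ with search (λ f → l f ≟ l e) S | suc (p (r e)) ℕ.≤? w e
      ... | inj₁ h | _     = inj₁ h
      ... | inj₂ _ | no ¬< = inj₂ (ℕ.≮⇒≥ ¬<)
      ... | inj₂ h | yes < = ⊥-elim (none e e∈ ((λ { (f , f∈ , eq) → h f f∈ eq }) , <))

  private
    -- A price never exceeds the weight of the edge matched there, so the prices have a crude upper
    -- bound; as every bid adds one to their sum, the same number serves as fuel.
    ceiling : ℕ
    ceiling = sum (map (λ _ → sum (map w es)) (allFin N))

    total : State → ℚ
    total s = ∑ᶠ (λ v → nat (State.p s v))

    total≤ : ∀ s → total s ≤ nat ceiling
    total≤ s = subst (total s ≤_) (sym (∑-cast (allFin N) (λ _ → sum (map w es)))) (∑-mono (allFin N) bounded)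
      where
      open State s
      bounded : ∀ v → nat (p v) ≤ nat (sum (map w es))
      bounded v with 1 ℕ.≤? p v
      ... | no ¬1≤ = cast-≤ {p v} {sum (map w es)} (ℕ.≤-trans (ℕ.≤-pred (ℕ.≰⇒> ¬1≤)) z≤n)
      ... | yes 1≤ with priced v 1≤
      ...   | e , e∈ , refl = ℚ.≤-trans (cast-≤ (afford e e∈))
              (subst (nat (w e) ≤_) (sym (∑-cast es w)) (≤∑ es (λ f → 0≤cast (w f)) (S⊆ e e∈)))

    run : ∀ fuel s → nat ceiling ≤ total s + nat fuel → ∃ Stop
    run fuel s bound with step s
    ... | inj₁ stop = s , stop
    run zero s bound | inj₂ (s′ , eq) = ⊥-elim (≰-< (ℚ.positive⁻¹ 1ℚ) (≤-by (0≤- (ℚ.≤-trans (subst (_≤ nat ceiling) eq (total≤ s′)) (subst (λ z → nat ceiling ≤ total s + z) nat-0 bound)))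
        (eq₁ (total s))))
      where
      eq₁ : ∀ t → 0ℚ ≡ 1ℚ + (t + 0ℚ - (1ℚ + t))
      eq₁ = solve-∀ ring
    run (suc fuel) s bound | inj₂ (s′ , eq) = run fuel s′ (subst (nat ceiling ≤_)
        (trans (cong (total s +_) (cast-suc fuel)) (trans (eq₁ (total s) (nat fuel)) (cong (_+ nat fuel) (sym eq)))) bound)
      where
      eq₁ : ∀ t f → t + (1ℚ + f) ≡ 1ℚ + t + f
      eq₁ = solve-∀ ring

    start : State
    start = record { S = [] ; p = λ _ → 0 ; S⊆ = λ _ () ; disj = [] ; priced = λ _ () ; best = λ _ _ () ; afford = λ _ () }

    -- The best profit still available at the left vertex `a`, truncated at zero: the least left
    -- dual compatible with the prices.
    surplus : List A → (Fin N → ℕ) → Fin N → ℕ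
    surplus []       p a = 0
    surplus (e ∷ fs) p a = (if ⌊ l e ≟ a ⌋ then w e ℕ.∸ p (r e) else 0) ℕ.⊔ surplus fs p a

    ≤surplus : ∀ fs p e → e ∈ fs → w e ℕ.∸ p (r e) ℕ.≤ surplus fs p (l e)
    ≤surplus (f ∷ fs) p e (there e∈) = ℕ.≤-trans (≤surplus fs p e e∈) (ℕ.m≤n⊔m _ (surplus fs p (l e)))
    ≤surplus (f ∷ fs) p e (here refl) with l e ≟ l e
    ... | yes _ = ℕ.m≤m⊔n (w e ℕ.∸ p (r e)) (surplus fs p (l e))
    ... | no ¬≡ = ⊥-elim (¬≡ refl)

    surplus≤ : ∀ fs p a k → (∀ f → f ∈ fs → l f ≡ a → w f ℕ.∸ p (r f) ℕ.≤ k) → surplus fs p a ℕ.≤ k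
    surplus≤ []       p a k h = z≤n
    surplus≤ (f ∷ fs) p a k h = ℕ.⊔-lub head (surplus≤ fs p a k (λ g g∈ → h g (there g∈)))
      where
      head : (if ⌊ l f ≟ a ⌋ then w f ℕ.∸ p (r f) else 0) ℕ.≤ k
      head with l f ≟ a
      ... | yes eq = h f (here refl) eq
      ... | no _   = z≤n

  -- Prices rise in unit steps, so the matching is optimal only up to one unit per matched edge.
  NearDuality : Set
  NearDuality = ∃ λ S → AllPairs Disjoint S × (∀ e → e ∈ S → e ∈ es) × Σ (Fin N → ℕ) λ yl → Σ (Fin N → ℕ) λ yr →
    (∀ e → e ∈ es → w e ℕ.≤ yl (l e) ℕ.+ yr (r e)) ×
    ∑ᶠ (λ v → nat (yl v)) + ∑ᶠ (λ v → nat (yr v)) ≤ ∑ S (λ e → nat (suc (w e)))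

  -- When no bid remains, unmatched left vertices have no surplus, and unmatched right vertices have
  -- price zero. The dual value is therefore collected along `S`, where `best` costs one unit per
  -- edge.
  prices-dual : ∀ s → Stop s → NearDuality
  prices-dual s stopped = S , disj , S⊆ , yl , p , cover , (begin
    ∑ᶠ yl′ + ∑ᶠ p′  ≤⟨ ℚ.+-mono-≤ (∑-support l S yl′ (λ v → 0≤cast (yl v)) yl-support) (∑-support r S p′ (λ v → 0≤cast (p v)) p-support) ⟩
    ∑ S (λ e → yl′ (l e)) + ∑ S (λ e → p′ (r e)) ≡⟨ sym (∑-+ S (λ e → yl′ (l e)) (λ e → p′ (r e))) ⟩
    ∑ S (λ e → yl′ (l e) + p′ (r e))  ≤⟨ ∑-mono∈ S (λ e e∈ → subst (_≤ nat (suc (w e))) (cast-+ (yl (l e)) (p (r e))) (cast-≤ (tight e e∈))) ⟩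
    ∑ S (λ e → nat (suc (w e)))  ∎)
    where
    open State s
    open ℚ.≤-Reasoning
    yl : Fin N → ℕ
    yl = surplus es p
    yl′ p′ : Fin N → ℚ
    yl′ v = nat (yl v)
    p′ v = nat (p v)
    cover : ∀ e → e ∈ es → w e ℕ.≤ yl (l e) ℕ.+ p (r e)
    cover e e∈ = ℕ.≤-trans (ℕ.m≤n+m∸n (w e) (p (r e)))
      (subst (p (r e) ℕ.+ (w e ℕ.∸ p (r e)) ℕ.≤_) (ℕ.+-comm (p (r e)) (yl (l e))) (ℕ.+-monoʳ-≤ (p (r e)) (≤surplus es p e e∈)))
    tight : ∀ e → e ∈ S → yl (l e) ℕ.+ p (r e) ℕ.≤ suc (w e)
    tight e e∈ = ℕ.≤-trans (ℕ.+-monoˡ-≤ (p (r e)) (surplus≤ es p (l e) (suc (w e) ℕ.∸ p (r e)) bound)) (ℕ.≤-reflexive (ℕ.m∸n+n≡m affordable))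
      where
      affordable : p (r e) ℕ.≤ suc (w e)
      affordable = ℕ.m≤n⇒m≤1+n (afford e e∈)
      bound : ∀ f → f ∈ es → l f ≡ l e → w f ℕ.∸ p (r f) ℕ.≤ suc (w e) ℕ.∸ p (r e)
      bound f f∈ eq = ℕ.m≤n+o⇒m∸n≤o (w f) (p (r f)) (ℕ.≤-trans (ℕ.m+n≤o⇒m≤o∸n (w f) (best e f e∈ f∈ eq))
        (ℕ.≤-reflexive (trans (cong (ℕ._∸ p (r e)) (ℕ.+-comm (suc (w e)) (p (r f)))) (ℕ.+-∸-assoc (p (r f)) affordable))))
    ≡0 : ∀ {m} → m ≡ 0 → nat m ≡ 0ℚ
    ≡0 m≡0 = trans (cong nat m≡0) nat-0
    yl-support : ∀ v → (yl′ v ≡ 0ℚ) ⊎ ∃ λ e → e ∈ S × l e ≡ v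
    yl-support v with search (λ e → l e ≟ v) S
    ... | inj₁ h = inj₂ h
    ... | inj₂ none = inj₁ (≡0 (ℕ.n≤0⇒n≡0 (surplus≤ es p v 0 bound)))
      where
      bound : ∀ f → f ∈ es → l f ≡ v → w f ℕ.∸ p (r f) ℕ.≤ 0
      bound f f∈ lf≡v with stopped f f∈
      ... | inj₁ (g , g∈ , lg≡lf) = ⊥-elim (none g g∈ (trans lg≡lf lf≡v))
      ... | inj₂ w≤p = ℕ.≤-reflexive (ℕ.m≤n⇒m∸n≡0 w≤p)
    p-support : ∀ v → (p′ v ≡ 0ℚ) ⊎ ∃ λ e → e ∈ S × r e ≡ v
    p-support v with 1 ℕ.≤? p v
    ... | yes 1≤ = inj₂ (priced v 1≤)
    ... | no ¬1≤ = inj₁ (≡0 (ℕ.n≤0⇒n≡0 (ℕ.≤-pred (ℕ.≰⇒> ¬1≤))))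

  near-duality : NearDuality
  near-duality = prices-dual (proj₁ outcome) (proj₂ outcome)
    where
    outcome : ∃ Stop
    outcome = run ceiling start (≤-by (0≤∑ (allFin N) (λ _ → 0≤cast 0)) (ℚ.+-comm (total start) (nat ceiling)))

-- Rounding a scaled dual

∑-upTo-∷ : ∀ k f → ∑ (upTo (suc k)) f ≡ f 0 + ∑ (upTo k) (f ∘ suc)
∑-upTo-∷ k f = cong (f 0 +_) (trans (cong (λ xs → ∑ xs f) (sym (List.map-upTo suc k))) (∑-map suc (upTo k) f))

∑-upTo-∷ʳ : ∀ k f → ∑ (upTo (suc k)) f ≡ ∑ (upTo k) f + f k
∑-upTo-∷ʳ k f = trans (cong (λ xs → ∑ xs f) (sym (List.upTo-∷ʳ k)))
  (trans (∑-++ (upTo k) (k ∷ []) f) (cong (∑ (upTo k) f +_) (ℚ.+-identityʳ (f k))))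

∑-upTo-reverse : ∀ k f → ∑ (upTo k) (λ θ → f (k ℕ.∸ suc θ)) ≡ ∑ (upTo k) f
∑-upTo-reverse zero    f = refl
∑-upTo-reverse (suc k) f = trans (∑-upTo-∷ k (λ θ → f (k ℕ.∸ θ))) (trans (cong (f k +_) (∑-upTo-reverse k f))
  (trans (ℚ.+-comm (f k) (∑ (upTo k) f)) (sym (∑-upTo-∷ʳ k f))))

module Rounding (k : ℕ) where

  K : ℕ
  K = suc k

  div : ℕ → ℚ
  div m = nat (m ℕ./ K)

  -- Hermite's identity. Raising `m` by one trades the term at θ = 0 for the one at θ = K, whose
  -- floor is larger by exactly one.
  hermite : ∀ m → ∑ (upTo K) (λ θ → div (m ℕ.+ θ)) ≡ nat m
  hermite zero = trans (∑-cong∈ (upTo K) (λ θ θ∈ → trans (cong nat (ℕ.m<n⇒m/n≡0 (∈-upTo⁻ θ∈))) nat-0)) (trans (∑-0 (upTo K)) (sym nat-0))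
  hermite (suc m) = begin
    ∑ (upTo K) (λ θ → div (suc m ℕ.+ θ))  ≡⟨ ∑-upTo-∷ʳ k (λ θ → div (suc m ℕ.+ θ)) ⟩
    ∑ (upTo k) (λ θ → div (suc m ℕ.+ θ)) + div (suc m ℕ.+ k) ≡⟨ cong₂ _+_ (∑-cong (upTo k) (λ θ → cong div (sym (ℕ.+-suc m θ)))) carry ⟩
    ∑ (upTo k) (λ θ → div (m ℕ.+ suc θ)) + (1ℚ + div (m ℕ.+ 0)) ≡⟨ eq (∑ (upTo k) (λ θ → div (m ℕ.+ suc θ))) (div (m ℕ.+ 0)) ⟩
    1ℚ + (div (m ℕ.+ 0) + ∑ (upTo k) (λ θ → div (m ℕ.+ suc θ))) ≡⟨ cong (1ℚ +_) (sym (∑-upTo-∷ k (λ θ → div (m ℕ.+ θ)))) ⟩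
    1ℚ + ∑ (upTo K) (λ θ → div (m ℕ.+ θ))  ≡⟨ cong (1ℚ +_) (hermite m) ⟩
    1ℚ + nat m  ≡⟨ sym (cast-suc m) ⟩
    nat (suc m)  ∎
    where
    open ≡-Reasoning
    eq : ∀ a b → a + (1ℚ + b) ≡ 1ℚ + (b + a)
    eq = solve-∀ ring
    carry : div (suc m ℕ.+ k) ≡ 1ℚ + div (m ℕ.+ 0)
    carry = trans (cong nat (trans (cong (ℕ._/ K) (trans (sym (ℕ.+-suc m k)) (ℕ.+-comm m K)))
      (trans (ℕ.+-distrib-/-∣ˡ {K} m (divides 1 (sym (ℕ.*-identityˡ K)))) (cong₂ ℕ._+_ (ℕ.n/n≡1 K) (cong (ℕ._/ K) (sym (ℕ.+-identityʳ m)))))))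
      (cast-suc ((m ℕ.+ 0) ℕ./ K))

  -- The two offsets add up to K - 1, while the two floors lose at most 2 (K - 1). So K times their
  -- sum is at least a + b - (K - 1), which is more than K (x - 1).
  floors-cover : ∀ x a b θ → θ ℕ.< K → K ℕ.* x ℕ.≤ a ℕ.+ b → x ℕ.≤ (a ℕ.+ θ) ℕ./ K ℕ.+ (b ℕ.+ (K ℕ.∸ suc θ)) ℕ./ K
  floors-cover x a b θ θ<K h = ℕ.≤-pred (ℕ.*-cancelˡ-< K x (suc (s ℕ.+ t)) (begin-strict
    K ℕ.* x  ≤⟨ h ⟩
    a ℕ.+ b  <⟨ ℕ.+-cancelʳ-< k (a ℕ.+ b) (K ℕ.* suc (s ℕ.+ t)) sum< ⟩
    K ℕ.* suc (s ℕ.+ t)  ∎))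
    where
    open ℕ.≤-Reasoning
    θ′ s t : ℕ
    θ′ = K ℕ.∸ suc θ
    s = (a ℕ.+ θ) ℕ./ K
    t = (b ℕ.+ θ′) ℕ./ K
    below : ∀ m → m ℕ.≤ k ℕ.+ (m ℕ./ K) ℕ.* K
    below m = ℕ.≤-trans (ℕ.≤-reflexive (ℕ.m≡m%n+[m/n]*n m K)) (ℕ.+-monoˡ-≤ ((m ℕ./ K) ℕ.* K) (ℕ.≤-pred (ℕ.m%n<n m K)))
    θ+θ′ : θ ℕ.+ θ′ ≡ k
    θ+θ′ = ℕ.suc-injective (ℕ.m+[n∸m]≡n θ<K)
    open import Data.Nat.Solver using (module +-*-Solver)
    open +-*-Solver
    sum< : a ℕ.+ b ℕ.+ k ℕ.< K ℕ.* suc (s ℕ.+ t) ℕ.+ k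
    sum< = begin-strict
      a ℕ.+ b ℕ.+ k  ≡⟨ cong (a ℕ.+ b ℕ.+_) (sym θ+θ′) ⟩
      a ℕ.+ b ℕ.+ (θ ℕ.+ θ′)  ≡⟨ solve 4 (λ a b c d → a :+ b :+ (c :+ d) := (a :+ c) :+ (b :+ d)) refl a b θ θ′ ⟩
      (a ℕ.+ θ) ℕ.+ (b ℕ.+ θ′)  ≤⟨ ℕ.+-mono-≤ (below (a ℕ.+ θ)) (below (b ℕ.+ θ′)) ⟩
      (k ℕ.+ s ℕ.* K) ℕ.+ (k ℕ.+ t ℕ.* K)  <⟨ ℕ.n<1+n _ ⟩
      suc ((k ℕ.+ s ℕ.* K) ℕ.+ (k ℕ.+ t ℕ.* K))    ≡⟨ solve 3 (λ k s t → con 1 :+ ((k :+ s :* (con 1 :+ k)) :+ (k :+ t :* (con 1 :+ k))) :=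
                        (con 1 :+ k) :* (con 1 :+ (s :+ t)) :+ k) refl k s t ⟩
      K ℕ.* suc (s ℕ.+ t) ℕ.+ k  ∎

module Egerváry {A : Set} {N : ℕ} (l r : A → Fin N) (w : A → ℕ) (es : List A) where

  private
    open Rounding (length es)

    -- As `K` exceeds the number of edges of any matching, an error of one unit per matched edge
    -- stays below one unit of original weight.
    scaled : A → ℕ
    scaled e = K ℕ.* w e

  open Auction l r scaled es public using (Disjoint)

  Duality : Set
  Duality = ∃ λ S → AllPairs Disjoint S × ∃ λ T → es ↭ S ++ T × Σ (Fin N → ℕ) λ yl → Σ (Fin N → ℕ) λ yr →
    (∀ e → e ∈ es → w e ℕ.≤ yl (l e) ℕ.+ yr (r e)) ×
    ∑ᶠ (λ v → nat (yl v)) + ∑ᶠ (λ v → nat (yr v)) ≤ ∑ S (λ e → nat (w e))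

  private
    round : Auction.NearDuality l r scaled es → Duality
    round (S , disj , S⊆ , yl , yr , cover , near) = S , disj , T , es↭ , fl θ , fr θ , cover′ , small′
      where
      open ℚ.≤-Reasoning
      split : ∃ λ T → es ↭ S ++ T
      split = submultiset (λ d x≡y → proj₁ d (cong l x≡y)) disj S⊆
      T = proj₁ split
      es↭ = proj₂ split

      -- The two sides are shifted in opposite directions: the cover survives for every θ, and on
      -- each side the shifts run through all residues, as Hermite's identity requires.
      fl fr : ℕ → Fin N → ℕ
      fl θ v = (yl v ℕ.+ θ) ℕ./ K
      fr θ v = (yr v ℕ.+ (K ℕ.∸ suc θ)) ℕ./ K

      size weightS : ℕ
      size = length S
      weightS = sum (map w S)

      size<K : size ℕ.< K
      size<K = s≤s (subst (size ℕ.≤_) (sym (trans (↭.↭-length es↭) (List.length-++ S))) (ℕ.m≤m+n size (length T)))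

      value : ℕ → ℕ
      value θ = sum (map (fl θ) (allFin N)) ℕ.+ sum (map (fr θ) (allFin N))

      value≡ : ∀ θ → nat (value θ) ≡ ∑ᶠ (λ v → nat (fl θ v)) + ∑ᶠ (λ v → nat (fr θ v))
      value≡ θ = trans (cast-+ (sum (map (fl θ) (allFin N))) (sum (map (fr θ) (allFin N)))) (cong₂ _+_ (∑-cast (allFin N) (fl θ)) (∑-cast (allFin N) (fr θ)))

      left : ∑ (upTo K) (λ θ → ∑ᶠ (λ v → nat (fl θ v))) ≡ ∑ᶠ (λ v → nat (yl v))
      left = trans (∑-swap (upTo K) (allFin N) _) (∑-cong (allFin N) (λ v → hermite (yl v)))

      right : ∑ (upTo K) (λ θ → ∑ᶠ (λ v → nat (fr θ v))) ≡ ∑ᶠ (λ v → nat (yr v))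
      right = trans (∑-swap (upTo K) (allFin N) _) (∑-cong (allFin N) (λ v →
        trans (∑-upTo-reverse K (λ θ → div (yr v ℕ.+ θ))) (hermite (yr v))))

      total-value : ∑ (upTo K) (λ θ → nat (value θ)) ≤ nat (K ℕ.* weightS ℕ.+ size)
      total-value = begin
        ∑ (upTo K) (λ θ → nat (value θ))  ≡⟨ trans (∑-cong (upTo K) value≡) (trans (∑-+ (upTo K) (λ θ → ∑ᶠ (λ v → nat (fl θ v))) (λ θ → ∑ᶠ (λ v → nat (fr θ v)))) (cong₂ _+_ left right)) ⟩
        ∑ᶠ (λ v → nat (yl v)) + ∑ᶠ (λ v → nat (yr v))   ≤⟨ near ⟩
        ∑ S (λ e → nat (suc (scaled e)))  ≡⟨ ∑-cong S (λ e → trans (cast-suc (scaled e)) (trans (ℚ.+-comm 1ℚ (nat (scaled e))) (cong (_+ 1ℚ) (cast-* K (w e))))) ⟩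
        ∑ S (λ e → nat K * nat (w e) + 1ℚ)  ≡⟨ trans (∑-+ S _ _) (cong₂ _+_ (trans (∑-*ˡ S (nat K) _) (cong (nat K *_) (sym (∑-cast S w)))) (∑-1 S)) ⟩
        nat K * nat weightS + nat size  ≡⟨ sym (trans (cast-+ (K ℕ.* weightS) size) (cong (_+ nat size) (cast-* K weightS))) ⟩
        nat (K ℕ.* weightS ℕ.+ size)  ∎

      -- The values over the K offsets add up to at most K w(S) + |S| < K (w(S) + 1), so not all of
      -- these integers can exceed w(S).
      small : ∃ λ θ → θ ∈ upTo K × value θ ℕ.≤ weightS
      small with search (λ θ → value θ ℕ.≤? weightS) (upTo K)
      ... | inj₁ h = h
      ... | inj₂ none = ⊥-elim (≰-< (cast-< {K ℕ.* weightS ℕ.+ size} {suc weightS ℕ.* K} sum<) (ℚ.≤-trans (begin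
        nat (suc weightS ℕ.* K)  ≡⟨ cast-* (suc weightS) K ⟩
        nat (suc weightS) * nat K  ≡⟨ cong (λ n → nat (suc weightS) * nat n) (sym (List.length-upTo K)) ⟩
        nat (suc weightS) * nat (length (upTo K))   ≡⟨ cong (nat (suc weightS) *_) (sym (∑-1 (upTo K))) ⟩
        nat (suc weightS) * ∑ (upTo K) (λ _ → 1ℚ)    ≡⟨ sym (∑-*ˡ (upTo K) (nat (suc weightS)) (λ _ → 1ℚ)) ⟩
        ∑ (upTo K) (λ _ → nat (suc weightS) * 1ℚ)    ≡⟨ ∑-cong (upTo K) (λ _ → ℚ.*-identityʳ (nat (suc weightS))) ⟩
        ∑ (upTo K) (λ _ → nat (suc weightS))  ≤⟨ ∑-mono∈ (upTo K) (λ θ θ∈ → cast-≤ {suc weightS} {value θ} (ℕ.≰⇒> (none θ θ∈))) ⟩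
        ∑ (upTo K) (λ θ → nat (value θ))  ∎) total-value))
        where
        sum< : K ℕ.* weightS ℕ.+ size ℕ.< suc weightS ℕ.* K
        sum< = subst (K ℕ.* weightS ℕ.+ size ℕ.<_) (trans (ℕ.+-comm (K ℕ.* weightS) K) (cong (K ℕ.+_) (ℕ.*-comm K weightS)))
          (ℕ.+-monoʳ-< (K ℕ.* weightS) size<K)

      θ = proj₁ small

      cover′ : ∀ e → e ∈ es → w e ℕ.≤ fl θ (l e) ℕ.+ fr θ (r e)
      cover′ e e∈ = floors-cover (w e) (yl (l e)) (yr (r e)) θ (∈-upTo⁻ (proj₁ (proj₂ small))) (cover e e∈)

      small′ : ∑ᶠ (λ v → nat (fl θ v)) + ∑ᶠ (λ v → nat (fr θ v)) ≤ ∑ S (λ e → nat (w e))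
      small′ = subst₂ _≤_ (value≡ θ) (∑-cast S w) (cast-≤ {value θ} {weightS} (proj₂ (proj₂ small)))

  duality : Duality
  duality = round (Auction.near-duality l r scaled es)

-- Balanced bipartitions

ι-idem : ∀ {n} (p q : Fin n) → ι p q * ι p q ≡ ι p q
ι-idem p q with p ≟ q
... | yes _ = refl
... | no _  = refl

1≤inc-u : ∀ {n} (e : Edge n) → 1ℚ ≤ inc e (u e)
1≤inc-u e = ≤-by (0≤ι (v e) (u e)) (cong (_+ ι (v e) (u e)) (ι-refl (u e)))

1≤inc-v : ∀ {n} (e : Edge n) → 1ℚ ≤ inc e (v e)
1≤inc-v e = ≤-by (0≤ι (u e) (v e)) (trans (ℚ.+-comm (ι (u e) (v e)) (ι (v e) (v e))) (cong (_+ ι (u e) (v e)) (ι-refl (v e))))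

-- In use, `m` is a weighted adjacency matrix, `energy σ` is the squared norm of m σ, and the
-- columns add up to the squared Frobenius norm, which is the expected energy of independent random
-- signs.
module Balancing {N : ℕ} (m : Fin N → Fin N → ℚ) (0≤m : ∀ p q → 0ℚ ≤ m p q) where

  lin : (Fin N → ℚ) → Fin N → ℚ
  lin σ p = ∑ᶠ (λ q → σ q * m p q)

  energy : (Fin N → ℚ) → ℚ
  energy σ = ∑ᶠ (λ p → lin σ p * lin σ p)

  column : Fin N → ℚ
  column q = ∑ᶠ (λ p → m p q * m p q)

  private
    0≤column : ∀ q → 0ℚ ≤ column q
    0≤column q = 0≤∑ (allFin N) (λ p → 0≤² (m p q))

    lin-ι : ∀ a p → lin (ι a) p ≡ m p a
    lin-ι a p = ∑-ι a (m p)

    lin-+ : ∀ σ g x p → lin (λ q → σ q + x * g q) p ≡ lin σ p + x * lin g p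
    lin-+ σ g x p = trans (∑-cong (allFin N) (λ q → eq (σ q) x (g q) (m p q)))
      (trans (∑-+ (allFin N) (λ q → σ q * m p q) (λ q → x * (g q * m p q))) (cong (lin σ p +_) (∑-*ˡ (allFin N) x (λ q → g q * m p q))))
      where
      eq : ∀ s x g m → (s + x * g) * m ≡ s * m + x * (g * m)
      eq = solve-∀ ring

    energy-+ : ∀ σ g x → x * x ≡ 1ℚ → energy (λ q → σ q + x * g q) ≡ energy σ + energy g + 2ℚ * (x * ∑ᶠ (λ p → lin σ p * lin g p))
    energy-+ σ g x x²≡1 = trans (∑-cong (allFin N) (λ p → trans (cong (λ z → z * z) (lin-+ σ g x p)) (trans (eq (lin σ p) x (lin g p))
        (cong (λ z → lin σ p * lin σ p + z * (lin g p * lin g p) + 2ℚ * x * (lin σ p * lin g p)) x²≡1))))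
      (trans (∑-+ (allFin N) (λ p → lin σ p * lin σ p + 1ℚ * (lin g p * lin g p)) (λ p → 2ℚ * x * (lin σ p * lin g p)))
        (cong₂ _+_ (trans (∑-+ (allFin N) (λ p → lin σ p * lin σ p) (λ p → 1ℚ * (lin g p * lin g p)))
            (cong (energy σ +_) (∑-cong (allFin N) (λ p → ℚ.*-identityˡ (lin g p * lin g p)))))
          (trans (∑-*ˡ (allFin N) (2ℚ * x) (λ p → lin σ p * lin g p)) (ℚ.*-assoc 2ℚ x _))))
      where
      eq : ∀ a x b → (a + x * b) * (a + x * b) ≡ a * a + x * x * (b * b) + 2ℚ * x * (a * b)
      eq = solve-∀ ring

  abstract

    -- One of the two signs makes the cross term nonpositive.
    sign-choice : ∀ σ g → ∃ λ x → x * x ≡ 1ℚ × energy (λ q → σ q + x * g q) ≤ energy σ + energy g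
    sign-choice σ g with ℚ.≤-total (∑ᶠ (λ p → lin σ p * lin g p)) 0ℚ
    ... | inj₁ ≤0 = 1ℚ , refl , subst (_≤ energy σ + energy g) (sym (energy-+ σ g 1ℚ refl))
          (≤-by (0≤* 0≤2 (0≤- ≤0)) (eq (energy σ + energy g) (∑ᶠ (λ p → lin σ p * lin g p))))
      where
      eq : ∀ a s → a ≡ a + 2ℚ * (1ℚ * s) + 2ℚ * (0ℚ - s)
      eq = solve-∀ ring
    ... | inj₂ 0≤ = - 1ℚ , refl , subst (_≤ energy σ + energy g) (sym (energy-+ σ g (- 1ℚ) refl))
          (≤-by (0≤* 0≤2 0≤) (eq (energy σ + energy g) (∑ᶠ (λ p → lin σ p * lin g p))))
      where
      eq : ∀ a s → a ≡ a + 2ℚ * (- 1ℚ * s) + 2ℚ * s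
      eq = solve-∀ ring

  -- Zero marks a sign not yet decided, so σ² is the indicator of the decided vertices and only
  -- their columns are charged.
  record Partial (σ : Fin N → ℚ) : Set where
    field
      ternary : ∀ q → (σ q ≡ 0ℚ) ⊎ (σ q * σ q ≡ 1ℚ)
      bounded : energy σ ≤ ∑ᶠ (λ q → σ q * σ q * column q)

  record Fits (σ g : Fin N → ℚ) : Set where
    field
      fresh : ∀ q → (g q ≡ 0ℚ) ⊎ (σ q ≡ 0ℚ × g q * g q ≡ 1ℚ)
      small : energy g ≤ ∑ᶠ (λ q → g q * g q * column q)

  private
    unit≢0 : ∀ {a} → a * a ≡ 1ℚ → a ≢ 0ℚ
    unit≢0 a²≡1 refl = ⊥-elim (ℚ.<⇒≢ (ℚ.positive⁻¹ 1ℚ) a²≡1)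

    unchanged : ∀ {σ g : Fin N → ℚ} x q → g q ≡ 0ℚ → σ q + x * g q ≡ σ q
    unchanged {σ} x q g≡0 = trans (cong (λ z → σ q + x * z) g≡0) (trans (cong (σ q +_) (ℚ.*-zeroʳ x)) (ℚ.+-identityʳ (σ q)))

  extend : ∀ σ g → Partial σ → Fits σ g → ∃ λ x → x * x ≡ 1ℚ × Partial (λ q → σ q + x * g q)
  extend σ g P F = x , x²≡1 , record { ternary = ternary′ ; bounded = bounded′ }
    where
    open Partial P
    open Fits F
    choice = sign-choice σ g
    x = proj₁ choice
    x²≡1 = proj₁ (proj₂ choice)
    σ′ : Fin N → ℚ
    σ′ q = σ q + x * g q
    fresh-eq : ∀ q → σ q ≡ 0ℚ → σ′ q * σ′ q ≡ σ q * σ q + g q * g q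
    fresh-eq q σ≡0 = trans (cong (λ z → (z + x * g q) * (z + x * g q)) σ≡0) (trans (eq x (g q))
      (trans (cong (λ z → 0ℚ * 0ℚ + z * (g q * g q)) x²≡1) (trans (cong (0ℚ * 0ℚ +_) (ℚ.*-identityˡ (g q * g q))) (cong (λ z → z * z + g q * g q) (sym σ≡0)))))
      where
      eq : ∀ x g → (0ℚ + x * g) * (0ℚ + x * g) ≡ 0ℚ * 0ℚ + x * x * (g * g)
      eq = solve-∀ ring
    square : ∀ q → σ′ q * σ′ q ≡ σ q * σ q + g q * g q
    square q with fresh q
    ... | inj₂ (σ≡0 , _) = fresh-eq q σ≡0
    ... | inj₁ g≡0 = trans (cong (λ z → z * z) (unchanged {σ} {g} x q g≡0)) (sym (trans (cong (λ z → σ q * σ q + z * z) g≡0) (ℚ.+-identityʳ (σ q * σ q))))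
    ternary′ : ∀ q → (σ′ q ≡ 0ℚ) ⊎ (σ′ q * σ′ q ≡ 1ℚ)
    ternary′ q with fresh q
    ... | inj₂ (σ≡0 , g²≡1) = inj₂ (trans (square q) (cong₂ _+_ (cong (λ z → z * z) σ≡0) g²≡1))
    ... | inj₁ g≡0 with ternary q
    ...   | inj₁ σ≡0  = inj₁ (trans (unchanged {σ} {g} x q g≡0) σ≡0)
    ...   | inj₂ σ²≡1 = inj₂ (trans (cong (λ z → z * z) (unchanged {σ} {g} x q g≡0)) σ²≡1)
    bounded′ : energy σ′ ≤ ∑ᶠ (λ q → σ′ q * σ′ q * column q)
    bounded′ = begin
      energy σ′  ≤⟨ proj₂ (proj₂ choice) ⟩
      energy σ + energy g  ≤⟨ ℚ.+-mono-≤ bounded small ⟩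
      _  ≡⟨ sym (∑-+ (allFin N) (λ q → σ q * σ q * column q) (λ q → g q * g q * column q)) ⟩
      ∑ᶠ (λ q → σ q * σ q * column q + g q * g q * column q) ≡⟨ ∑-cong (allFin N) (λ q → trans (sym (ℚ.*-distribʳ-+ (column q) (σ q * σ q) (g q * g q)))
                        (cong (_* column q) (sym (square q)))) ⟩
      ∑ᶠ (λ q → σ′ q * σ′ q * column q)  ∎
      where open ℚ.≤-Reasoning

  pair : Edge N → Fin N → ℚ
  pair e q = ι (u e) q - ι (v e) q

  private
    pair-square : ∀ e q → u e ≢ v e → pair e q * pair e q ≡ ι (u e) q + ι (v e) q
    pair-square e q u≢v with u e ≟ q | v e ≟ q
    ... | yes refl | yes v≡u = ⊥-elim (u≢v (sym v≡u))
    ... | yes _ | no _  = refl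
    ... | no _  | yes _ = refl
    ... | no _  | no _  = refl

    -- The entries of `m` are nonnegative, so the cross term created by opposite signs is negative:
    -- tying two vertices costs no more than signing them separately.
    pair-small : ∀ e → u e ≢ v e → energy (pair e) ≤ ∑ᶠ (λ q → pair e q * pair e q * column q)
    pair-small e u≢v = begin
      energy (pair e)  ≡⟨ ∑-cong (allFin N) (λ p → cong (λ z → z * z) (lin-pair p)) ⟩
      ∑ᶠ (λ p → (m p (u e) - m p (v e)) * (m p (u e) - m p (v e)))
                        ≤⟨ ∑-mono (allFin N) (λ p → ≤-by (0≤* 0≤2 (0≤* (0≤m p (u e)) (0≤m p (v e)))) (eq (m p (u e)) (m p (v e)))) ⟩
      ∑ᶠ (λ p → m p (u e) * m p (u e) + m p (v e) * m p (v e))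
                        ≡⟨ ∑-+ (allFin N) (λ p → m p (u e) * m p (u e)) (λ p → m p (v e) * m p (v e)) ⟩
      column (u e) + column (v e)        ≡⟨ sym (∑-inc e column) ⟩
      ∑ᶠ (λ q → inc e q * column q)      ≡⟨ ∑-cong (allFin N) (λ q → cong (_* column q) (sym (pair-square e q u≢v))) ⟩
      ∑ᶠ (λ q → pair e q * pair e q * column q) ∎
      where
      open ℚ.≤-Reasoning
      eq : ∀ a b → a * a + b * b ≡ (a - b) * (a - b) + 2ℚ * (a * b)
      eq = solve-∀ ring
      lin-pair : ∀ p → lin (pair e) p ≡ m p (u e) - m p (v e)
      lin-pair p = trans (∑-cong (allFin N) (λ q → eq′ (ι (u e) q) (ι (v e) q) (m p q)))
        (trans (∑-- (allFin N) (λ q → ι (u e) q * m p q) (λ q → ι (v e) q * m p q)) (cong₂ _-_ (lin-ι (u e) p) (lin-ι (v e) p)))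
        where
        eq′ : ∀ a b c → (a - b) * c ≡ a * c - b * c
        eq′ = solve-∀ ring

    point-small : ∀ a → energy (ι a) ≤ ∑ᶠ (λ q → ι a q * ι a q * column q)
    point-small a = ℚ.≤-reflexive (trans (∑-cong (allFin N) (λ p → cong (λ z → z * z) (lin-ι a p)))
      (sym (trans (∑-cong (allFin N) (λ q → cong (_* column q) (ι-idem a q))) (∑-ι a column))))

    fill : ∀ ps σ → Partial σ → ∃ λ σ′ → Partial σ′ × (∀ q → σ q * σ q ≡ 1ℚ → σ′ q ≡ σ q) × (∀ q → q ∈ ps → σ′ q * σ′ q ≡ 1ℚ)
    fill []       σ P = σ , P , (λ _ _ → refl) , λ _ ()
    fill (a ∷ ps) σ P with Partial.ternary P a
    ... | inj₂ σa with fill ps σ P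
    ...   | σ′ , P′ , keep , done = σ′ , P′ , keep ,
            λ { q (here refl) → trans (cong (λ z → z * z) (keep q σa)) σa ; q (there q∈) → done q q∈ }
    fill (a ∷ ps) σ P | inj₁ σa≡0 with extend σ (ι a) P (record { fresh = fresh ; small = point-small a })
      where
      fresh : ∀ q → (ι a q ≡ 0ℚ) ⊎ (σ q ≡ 0ℚ × ι a q * ι a q ≡ 1ℚ)
      fresh q with a ≟ q
      ... | yes refl = inj₂ (σa≡0 , refl)
      ... | no _     = inj₁ refl
    ... | x , x²≡1 , P₁ with fill ps (λ q → σ q + x * ι a q) P₁
    ...   | σ′ , P′ , keep , done = σ′ , P′ , keep′ , done′
      where
      at-a : (σ a + x * ι a a) * (σ a + x * ι a a) ≡ 1ℚ
      at-a = trans (cong₂ (λ y z → (y + x * z) * (y + x * z)) σa≡0 (ι-refl a)) (trans (eq x) x²≡1)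
        where
        eq : ∀ x → (0ℚ + x * 1ℚ) * (0ℚ + x * 1ℚ) ≡ x * x
        eq = solve-∀ ring
      keep′ : ∀ q → σ q * σ q ≡ 1ℚ → σ′ q ≡ σ q
      keep′ q σq = trans (keep q (trans (cong (λ z → z * z) same) σq)) same
        where
        same : σ q + x * ι a q ≡ σ q
        same = unchanged {σ} {ι a} x q (ι-≢ (λ { refl → unit≢0 σq σa≡0 }))
      done′ : ∀ q → q ∈ a ∷ ps → σ′ q * σ′ q ≡ 1ℚ
      done′ q (here refl) = trans (cong (λ z → z * z) (keep q at-a)) at-a
      done′ q (there q∈)  = done q q∈

    Opposite : (Fin N → ℚ) → MultiGraph N → Set
    Opposite σ L = ∀ e → e ∈ L → σ (u e) * σ (u e) ≡ 1ℚ × σ (v e) * σ (v e) ≡ 1ℚ × σ (u e) + σ (v e) ≡ 0ℚ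

    -- The last clause keeps vertices off `L` undecided, so that both ends of the next matching edge
    -- are still free when it is added.
    orient : ∀ L → NoLoops L → (∀ p → dg one L p ≤ 1ℚ) →
      ∃ λ σ → Partial σ × Opposite σ L × (∀ q → dg one L q ≤ 0ℚ → σ q ≡ 0ℚ)
    orient [] nl deg≤ = (λ _ → 0ℚ) , record { ternary = λ _ → inj₁ refl ; bounded = zero-bounded } , (λ _ ()) , λ _ _ → refl
      where
      zero-lin : ∀ p → lin (λ _ → 0ℚ) p ≡ 0ℚ
      zero-lin p = trans (∑-cong (allFin N) (λ q → ℚ.*-zeroˡ (m p q))) (∑-0 (allFin N))
      zero-bounded : energy (λ _ → 0ℚ) ≤ ∑ᶠ (λ q → 0ℚ * 0ℚ * column q)
      zero-bounded = subst (_≤ ∑ᶠ (λ q → 0ℚ * 0ℚ * column q)) (sym (trans (∑-cong (allFin N) (λ p → cong (λ z → z * z) (zero-lin p))) (∑-0 (allFin N))))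
        (0≤∑ (allFin N) (λ q → 0≤* (0≤² 0ℚ) (0≤column q)))
    orient (e ∷ L) nl deg≤ = step (orient L (λ f f∈ → nl f (there f∈)) (λ p → ℚ.≤-trans (≤-by (0≤* (0≤inc e p) 0≤1) (ℚ.+-comm (inc e p * 1ℚ) (dg one L p))) (deg≤ p)))
      where
      u≢v : u e ≢ v e
      u≢v = nl e (here refl)
      free : ∀ q → 1ℚ ≤ inc e q → dg one L q ≤ 0ℚ
      free q 1≤ = ≤-by (0≤+ (0≤- (deg≤ q)) (0≤- 1≤)) (eq (inc e q) (dg one L q))
        where
        eq : ∀ i d → 0ℚ ≡ d + (1ℚ - (i * 1ℚ + d) + (i - 1ℚ))
        eq = solve-∀ ring
      step : (∃ λ σ → Partial σ × Opposite σ L × (∀ q → dg one L q ≤ 0ℚ → σ q ≡ 0ℚ)) →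
        ∃ λ σ → Partial σ × Opposite σ (e ∷ L) × (∀ q → dg one (e ∷ L) q ≤ 0ℚ → σ q ≡ 0ℚ)
      step (σ , P , opp , zeros) = (λ q → σ q + x * pair e q) , proj₂ (proj₂ ext) , opp′ , zeros′
        where
        σu≡0 : σ (u e) ≡ 0ℚ
        σu≡0 = zeros (u e) (free (u e) (1≤inc-u e))
        σv≡0 : σ (v e) ≡ 0ℚ
        σv≡0 = zeros (v e) (free (v e) (1≤inc-v e))
        fresh : ∀ q → (pair e q ≡ 0ℚ) ⊎ (σ q ≡ 0ℚ × pair e q * pair e q ≡ 1ℚ)
        fresh q with u e ≟ q | v e ≟ q
        ... | yes refl | yes v≡u = ⊥-elim (u≢v (sym v≡u))
        ... | yes refl | no _    = inj₂ (σu≡0 , refl)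
        ... | no _     | yes refl = inj₂ (σv≡0 , refl)
        ... | no _     | no _    = inj₁ refl
        ext = extend σ (pair e) P (record { fresh = fresh ; small = pair-small e u≢v })
        x = proj₁ ext
        x²≡1 = proj₁ (proj₂ ext)
        pair-u : pair e (u e) ≡ 1ℚ
        pair-u = cong₂ _-_ (ι-refl (u e)) (ι-≢ {p = v e} {u e} (λ v≡u → u≢v (sym v≡u)))
        pair-v : pair e (v e) ≡ - 1ℚ
        pair-v = cong₂ _-_ (ι-≢ {p = u e} {v e} u≢v) (ι-refl (v e))
        at-u : σ (u e) + x * pair e (u e) ≡ x
        at-u = trans (cong₂ (λ a b → a + x * b) σu≡0 pair-u) (trans (ℚ.+-identityˡ (x * 1ℚ)) (ℚ.*-identityʳ x))
        at-v : σ (v e) + x * pair e (v e) ≡ - x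
        at-v = trans (cong₂ (λ a b → a + x * b) σv≡0 pair-v) (eq x)
          where
          eq : ∀ x → 0ℚ + x * - 1ℚ ≡ - x
          eq = solve-∀ ring
        kept : ∀ q → σ q * σ q ≡ 1ℚ → σ q + x * pair e q ≡ σ q
        kept q σq with fresh q
        ... | inj₁ g≡0 = unchanged {σ} {pair e} x q g≡0
        ... | inj₂ (σ≡0 , _) = ⊥-elim (unit≢0 σq σ≡0)
        opp′ : Opposite (λ q → σ q + x * pair e q) (e ∷ L)
        opp′ f (here refl) = trans (cong (λ z → z * z) at-u) x²≡1 , trans (cong (λ z → z * z) at-v) (trans (eq x) x²≡1) ,
          trans (cong₂ _+_ at-u at-v) (ℚ.+-inverseʳ x)
          where
          eq : ∀ x → (- x) * (- x) ≡ x * x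
          eq = solve-∀ ring
        opp′ f (there f∈) with opp f f∈
        ... | uu , vv , uv = trans (cong (λ z → z * z) (kept (u f) uu)) uu , trans (cong (λ z → z * z) (kept (v f) vv)) vv ,
              trans (cong₂ _+_ (kept (u f) uu) (kept (v f) vv)) uv
        zeros′ : ∀ q → dg one (e ∷ L) q ≤ 0ℚ → σ q + x * pair e q ≡ 0ℚ
        zeros′ q d≤0 = trans (unchanged {σ} {pair e} x q pair≡0) (zeros q (≤-by (0≤+ (0≤- d≤0) (0≤inc e q)) (eq (inc e q) (dg one L q))))
          where
          eq : ∀ i d → 0ℚ ≡ d + (0ℚ - (i * 1ℚ + d) + i)
          eq = solve-∀ ring
          inc≤0 : inc e q ≤ 0ℚ
          inc≤0 = ≤-by (0≤+ (0≤- d≤0) (0≤dg one L q (λ _ → 0≤1))) (eq′ (inc e q) (dg one L q))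
            where
            eq′ : ∀ i d → 0ℚ ≡ i + (0ℚ - (i * 1ℚ + d) + d)
            eq′ = solve-∀ ring
          pair≡0 : pair e q ≡ 0ℚ
          pair≡0 = cong₂ _-_
            (ι-≢ {p = u e} {q} (λ { refl → ≰-< (ℚ.positive⁻¹ 1ℚ) (ℚ.≤-trans (1≤inc-u e) inc≤0) }))
            (ι-≢ {p = v e} {q} (λ { refl → ≰-< (ℚ.positive⁻¹ 1ℚ) (ℚ.≤-trans (1≤inc-v e) inc≤0) }))

  balanced : ∀ L → NoLoops L → (∀ p → dg one L p ≤ 1ℚ) →
    ∃ λ (σ : Fin N → ℚ) → (∀ q → σ q * σ q ≡ 1ℚ) × (∀ e → e ∈ L → σ (u e) + σ (v e) ≡ 0ℚ) × energy σ ≤ ∑ᶠ column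
  balanced L nl deg≤ = finish (orient L nl deg≤)
    where
    finish : (∃ λ σ → Partial σ × Opposite σ L × (∀ q → dg one L q ≤ 0ℚ → σ q ≡ 0ℚ)) →
      ∃ λ (σ : Fin N → ℚ) → (∀ q → σ q * σ q ≡ 1ℚ) × (∀ e → e ∈ L → σ (u e) + σ (v e) ≡ 0ℚ) × energy σ ≤ ∑ᶠ column
    finish (σ , P , opp , _) with fill (allFin N) σ P
    ... | σ′ , P′ , keep , done = σ′ , all-done ,
      (λ e e∈ → trans (cong₂ _+_ (keep (u e) (proj₁ (opp e e∈))) (keep (v e) (proj₁ (proj₂ (opp e e∈))))) (proj₂ (proj₂ (opp e e∈)))) ,
      ℚ.≤-trans (Partial.bounded P′) (ℚ.≤-reflexive (∑-cong (allFin N) (λ q → trans (cong (_* column q) (all-done q)) (ℚ.*-identityˡ (column q)))))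
      where
      all-done : ∀ q → σ′ q * σ′ q ≡ 1ℚ
      all-done q = done q (∈-allFin q)

-- Splitting every vertex v into b v slots

∑-replicate : ∀ {A : Set} k (x : A) f → ∑ (List.replicate k x) f ≡ nat k * f x
∑-replicate zero    x f = sym (trans (cong (_* f x) nat-0) (ℚ.*-zeroˡ (f x)))
∑-replicate (suc k) x f = trans (cong (f x +_) (∑-replicate k x f)) (trans (eq (f x) (nat k)) (cong (_* f x) (sym (cast-suc k))))
  where
  eq : ∀ a k → a + k * a ≡ (1ℚ + k) * a
  eq = solve-∀ ring

∑-concatMap : ∀ {A B : Set} (h : A → List B) xs f → ∑ (List.concatMap h xs) f ≡ ∑ xs (λ x → ∑ (h x) f)
∑-concatMap h []       f = refl
∑-concatMap h (x ∷ xs) f = trans (∑-++ (h x) (List.concatMap h xs) f) (cong (∑ (h x) f +_) (∑-concatMap h xs f))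

∑-lookup : ∀ {A : Set} (xs : List A) f → ∑ᶠ (λ p → f (List.lookup xs p)) ≡ ∑ xs f
∑-lookup xs f = trans (sym (∑-map (List.lookup xs) (allFin (length xs)) f))
  (cong (λ ys → ∑ ys f) (trans (List.map-tabulate id (List.lookup xs)) (List.tabulate-lookup xs)))

-- All that matters about the slots is how many lie over each vertex; `∑-owner` states this as a
-- change of variables.
record Slots {n : ℕ} (b : Fin n → ℕ) : Set where
  field
    N       : ℕ
    owner   : Fin N → Fin n
    ∑-owner : ∀ (f : Fin n → ℚ) → ∑ᶠ (λ p → f (owner p)) ≡ ∑ᶠ (λ v → nat (b v) * f v)

slots : ∀ {n} (b : Fin n → ℕ) → Slots b
slots {n} b = record
  { N       = length all
  ; owner   = List.lookup all
  ; ∑-owner = λ f → trans (∑-lookup all f) (trans (∑-concatMap (λ v → List.replicate (b v) v) (allFin n) f)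
                (∑-cong (allFin n) (λ v → ∑-replicate (b v) v f)))
  }
  where
  all = List.concatMap (λ v → List.replicate (b v) v) (allFin n)

module Lifting {n : ℕ} (b : Fin n → ℕ) (1≤b : ∀ v → 1 ℕ.≤ b v) (sl : Slots b) where

  open Slots sl public

  bq ib : Fin n → ℚ
  bq v = nat (b v)
  ib v = ratio 1 (b v)

  bq*ib : ∀ v → bq v * ib v ≡ 1ℚ
  bq*ib v = cast*ratio1 (b v) (1≤b v)

  0≤ib : ∀ v → 0ℚ ≤ ib v
  0≤ib v = 0≤ratio 1 (b v)

  0<bq : ∀ v → 0ℚ < bq v
  0<bq v = 0<cast (1≤b v)

  π : Edge N → Edge n
  π e = edge (owner (u e)) (owner (v e)) (wt e)

  NoLoops-lift : ∀ {L′} → NoLoops (map π L′) → NoLoops L′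
  NoLoops-lift nl e e∈ u≡v = nl (π e) (∈-map⁺ π e∈) (cong owner u≡v)

  fiber-size : ∀ a → ∑ᶠ (λ p → ι a (owner p)) ≡ bq a
  fiber-size a = trans (∑-owner (ι a)) (trans (∑-cong (allFin n) (λ v → ℚ.*-comm (bq v) (ι a v))) (∑-ι a bq))

  -- There are `b a` slots over `a`, so one of them does no worse than the mean of `f` over the
  -- fiber.
  fiber-average : ∀ a (f : Fin N → ℚ) → ∃ λ p → owner p ≡ a × f p ≤ ib a * ∑ᶠ (λ p → ι a (owner p) * f p)
  fiber-average a f = proj₁ found , sym (0<ι⇒≡ (proj₁ (proj₂ found))) , proj₂ (proj₂ found)
    where
    s : ℚ
    s = ∑ᶠ (λ p → ι a (owner p) * f p)
    eq : ∀ i s b → i * s * b ≡ b * i * s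
    eq = solve-∀ ring
    found : ∃ λ p → 0ℚ < ι a (owner p) × f p ≤ ib a * s
    found = average (allFin N) (λ p → ι a (owner p)) f (ib a * s) (λ p → 0≤ι a (owner p))
      (subst (0ℚ <_) (sym (fiber-size a)) (0<bq a))
      (ℚ.≤-reflexive (sym (trans (cong (ib a * s *_) (fiber-size a)) (trans (eq (ib a) s (bq a)) (trans (cong (_* s) (bq*ib a)) (ℚ.*-identityˡ s))))))

  dg-fiber : ∀ (c : ∀ {k} → Edge k → ℚ) → (∀ e → c (π e) ≡ c e) → ∀ L′ (f : Fin n → ℚ) →
    ∑ᶠ (λ p → dg c L′ p * f (owner p)) ≡ ∑ᶠ (λ v → dg c (map π L′) v * f v)
  dg-fiber c c-π L′ f = trans (∑-dg c L′ (λ p → f (owner p))) (trans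
    (∑-cong L′ (λ e → cong (_* (f (owner (u e)) + f (owner (v e)))) (sym (c-π e))))
    (sym (trans (∑-dg c (map π L′) f) (∑-map π L′ _))))

  dg-owner : ∀ (c : ∀ {k} → Edge k → ℚ) → (∀ e → c (π e) ≡ c e) → ∀ L′ a →
    ∑ᶠ (λ p → ι a (owner p) * dg c L′ p) ≡ dg c (map π L′) a
  dg-owner c c-π L′ a = trans (∑-cong (allFin N) (λ p → ℚ.*-comm (ι a (owner p)) (dg c L′ p)))
    (trans (dg-fiber c c-π L′ (ι a)) (trans (∑-cong (allFin n) (λ v → ℚ.*-comm (dg c (map π L′) v) (ι a v))) (∑-ι a (dg c (map π L′)))))

  private
    cons-degree : ∀ (i j : Fin N) L′ → i ≢ j → dg one L′ i ≡ 0ℚ → dg one L′ j ≡ 0ℚ → (∀ p → dg one L′ p ≤ 1ℚ) →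
      ∀ p → (ι i p + ι j p) * 1ℚ + dg one L′ p ≤ 1ℚ
    cons-degree i j L′ i≢j di dj deg≤ p with i ≟ p | j ≟ p
    ... | yes refl | yes j≡i = ⊥-elim (i≢j (sym j≡i))
    ... | yes refl | no _    = ℚ.≤-reflexive (cong ((1ℚ + 0ℚ) * 1ℚ +_) di)
    ... | no _     | yes refl = ℚ.≤-reflexive (cong ((0ℚ + 1ℚ) * 1ℚ +_) dj)
    ... | no _     | no _    = ℚ.≤-trans (ℚ.≤-reflexive (ℚ.+-identityˡ (dg one L′ p))) (deg≤ p)

  -- Before `e` is added, the degrees in the fiber over either end sum to less than its capacity.
  -- Their mean is below 1, so some slot has degree 0 by integrality.
  lift-matching : ∀ L → NoLoops L → (∀ x → dg one L x ≤ bq x) → ∃ λ L′ → map π L′ ≡ L × (∀ p → dg one L′ p ≤ 1ℚ)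
  lift-matching [] nl deg≤ = [] , refl , λ _ → 0≤1
  lift-matching (e ∷ L) nl deg≤ = step (lift-matching L (λ f f∈ → nl f (there f∈))
      (λ x → ℚ.≤-trans (≤-by (0≤* (0≤inc e x) 0≤1) (ℚ.+-comm (inc e x * 1ℚ) (dg one L x))) (deg≤ x)))
    where
    step : (∃ λ L′ → map π L′ ≡ L × (∀ p → dg one L′ p ≤ 1ℚ)) → ∃ λ L′ → map π L′ ≡ e ∷ L × (∀ p → dg one L′ p ≤ 1ℚ)
    step (L′ , lift , deg′≤) = edge i j (wt e) ∷ L′ ,
      cong₂ _∷_ (cong₂ (λ x y → edge x y (wt e)) (proj₁ (proj₂ I)) (proj₁ (proj₂ J))) lift , cons-degree i j L′ i≢j (proj₂ (proj₂ I)) (proj₂ (proj₂ J)) deg′≤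
      where
      free : ∀ a → 1ℚ ≤ inc e a → ∃ λ p → owner p ≡ a × dg one L′ p ≡ 0ℚ
      free a 1≤ = p , op≡a , trans (sym (cast-deg L′ p nl′)) (trans (cong nat (ℕ.n<1⇒n≡0 (cast-cancel-< (subst₂ _<_ (sym (cast-deg L′ p nl′)) (sym nat-1) f<1)))) nat-0)
        where
        found : ∃ λ p → owner p ≡ a × dg one L′ p ≤ ib a * ∑ᶠ (λ p → ι a (owner p) * dg one L′ p)
        found = fiber-average a (dg one L′)
        p = proj₁ found
        op≡a = proj₁ (proj₂ found)
        f≤ = proj₂ (proj₂ found)
        nl′ : NoLoops L′
        nl′ = NoLoops-lift (subst NoLoops (sym lift) (λ f f∈ → nl f (there f∈)))
        f≤′ : dg one L′ p ≤ ib a * dg one L a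
        f≤′ = subst (λ z → dg one L′ p ≤ ib a * z) (trans (dg-owner one (λ _ → refl) L′ a) (cong (λ z → dg one z a) lift)) f≤
        scaled< : bq a * dg one L′ p < bq a * 1ℚ
        scaled< = ℚ.≤-<-trans (ℚ.≤-trans (*-monoˡ (0≤cast (b a)) f≤′) (ℚ.≤-reflexive
            (trans (eq (bq a) (ib a) (dg one L a)) (trans (cong (_* dg one L a) (bq*ib a)) (ℚ.*-identityˡ (dg one L a))))))
          (subst₂ _<_ (ℚ.+-identityˡ (dg one L a)) (sym (ℚ.*-identityʳ (bq a)))
            (ℚ.<-≤-trans (ℚ.+-monoˡ-< (dg one L a) (ℚ.positive⁻¹ 1ℚ)) (ℚ.≤-trans (ℚ.+-monoˡ-≤ (dg one L a) (ℚ.≤-trans 1≤ (ℚ.≤-reflexive (sym (ℚ.*-identityʳ (inc e a)))))) (deg≤ a))))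
          where
          eq : ∀ b i d → b * (i * d) ≡ b * i * d
          eq = solve-∀ ring
        f<1 : dg one L′ p < 1ℚ
        f<1 = ℚ.*-cancelˡ-<-nonNeg (bq a) {{ℚ.nonNegative (0≤cast (b a))}} scaled<
      I = free (u e) (1≤inc-u e)
      J = free (v e) (1≤inc-v e)
      i = proj₁ I
      j = proj₁ J
      i≢j : i ≢ j
      i≢j i≡j = nl e (here refl) (trans (sym (proj₁ (proj₂ I))) (trans (cong owner i≡j) (proj₁ (proj₂ J))))

-- Spreading edges evenly over the slots

-- Counting both orientations makes `mult` the symmetric weighted adjacency matrix.
joins : ∀ {n} → Edge n → Fin n → Fin n → ℚ
joins e p q = ι (u e) p * ι (v e) q + ι (u e) q * ι (v e) p

mult : ∀ {n} → MultiGraph n → Fin n → Fin n → ℚ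
mult L p q = ∑ L (λ e → joins e p q * wq e)

0≤joins : ∀ {n} (e : Edge n) p q → 0ℚ ≤ joins e p q
0≤joins e p q = 0≤+ (0≤* (0≤ι (u e) p) (0≤ι (v e) q)) (0≤* (0≤ι (u e) q) (0≤ι (v e) p))

0≤mult : ∀ {n} (L : MultiGraph n) p q → 0ℚ ≤ mult L p q
0≤mult L p q = 0≤∑ L (λ e → 0≤* (0≤joins e p q) (0≤cast (wt e)))

mult-sym : ∀ {n} (L : MultiGraph n) p q → mult L p q ≡ mult L q p
mult-sym L p q = ∑-cong L (λ e → cong (_* wq e) (ℚ.+-comm (ι (u e) p * ι (v e) q) (ι (u e) q * ι (v e) p)))

joins-row : ∀ {n} (e : Edge n) p (f : Fin n → ℚ) → ∑ᶠ (λ q → joins e p q * f q) ≡ ι (u e) p * f (v e) + ι (v e) p * f (u e)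
joins-row {n} e p f = trans (∑-cong (allFin n) (λ q → eq (ι (u e) p) (ι (v e) q) (ι (u e) q) (ι (v e) p) (f q)))
  (trans (∑-+ (allFin n) (λ q → ι (u e) p * (ι (v e) q * f q)) (λ q → ι (v e) p * (ι (u e) q * f q)))
    (cong₂ _+_ (trans (∑-*ˡ (allFin n) (ι (u e) p) (λ q → ι (v e) q * f q)) (cong (ι (u e) p *_) (∑-ι (v e) f)))
               (trans (∑-*ˡ (allFin n) (ι (v e) p) (λ q → ι (u e) q * f q)) (cong (ι (v e) p *_) (∑-ι (u e) f)))))
  where
  eq : ∀ a b c d f → (a * b + c * d) * f ≡ a * (b * f) + d * (c * f)
  eq = solve-∀ ring

mult-row : ∀ {n} (L : MultiGraph n) p (f : Fin n → ℚ) →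
  ∑ᶠ (λ q → mult L p q * f q) ≡ ∑ L (λ e → (ι (u e) p * f (v e) + ι (v e) p * f (u e)) * wq e)
mult-row {n} L p f = trans (∑-cong (allFin n) (λ q → sym (∑-*ʳ L (f q) (λ e → joins e p q * wq e))))
  (trans (∑-swap (allFin n) L (λ q e → joins e p q * wq e * f q))
    (∑-cong L (λ e → trans (∑-cong (allFin n) (λ q → eq (joins e p q) (wq e) (f q)))
      (trans (∑-*ʳ (allFin n) (wq e) (λ q → joins e p q * f q)) (cong (_* wq e) (joins-row e p f))))))
  where
  eq : ∀ a w f → a * w * f ≡ a * f * w
  eq = solve-∀ ring

joins-∑ : ∀ {n} (e : Edge n) (F : Fin n → Fin n → ℚ) → ∑ᶠ (λ p → ∑ᶠ (λ q → joins e p q * F p q)) ≡ F (u e) (v e) + F (v e) (u e)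
joins-∑ {n} e F = trans (∑-cong (allFin n) (λ p → joins-row e p (F p)))
  (trans (∑-+ (allFin n) (λ p → ι (u e) p * F p (v e)) (λ p → ι (v e) p * F p (u e)))
    (cong₂ _+_ (∑-ι (u e) (λ p → F p (v e))) (∑-ι (v e) (λ p → F p (u e)))))

-- The first sum penalises uneven degrees. The second penalises heavy bundles of parallel edges and
-- is the Frobenius norm that bounds the energy of the signing.
potential : ∀ {n} → MultiGraph n → ℚ
potential L = ∑ᶠ (λ p → dg wq L p * dg wq L p) + ∑ᶠ (λ p → ∑ᶠ (λ q → mult L p q * mult L p q))

private

  inc-square : ∀ {n} (e : Edge n) p → u e ≢ v e → inc e p * inc e p ≡ inc e p * 1ℚ
  inc-square e p u≢v with u e ≟ p | v e ≟ p
  ... | yes refl | yes v≡u = ⊥-elim (u≢v (sym v≡u))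
  ... | yes _ | no _  = refl
  ... | no _  | yes _ = refl
  ... | no _  | no _  = refl

  degree-part : ∀ {n} (e : Edge n) L → u e ≢ v e →
    ∑ᶠ (λ p → dg wq (e ∷ L) p * dg wq (e ∷ L) p) ≡
    ∑ᶠ (λ p → dg wq L p * dg wq L p) + (2ℚ * wq e * (dg wq L (u e) + dg wq L (v e)) + wq e * wq e * 2ℚ)
  degree-part {n} e L u≢v = trans (∑-cong (allFin n) pointwise)
    (trans (∑-+ (allFin n) (λ p → dg wq L p * dg wq L p) (λ p → inc e p * (2ℚ * wq e * dg wq L p + wq e * wq e * 1ℚ)))
      (cong (∑ᶠ (λ p → dg wq L p * dg wq L p) +_) (trans (∑-inc e (λ p → 2ℚ * wq e * dg wq L p + wq e * wq e * 1ℚ)) (eq′ (wq e) (dg wq L (u e)) (dg wq L (v e))))))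
    where
    eq : ∀ i w d → (i * w + d) * (i * w + d) ≡ d * d + (2ℚ * w * (i * d) + w * w * (i * i))
    eq = solve-∀ ring
    eq″ : ∀ i w d → d * d + (2ℚ * w * (i * d) + w * w * (i * 1ℚ)) ≡ d * d + i * (2ℚ * w * d + w * w * 1ℚ)
    eq″ = solve-∀ ring
    eq′ : ∀ w a b → 2ℚ * w * a + w * w * 1ℚ + (2ℚ * w * b + w * w * 1ℚ) ≡ 2ℚ * w * (a + b) + w * w * 2ℚ
    eq′ = solve-∀ ring
    pointwise : ∀ p → dg wq (e ∷ L) p * dg wq (e ∷ L) p ≡ dg wq L p * dg wq L p + inc e p * (2ℚ * wq e * dg wq L p + wq e * wq e * 1ℚ)
    pointwise p = trans (eq (inc e p) (wq e) (dg wq L p)) (trans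
      (cong (λ z → dg wq L p * dg wq L p + (2ℚ * wq e * (inc e p * dg wq L p) + wq e * wq e * z)) (inc-square e p u≢v))
      (eq″ (inc e p) (wq e) (dg wq L p)))

  pair-part : ∀ {n} (e : Edge n) L → u e ≢ v e →
    ∑ᶠ (λ p → ∑ᶠ (λ q → mult (e ∷ L) p q * mult (e ∷ L) p q)) ≡
    ∑ᶠ (λ p → ∑ᶠ (λ q → mult L p q * mult L p q)) + (2ℚ * 2ℚ * wq e * mult L (u e) (v e) + wq e * wq e * 2ℚ)
  pair-part {n} e L u≢v = trans
    (∑-cong (allFin n) (λ p → trans (∑-cong (allFin n) (λ q → eq (joins e p q) (wq e) (mult L p q)))
      (∑-+ (allFin n) (λ q → mult L p q * mult L p q) (λ q → joins e p q * F p q))))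
    (trans (∑-+ (allFin n) (λ p → ∑ᶠ (λ q → mult L p q * mult L p q)) (λ p → ∑ᶠ (λ q → joins e p q * F p q)))
      (cong (∑ᶠ (λ p → ∑ᶠ (λ q → mult L p q * mult L p q)) +_) (trans (joins-∑ e F) ends)))
    where
    F : Fin _ → Fin _ → ℚ
    F p q = 2ℚ * wq e * mult L p q + wq e * wq e * joins e p q
    eq : ∀ j w m → (j * w + m) * (j * w + m) ≡ m * m + j * (2ℚ * w * m + w * w * j)
    eq = solve-∀ ring
    uv : joins e (u e) (v e) ≡ 1ℚ
    uv = cong₂ _+_ (cong₂ _*_ (ι-refl (u e)) (ι-refl (v e))) (trans (cong (_* ι (v e) (u e)) (ι-≢ {p = u e} {v e} u≢v)) (ℚ.*-zeroˡ (ι (v e) (u e))))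
    vu : joins e (v e) (u e) ≡ 1ℚ
    vu = trans (ℚ.+-comm (ι (u e) (v e) * ι (v e) (u e)) (ι (u e) (u e) * ι (v e) (v e))) uv
    eq′ : ∀ w a → 2ℚ * w * a + w * w * 1ℚ + (2ℚ * w * a + w * w * 1ℚ) ≡ 2ℚ * 2ℚ * w * a + w * w * 2ℚ
    eq′ = solve-∀ ring
    ends : F (u e) (v e) + F (v e) (u e) ≡ 2ℚ * 2ℚ * wq e * mult L (u e) (v e) + wq e * wq e * 2ℚ
    ends = trans (cong₂ _+_ (cong (λ z → 2ℚ * wq e * mult L (u e) (v e) + wq e * wq e * z) uv)
                            (cong₂ (λ y z → 2ℚ * wq e * y + wq e * wq e * z) (mult-sym L (v e) (u e)) vu))
                 (eq′ (wq e) (mult L (u e) (v e)))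

potential-∷ : ∀ {n} (e : Edge n) L → u e ≢ v e →
  potential (e ∷ L) ≡ potential L + (2ℚ * wq e * (dg wq L (u e) + (dg wq L (v e) + 2ℚ * mult L (u e) (v e))) + 2ℚ * 2ℚ * (wq e * wq e))
potential-∷ e L u≢v = trans (cong₂ _+_ (degree-part e L u≢v) (pair-part e L u≢v))
  (eq (∑ᶠ (λ p → dg wq L p * dg wq L p)) (∑ᶠ (λ p → ∑ᶠ (λ q → mult L p q * mult L p q))) (wq e) (dg wq L (u e)) (dg wq L (v e)) (mult L (u e) (v e)))
  where
  eq : ∀ s t w a b m → s + (2ℚ * w * (a + b) + w * w * 2ℚ) + (t + (2ℚ * 2ℚ * w * m + w * w * 2ℚ)) ≡
    s + t + (2ℚ * w * (a + (b + 2ℚ * m)) + 2ℚ * 2ℚ * (w * w))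
  eq = solve-∀ ring

betweenᵇ-ι : ∀ {n} (e : Edge n) a c → a ≢ c → ι (u e) a * ι (v e) c + ι (v e) a * ι (u e) c ≡ ⟨ betweenᵇ a c e ⟩
betweenᵇ-ι e a c a≢c with u e ≟ a | v e ≟ c | u e ≟ c | v e ≟ a
... | yes p | _     | yes q | _     = ⊥-elim (a≢c (trans (sym p) q))
... | _     | yes p | _     | yes q = ⊥-elim (a≢c (trans (sym q) p))
... | yes _ | yes _ | no _  | no _  = refl
... | yes _ | no _  | no _  | yes _ = refl
... | yes _ | no _  | no _  | no _  = refl
... | no _  | yes _ | yes _ | no _  = refl
... | no _  | yes _ | no _  | no _  = refl
... | no _  | no _  | yes _ | yes _ = refl
... | no _  | no _  | yes _ | no _  = refl
... | no _  | no _  | no _  | yes _ = refl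
... | no _  | no _  | no _  | no _  = refl

module Spreading {n : ℕ} (b : Fin n → ℕ) (1≤b : ∀ v → 1 ℕ.≤ b v) (sl : Slots b) (W : ℕ) where

  open Lifting b 1≤b sl

  private
    w : ℚ
    w = nat W

    8ℚ : ℚ
    8ℚ = 2ℚ * 2ℚ * 2ℚ

  -- Asked for both orders of `x` and `y`, the last bound is min(b x, b y): this is where relevance
  -- of the edges enters.
  Thin : MultiGraph n → Set
  Thin L = NoLoops L × (∀ e → e ∈ L → wt e ℕ.≤ W) × (∀ x y → length (edgesBetween L x y) ℕ.≤ b y)

  -- The sum of squared degrees over the slots if every vertex shared its weighted degree equally
  -- among them.
  ideal : MultiGraph n → ℚ
  ideal L = ∑ᶠ (λ x → ib x * (dg wq L x * dg wq L x))

  private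
    thin-tail : ∀ {e L} → Thin (e ∷ L) → Thin L
    thin-tail {e} {L} (nl , w≤ , few) = (λ f f∈ → nl f (there f∈)) , (λ f f∈ → w≤ f (there f∈)) , fewer
      where
      fewer : ∀ x y → length (edgesBetween L x y) ℕ.≤ b y
      fewer x y with betweenᵇ x y e | few x y
      ... | true  | h = ℕ.≤-trans (ℕ.n≤1+n _) h
      ... | false | h = h

    -- Edges from slot `i` to the fiber over `c` project to edges between `a` and `c`, of which
    -- there are at most `b c`, each of weight at most W. The mean multiplicity over that fiber is
    -- thus at most W.
    row-bound : ∀ L L′ → map π L′ ≡ L → Thin L → ∀ i a c → owner i ≡ a → a ≢ c →
      ∑ᶠ (λ q → ι c (owner q) * mult L′ i q) ≤ w * bq c
    row-bound L L′ refl (nl , w≤ , few) i a c refl a≢c = begin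
      ∑ᶠ (λ q → ι c (owner q) * mult L′ i q)       ≡⟨ ∑-cong (allFin N) (λ q → ℚ.*-comm (ι c (owner q)) (mult L′ i q)) ⟩
      ∑ᶠ (λ q → mult L′ i q * ι c (owner q))       ≡⟨ mult-row L′ i (λ q → ι c (owner q)) ⟩
      ∑ L′ (λ e → (ι (u e) i * ι c (owner (v e)) + ι (v e) i * ι c (owner (u e))) * wq e)
                        ≤⟨ ∑-mono∈ L′ termwise ⟩
      ∑ L′ (λ e → ⟨ betweenᵇ a c (π e) ⟩ * w)      ≡⟨ trans (∑-*ʳ L′ w (λ e → ⟨ betweenᵇ a c (π e) ⟩)) (cong (_* w) (sym (∑-map π L′ (λ e → ⟨ betweenᵇ a c e ⟩)))) ⟩
      ∑ L (λ e → ⟨ betweenᵇ a c e ⟩) * w  ≡⟨ cong (_* w) (trans (∑-cong L (λ e → sym (ℚ.*-identityʳ ⟨ betweenᵇ a c e ⟩)))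
                        (trans (sym (∑-filter (betweenᵇ a c) L (λ _ → 1ℚ))) (∑-1 (edgesBetween L a c)))) ⟩
      nat (length (edgesBetween L a c)) * w       ≤⟨ *-mono (0≤cast (length (edgesBetween L a c))) (0≤cast W) (cast-≤ {length (edgesBetween L a c)} {b c} (few a c)) ℚ.≤-refl ⟩
      bq c * w  ≡⟨ ℚ.*-comm (bq c) w ⟩
      w * bq c  ∎
      where
      open ℚ.≤-Reasoning
      ι-owner : ∀ x → ι x i ≤ ι (owner x) a
      ι-owner x with x ≟ i
      ... | yes refl = ℚ.≤-reflexive (sym (ι-refl (owner i)))
      ... | no _     = 0≤ι (owner x) a
      termwise : ∀ e → e ∈ L′ → (ι (u e) i * ι c (owner (v e)) + ι (v e) i * ι c (owner (u e))) * wq e ≤ ⟨ betweenᵇ a c (π e) ⟩ * w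
      termwise e e∈ = *-mono (0≤+ (0≤* (0≤ι (u e) i) (0≤ι c (owner (v e)))) (0≤* (0≤ι (v e) i) (0≤ι c (owner (u e))))) (0≤cast W)
        (ℚ.≤-trans (ℚ.+-mono-≤ (half (u e) (v e)) (half (v e) (u e))) (ℚ.≤-reflexive (betweenᵇ-ι (π e) a c a≢c)))
        (cast-≤ (w≤ (π e) (∈-map⁺ π e∈)))
        where
        half : ∀ x y → ι x i * ι c (owner y) ≤ ι (owner x) a * ι (owner y) c
        half x y = *-mono (0≤ι x i) (0≤ι (owner y) c) (ι-owner x) (ℚ.≤-reflexive (ι-sym c (owner y)))

    ideal-∷ : ∀ e L → ideal L + 2ℚ * wq e * (ib (u e) * dg wq L (u e) + ib (v e) * dg wq L (v e)) ≤ ideal (e ∷ L)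
    ideal-∷ e L = begin
      ideal L + 2ℚ * wq e * (ib (u e) * dg wq L (u e) + ib (v e) * dg wq L (v e))
        ≡⟨ cong (λ z → ideal L + 2ℚ * wq e * z) (sym (∑-inc e (λ x → ib x * dg wq L x))) ⟩
      ideal L + 2ℚ * wq e * ∑ᶠ (λ x → inc e x * (ib x * dg wq L x))
        ≡⟨ cong (ideal L +_) (sym (∑-*ˡ (allFin n) (2ℚ * wq e) (λ x → inc e x * (ib x * dg wq L x)))) ⟩
      ideal L + ∑ᶠ (λ x → 2ℚ * wq e * (inc e x * (ib x * dg wq L x)))
        ≡⟨ sym (∑-+ (allFin n) (λ x → ib x * (dg wq L x * dg wq L x)) (λ x → 2ℚ * wq e * (inc e x * (ib x * dg wq L x)))) ⟩
      ∑ᶠ (λ x → ib x * (dg wq L x * dg wq L x) + 2ℚ * wq e * (inc e x * (ib x * dg wq L x)))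
        ≤⟨ ∑-mono (allFin n) (λ x → ≤-by (0≤* (0≤ib x) (0≤² (inc e x * wq e))) (eq (ib x) (dg wq L x) (inc e x) (wq e))) ⟩
      ideal (e ∷ L) ∎
      where
      open ℚ.≤-Reasoning
      eq : ∀ b d i w → b * ((i * w + d) * (i * w + d)) ≡ b * (d * d) + 2ℚ * w * (i * (b * d)) + b * (i * w * (i * w))
      eq = solve-∀ ring

  -- The edges of `J` are placed greedily. With both ends chosen no worse than average, the
  -- potential grows by at most the growth of `ideal` plus 4 w W + 4 w² ≤ 8 W w for an edge of
  -- weight w.
  spread : ∀ K K′ → map π K′ ≡ K → (potential K′ ≤ ideal K + 8ℚ * w * ∑ K wq) → ∀ J → Thin (J ++ K) →
    ∃ λ J′ → map π J′ ≡ J × potential (J′ ++ K′) ≤ ideal (J ++ K) + 8ℚ * w * ∑ (J ++ K) wq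
  spread K K′ liftK base [] thin = [] , refl , base
  spread K K′ liftK base (e ∷ J) thin = step (spread K K′ liftK base J (thin-tail thin))
    where
    L = J ++ K
    step : (∃ λ J′ → map π J′ ≡ J × potential (J′ ++ K′) ≤ ideal L + 8ℚ * w * ∑ L wq) →
      ∃ λ J′ → map π J′ ≡ e ∷ J × potential (J′ ++ K′) ≤ ideal (e ∷ L) + 8ℚ * w * ∑ (e ∷ L) wq
    step (J′ , liftJ , bound) = e′ ∷ J′ , cong₂ _∷_ (cong₂ (λ x y → edge x y (wt e)) oi oj) liftJ , (begin
      potential (e′ ∷ L′)  ≡⟨ potential-∷ e′ L′ i≢j ⟩
      potential L′ + (2ℚ * wq e * (d i + (d j + 2ℚ * mult L′ i j)) + 2ℚ * 2ℚ * (wq e * wq e))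
                        ≤⟨ ≤-by slack (eq (potential L′) (wq e) (d i) (d j + 2ℚ * mult L′ i j) w (ideal L) (ideal (e ∷ L)) (∑ L wq)
                        (ib (u e) * dg wq L (u e)) (ib (v e) * dg wq L (v e))) ⟩
      ideal (e ∷ L) + 8ℚ * w * ∑ (e ∷ L) wq  ∎)
      where
      open ℚ.≤-Reasoning
      L′ : MultiGraph N
      L′ = J′ ++ K′
      liftL : map π L′ ≡ L
      liftL = trans (List.map-++ π J′ K′) (cong₂ _++_ liftJ liftK)
      d : Fin N → ℚ
      d = dg wq L′
      I = fiber-average (u e) d
      i = proj₁ I
      oi = proj₁ (proj₂ I)
      owner-degree : ∀ a → ∑ᶠ (λ p → ι a (owner p) * d p) ≡ dg wq L a
      owner-degree a = trans (dg-owner wq (λ _ → refl) L′ a) (cong (λ z → dg wq z a) liftL)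
      di≤ : d i ≤ ib (u e) * dg wq L (u e)
      di≤ = subst (λ z → d i ≤ ib (u e) * z) (owner-degree (u e)) (proj₂ (proj₂ I))
      u≢v : u e ≢ v e
      u≢v = proj₁ thin e (here refl)
      -- The second end balances degree against multiplicity. The factor 2 is that of the increment
      -- of the potential, which counts each pair of slots in both orders.
      Jv = fiber-average (v e) (λ q → d q + 2ℚ * mult L′ i q)
      j = proj₁ Jv
      oj = proj₁ (proj₂ Jv)
      row : ∑ᶠ (λ q → ι (v e) (owner q) * (d q + 2ℚ * mult L′ i q)) ≤ dg wq L (v e) + 2ℚ * (w * bq (v e))
      row = begin
        ∑ᶠ (λ q → ι (v e) (owner q) * (d q + 2ℚ * mult L′ i q))
          ≡⟨ ∑-cong (allFin N) (λ q → eq′ (ι (v e) (owner q)) (d q) (mult L′ i q)) ⟩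
        ∑ᶠ (λ q → ι (v e) (owner q) * d q + 2ℚ * (ι (v e) (owner q) * mult L′ i q))
          ≡⟨ ∑-+ (allFin N) (λ q → ι (v e) (owner q) * d q) (λ q → 2ℚ * (ι (v e) (owner q) * mult L′ i q)) ⟩
        ∑ᶠ (λ q → ι (v e) (owner q) * d q) + ∑ᶠ (λ q → 2ℚ * (ι (v e) (owner q) * mult L′ i q))
          ≡⟨ cong₂ _+_ (owner-degree (v e)) (∑-*ˡ (allFin N) 2ℚ (λ q → ι (v e) (owner q) * mult L′ i q)) ⟩
        dg wq L (v e) + 2ℚ * ∑ᶠ (λ q → ι (v e) (owner q) * mult L′ i q)
          ≤⟨ ℚ.+-monoʳ-≤ (dg wq L (v e)) (*-monoˡ 0≤2 (row-bound L L′ liftL (thin-tail thin) i (u e) (v e) oi u≢v)) ⟩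
        dg wq L (v e) + 2ℚ * (w * bq (v e)) ∎
        where
        eq′ : ∀ i d m → i * (d + 2ℚ * m) ≡ i * d + 2ℚ * (i * m)
        eq′ = solve-∀ ring
      dj≤ : d j + 2ℚ * mult L′ i j ≤ ib (v e) * dg wq L (v e) + 2ℚ * w
      dj≤ = ℚ.≤-trans (ℚ.≤-trans (proj₂ (proj₂ Jv)) (*-monoˡ (0≤ib (v e)) row)) (ℚ.≤-reflexive (trans (eq′ (ib (v e)) (dg wq L (v e)) w (bq (v e)))
          (trans (cong (λ z → ib (v e) * dg wq L (v e) + 2ℚ * w * z) (bq*ib (v e))) (cong (ib (v e) * dg wq L (v e) +_) (ℚ.*-identityʳ (2ℚ * w))))))
        where
        eq′ : ∀ i d w b → i * (d + 2ℚ * (w * b)) ≡ i * d + 2ℚ * w * (b * i)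
        eq′ = solve-∀ ring
      e′ : Edge N
      e′ = edge i j (wt e)
      i≢j : i ≢ j
      i≢j i≡j = u≢v (trans (sym oi) (trans (cong owner i≡j) oj))
      0≤we : 0ℚ ≤ wq e
      0≤we = 0≤cast (wt e)
      slack : 0ℚ ≤ (ideal L + 8ℚ * w * ∑ L wq - potential L′) + (ideal (e ∷ L) - (ideal L + 2ℚ * wq e * (ib (u e) * dg wq L (u e) + ib (v e) * dg wq L (v e))))
        + 2ℚ * wq e * ((ib (u e) * dg wq L (u e) - d i) + (ib (v e) * dg wq L (v e) + 2ℚ * w - (d j + 2ℚ * mult L′ i j))) + 2ℚ * 2ℚ * (wq e * (w - wq e))
      slack = 0≤+ (0≤+ (0≤+ (0≤- bound) (0≤- (ideal-∷ e L))) (0≤* (0≤* 0≤2 0≤we) (0≤+ (0≤- di≤) (0≤- dj≤))))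
        (0≤* (0≤* 0≤2 0≤2) (0≤* 0≤we (0≤- (cast-≤ (proj₁ (proj₂ thin) e (here refl))))))
      eq : ∀ P x di dj w Q Q′ S a c → Q′ + 2ℚ * 2ℚ * 2ℚ * w * (x + S) ≡
        P + (2ℚ * x * (di + dj) + 2ℚ * 2ℚ * (x * x)) +
        ((Q + 2ℚ * 2ℚ * 2ℚ * w * S - P) + (Q′ - (Q + 2ℚ * x * (a + c))) + 2ℚ * x * ((a - di) + (c + 2ℚ * w - dj)) + 2ℚ * 2ℚ * (x * (w - x)))
      eq = solve-∀ ring

  private
    0≤ideal : ∀ L → 0ℚ ≤ ideal L
    0≤ideal L = 0≤∑ (allFin n) (λ x → 0≤* (0≤ib x) (0≤² (dg wq L x)))

  -- The base of the greedy process: the edges of `K` already have prescribed slots. In a matching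
  -- all degrees and multiplicities are at most W, so their squares are bounded linearly.
  matching-potential : ∀ K K′ → map π K′ ≡ K → (∀ e → e ∈ K → wt e ℕ.≤ W) → (∀ p → dg one K′ p ≤ 1ℚ) →
    potential K′ ≤ ideal K + 8ℚ * w * ∑ K wq
  matching-potential K K′ refl w≤ deg≤ = begin
    potential K′  ≤⟨ ℚ.+-mono-≤ (∑-mono (allFin N) first) (∑-mono (allFin N) (λ p → ∑-mono (allFin N) (second p))) ⟩
    ∑ᶠ (λ p → dg wq K′ p * w) + ∑ᶠ (λ p → ∑ᶠ (λ q → mult K′ p q * w)) ≡⟨ cong (∑ᶠ (λ p → dg wq K′ p * w) +_) (∑-cong (allFin N) row) ⟩
    ∑ᶠ (λ p → dg wq K′ p * w) + ∑ᶠ (λ p → dg wq K′ p * w)  ≡⟨ cong₂ _+_ total total ⟩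
    2ℚ * w * ∑ K wq + 2ℚ * w * ∑ K wq  ≤⟨ ≤-by (0≤+ (0≤ideal K) (0≤* (0≤* (0≤* 0≤2 0≤2) (0≤cast W)) (0≤∑ K (λ e → 0≤cast (wt e)))))
                        (eq (ideal K) w (∑ K wq)) ⟩
    ideal K + 8ℚ * w * ∑ K wq  ∎
    where
    open ℚ.≤-Reasoning
    wt≤ : ∀ e → e ∈ K′ → wq e ≤ w
    wt≤ e e∈ = cast-≤ (w≤ (π e) (∈-map⁺ π e∈))
    dg≤ : ∀ p → dg wq K′ p ≤ w
    dg≤ p = ℚ.≤-trans (∑-mono∈ K′ (λ e e∈ → ℚ.≤-trans (*-monoˡ (0≤inc e p) (wt≤ e e∈)) (ℚ.≤-reflexive (cong (_* w) (sym (ℚ.*-identityʳ (inc e p)))))))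
      (ℚ.≤-trans (ℚ.≤-reflexive (∑-*ʳ K′ w (λ e → inc e p * 1ℚ))) (ℚ.≤-trans (*-mono (0≤dg one K′ p (λ _ → 0≤1)) (0≤cast W) (deg≤ p) ℚ.≤-refl) (ℚ.≤-reflexive (ℚ.*-identityˡ w))))
    row : ∀ p → ∑ᶠ (λ q → mult K′ p q * w) ≡ dg wq K′ p * w
    row p = trans (mult-row K′ p (λ _ → w)) (trans (∑-cong K′ (λ e → eq′ (ι (u e) p) (ι (v e) p) w (wq e))) (∑-*ʳ K′ w (λ e → inc e p * wq e)))
      where
      eq′ : ∀ a b w x → (a * w + b * w) * x ≡ (a + b) * x * w
      eq′ = solve-∀ ring
    mult≤ : ∀ p q → mult K′ p q ≤ w
    mult≤ p q = ℚ.≤-trans (∑-mono K′ (λ e → *-mono (0≤joins e p q) (0≤cast (wt e)) (joins≤inc e) ℚ.≤-refl)) (dg≤ p)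
      where
      ι≤1 : ∀ x → ι x q ≤ 1ℚ
      ι≤1 x with x ≟ q
      ... | yes _ = ℚ.≤-refl
      ... | no _  = 0≤1
      joins≤inc : ∀ e → joins e p q ≤ inc e p
      joins≤inc e = ≤-by (0≤+ (0≤* (0≤ι (u e) p) (0≤- (ι≤1 (v e)))) (0≤* (0≤ι (v e) p) (0≤- (ι≤1 (u e))))) (eq′ (ι (u e) p) (ι (v e) p) (ι (v e) q) (ι (u e) q))
        where
        eq′ : ∀ a b c d → a + b ≡ a * c + d * b + (a * (1ℚ - c) + b * (1ℚ - d))
        eq′ = solve-∀ ring
    first : ∀ p → dg wq K′ p * dg wq K′ p ≤ dg wq K′ p * w
    first p = *-monoˡ (0≤dg wq K′ p (λ e → 0≤cast (wt e))) (dg≤ p)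
    second : ∀ p q → mult K′ p q * mult K′ p q ≤ mult K′ p q * w
    second p q = *-monoˡ (0≤mult K′ p q) (mult≤ p q)
    total : ∑ᶠ (λ p → dg wq K′ p * w) ≡ 2ℚ * w * ∑ K wq
    total = trans (∑-dg wq K′ (λ _ → w)) (trans (∑-cong K′ (λ e → eq′ (wq e) w)) (trans (∑-*ˡ K′ (2ℚ * w) wq) (cong (2ℚ * w *_) (sym (∑-map π K′ wq)))))
      where
      eq′ : ∀ x w → x * (w + w) ≡ 2ℚ * w * x
      eq′ = solve-∀ ring
    eq : ∀ Q w s → Q + 2ℚ * 2ℚ * 2ℚ * w * s ≡ 2ℚ * w * s + 2ℚ * w * s + (Q + 2ℚ * 2ℚ * w * s)
    eq = solve-∀ ring

  load : MultiGraph n → Fin N → ℚ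
  load L p = dg wq L (owner p) * ib (owner p)

  -- The variance identity: `load` is the mean of the degree over each fiber, so its inner product
  -- with the degree and its own squared norm both equal `ideal`.
  deviation : ∀ L L′ → map π L′ ≡ L →
    ∑ᶠ (λ p → (dg wq L′ p - load L p) * (dg wq L′ p - load L p)) + ∑ᶠ (λ p → ∑ᶠ (λ q → mult L′ p q * mult L′ p q)) ≡ potential L′ - ideal L
  deviation L L′ refl = trans (cong (_+ M) (trans (∑-cong (allFin N) (λ p → eq (d p) (D p)))
      (trans (∑-+ (allFin N) (λ p → d p * d p) (λ p → D p * D p - 2ℚ * (d p * D p))) (cong (∑ᶠ (λ p → d p * d p) +_)
        (trans (∑-- (allFin N) (λ p → D p * D p) (λ p → 2ℚ * (d p * D p))) (cong₂ _-_ DD (trans (∑-*ˡ (allFin N) 2ℚ (λ p → d p * D p)) (cong (2ℚ *_) dD))))))))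
    (eq′ (∑ᶠ (λ p → d p * d p)) (ideal L) M)
    where
    d D : Fin N → ℚ
    d = dg wq L′
    D = load L
    M : ℚ
    M = ∑ᶠ (λ p → ∑ᶠ (λ q → mult L′ p q * mult L′ p q))
    eq : ∀ d D → (d - D) * (d - D) ≡ d * d + (D * D - 2ℚ * (d * D))
    eq = solve-∀ ring
    eq′ : ∀ s Q M → s + (Q - 2ℚ * Q) + M ≡ s + M - Q
    eq′ = solve-∀ ring
    dD : ∑ᶠ (λ p → d p * D p) ≡ ideal L
    dD = trans (dg-fiber wq (λ _ → refl) L′ (λ x → dg wq L x * ib x)) (∑-cong (allFin n) (λ x → eq″ (dg wq L x) (ib x)))
      where
      eq″ : ∀ a b → a * (a * b) ≡ b * (a * a)
      eq″ = solve-∀ ring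
    DD : ∑ᶠ (λ p → D p * D p) ≡ ideal L
    DD = trans (∑-owner (λ x → dg wq L x * ib x * (dg wq L x * ib x))) (∑-cong (allFin n) (λ x →
        trans (eq″ (bq x) (dg wq L x) (ib x)) (trans (cong (_* (ib x * (dg wq L x * dg wq L x))) (bq*ib x)) (ℚ.*-identityˡ (ib x * (dg wq L x * dg wq L x))))))
      where
      eq″ : ∀ b a i → b * (a * i * (a * i)) ≡ b * i * (i * (a * a))
      eq″ = solve-∀ ring

-- The crossing subgraph of a signing

unit-cases : ∀ a → a * a ≡ 1ℚ → (a ≡ 1ℚ) ⊎ (a ≡ - 1ℚ)
unit-cases a a²≡1 with ℚ.≤-total 0ℚ a
... | inj₁ 0≤a = inj₁ (nonneg-unit a 0≤a a²≡1)
  where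
  nonneg-unit : ∀ a → 0ℚ ≤ a → a * a ≡ 1ℚ → a ≡ 1ℚ
  nonneg-unit a 0≤a a²≡1 = ℚ.≤-antisym (*-cancelˡ-≤ 0<1+a (ℚ.≤-reflexive same)) (*-cancelˡ-≤ 0<1+a (ℚ.≤-reflexive (sym same)))
    where
    0<1+a : 0ℚ < 1ℚ + a
    0<1+a = ℚ.+-mono-<-≤ (ℚ.positive⁻¹ 1ℚ) 0≤a
    eq : ∀ a s → (1ℚ + a) * a ≡ a + a * a
    eq = solve-∀ ring
    eq′ : ∀ a → a + 1ℚ ≡ (1ℚ + a) * 1ℚ
    eq′ = solve-∀ ring
    same : (1ℚ + a) * a ≡ (1ℚ + a) * 1ℚ
    same = trans (eq a a) (trans (cong (a +_) a²≡1) (eq′ a))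
... | inj₂ a≤0 = inj₂ (trans (eq a) (cong -_ (ℚ.≤-antisym (*-cancelˡ-≤ 0<1-a (ℚ.≤-reflexive same)) (*-cancelˡ-≤ 0<1-a (ℚ.≤-reflexive (sym same))))))
  where
  eq : ∀ a → a ≡ - (- a)
  eq = solve-∀ ring
  0<1-a : 0ℚ < 1ℚ - a
  0<1-a = ℚ.+-mono-<-≤ (ℚ.positive⁻¹ 1ℚ) (subst (_≤ - a) refl (ℚ.neg-antimono-≤ a≤0))
  eq₁ : ∀ a → (1ℚ - a) * - a ≡ a * a - a
  eq₁ = solve-∀ ring
  eq₂ : ∀ a → 1ℚ - a ≡ (1ℚ - a) * 1ℚ
  eq₂ = solve-∀ ring
  same : (1ℚ - a) * - a ≡ (1ℚ - a) * 1ℚ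
  same = trans (eq₁ a) (trans (cong (_- a) a²≡1) (eq₂ a))

∑-distinct : ∀ {A : Set} {n} (k : A → Fin n) p {S : List A} → AllPairs (λ e f → k e ≢ k f) S → ∑ S (λ e → ι (k e) p) ≤ 1ℚ
∑-distinct k p []  = 0≤1
∑-distinct k p {e ∷ S} (apart ∷ ap) with k e ≟ p
... | no _     = ℚ.≤-trans (ℚ.≤-reflexive (ℚ.+-identityˡ (∑ S (λ f → ι (k f) p)))) (∑-distinct k p ap)
... | yes refl = ℚ.≤-reflexive (trans (cong (1ℚ +_) (trans (∑-cong∈ S (λ f f∈ → ι-≢ (λ kf≡ke → All.lookup apart f∈ (sym kf≡ke)))) (∑-0 S))) (ℚ.+-identityʳ 1ℚ))

module Crossing {N : ℕ} (H : MultiGraph N) (W : ℕ) (w≤ : ∀ e → e ∈ H → wt e ℕ.≤ W)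
  (σ : Fin N → ℚ) (unit : ∀ p → σ p * σ p ≡ 1ℚ) where

  side : Fin N → Bool
  side p = ⌊ σ p ℚ.≟ 1ℚ ⌋

  private
    data Sided (p : Fin N) : Set where
      plus  : side p ≡ true  → σ p ≡ 1ℚ   → Sided p
      minus : side p ≡ false → σ p ≡ - 1ℚ → Sided p

    sided : ∀ p → Sided p
    sided p with σ p ℚ.≟ 1ℚ in eq
    ... | yes σ≡1 = plus (cong ⌊_⌋ eq) σ≡1
    ... | no σ≢1 with unit-cases (σ p) (unit p)
    ...   | inj₁ σ≡1  = ⊥-elim (σ≢1 σ≡1)
    ...   | inj₂ σ≡-1 = minus (cong ⌊_⌋ eq) σ≡-1

  crosses : Edge N → Bool
  crosses e = side (u e) Bool.xor side (v e)

  crossing : MultiGraph N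
  crossing = filterᵇ crosses H

  opposite-crosses : ∀ e → σ (u e) + σ (v e) ≡ 0ℚ → crosses e ≡ true
  opposite-crosses e σ+σ≡0 with sided (u e) | sided (v e)
  ... | plus a _  | minus b _ = cong₂ Bool._xor_ a b
  ... | minus a _ | plus b _  = cong₂ Bool._xor_ a b
  ... | plus _ a  | plus _ b  with trans (sym (cong₂ _+_ a b)) σ+σ≡0
  ...   | ()
  opposite-crosses e σ+σ≡0 | minus _ a | minus _ b with trans (sym (cong₂ _+_ a b)) σ+σ≡0
  ...   | ()

  private
    crosses-σ : ∀ e → 2ℚ * ⟨ crosses e ⟩ ≡ 1ℚ - σ (u e) * σ (v e)
    crosses-σ e with sided (u e) | sided (v e)
    ... | plus a a′  | minus b b′ = trans (cong (λ z → 2ℚ * ⟨ z ⟩) (cong₂ Bool._xor_ a b)) (sym (cong₂ (λ y z → 1ℚ - y * z) a′ b′))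
    ... | minus a a′ | plus b b′  = trans (cong (λ z → 2ℚ * ⟨ z ⟩) (cong₂ Bool._xor_ a b)) (sym (cong₂ (λ y z → 1ℚ - y * z) a′ b′))
    ... | plus a a′  | plus b b′  = trans (cong (λ z → 2ℚ * ⟨ z ⟩) (cong₂ Bool._xor_ a b)) (sym (cong₂ (λ y z → 1ℚ - y * z) a′ b′))
    ... | minus a a′ | minus b b′ = trans (cong (λ z → 2ℚ * ⟨ z ⟩) (cong₂ Bool._xor_ a b)) (sym (cong₂ (λ y z → 1ℚ - y * z) a′ b′))

    lin : Fin N → ℚ
    lin p = ∑ᶠ (λ q → σ q * mult H p q)

    ι-σ : ∀ x p → ι x p * σ p ≡ ι x p * σ x
    ι-σ x p with x ≟ p
    ... | yes refl = refl
    ... | no _     = trans (ℚ.*-zeroˡ (σ p)) (sym (ℚ.*-zeroˡ (σ x)))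

  -- Twice the indicator of crossing is 1 - σ(u) σ(v), and at an edge through `p` this product is
  -- σ(p) times the sign of the other end.
  crossing-degree : ∀ p → 2ℚ * dg wq crossing p ≡ dg wq H p - σ p * lin p
  crossing-degree p = begin
    2ℚ * dg wq crossing p  ≡⟨ cong (2ℚ *_) (∑-filter crosses H (λ e → inc e p * wq e)) ⟩
    2ℚ * ∑ H (λ e → ⟨ crosses e ⟩ * (inc e p * wq e))  ≡⟨ sym (∑-*ˡ H 2ℚ (λ e → ⟨ crosses e ⟩ * (inc e p * wq e))) ⟩
    ∑ H (λ e → 2ℚ * (⟨ crosses e ⟩ * (inc e p * wq e)))  ≡⟨ ∑-cong H termwise ⟩
    ∑ H (λ e → inc e p * wq e - σ p * ((ι (u e) p * σ (v e) + ι (v e) p * σ (u e)) * wq e))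
                        ≡⟨ ∑-- H (λ e → inc e p * wq e) (λ e → σ p * ((ι (u e) p * σ (v e) + ι (v e) p * σ (u e)) * wq e)) ⟩
    dg wq H p - ∑ H (λ e → σ p * ((ι (u e) p * σ (v e) + ι (v e) p * σ (u e)) * wq e))
                        ≡⟨ cong (λ z → dg wq H p - z) (trans (∑-*ˡ H (σ p) _) (cong (σ p *_)
                        (trans (sym (mult-row H p σ)) (∑-cong (allFin N) (λ q → ℚ.*-comm (mult H p q) (σ q)))))) ⟩
    dg wq H p - σ p * lin p  ∎
    where
    open ≡-Reasoning
    eq₁ : ∀ c i w → 2ℚ * (c * (i * w)) ≡ 2ℚ * c * (i * w)
    eq₁ = solve-∀ ring
    eq₂ : ∀ a b s t w → (1ℚ - s * t) * ((a + b) * w) ≡ (a + b) * w - (a * s * t + b * t * s) * w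
    eq₂ = solve-∀ ring
    eq₃ : ∀ a b s t r w → (a + b) * w - (a * r * t + b * r * s) * w ≡ (a + b) * w - r * ((a * t + b * s) * w)
    eq₃ = solve-∀ ring
    termwise : ∀ e → 2ℚ * (⟨ crosses e ⟩ * (inc e p * wq e)) ≡ inc e p * wq e - σ p * ((ι (u e) p * σ (v e) + ι (v e) p * σ (u e)) * wq e)
    termwise e = trans (eq₁ ⟨ crosses e ⟩ (inc e p) (wq e)) (trans (cong (_* (inc e p * wq e)) (crosses-σ e))
      (trans (eq₂ (ι (u e) p) (ι (v e) p) (σ (u e)) (σ (v e)) (wq e))
        (trans (cong₂ (λ y z → inc e p * wq e - (y * σ (v e) + z * σ (u e)) * wq e) (sym (ι-σ (u e) p)) (sym (ι-σ (v e) p)))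
          (eq₃ (ι (u e) p) (ι (v e) p) (σ (u e)) (σ (v e)) (σ p) (wq e)))))

  -- The excess is uneven spreading minus imbalance of signs; by (a - b)² ≤ 2 (a² + b²) the two can
  -- be estimated separately.
  crossing-error : ∀ (D : Fin N → ℚ) →
    ∑ᶠ (λ p → (2ℚ * dg wq crossing p - D p) * (2ℚ * dg wq crossing p - D p)) ≤
    2ℚ * (∑ᶠ (λ p → (dg wq H p - D p) * (dg wq H p - D p)) + ∑ᶠ (λ p → lin p * lin p))
  crossing-error D = ℚ.≤-trans (∑-mono (allFin N) pointwise) (ℚ.≤-reflexive
      (trans (∑-*ˡ (allFin N) 2ℚ (λ p → (dg wq H p - D p) * (dg wq H p - D p) + lin p * lin p))
        (cong (2ℚ *_) (∑-+ (allFin N) (λ p → (dg wq H p - D p) * (dg wq H p - D p)) (λ p → lin p * lin p)))))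
    where
    pointwise : ∀ p → (2ℚ * dg wq crossing p - D p) * (2ℚ * dg wq crossing p - D p) ≤ 2ℚ * ((dg wq H p - D p) * (dg wq H p - D p) + lin p * lin p)
    pointwise p = subst (λ z → (z - D p) * (z - D p) ≤ 2ℚ * ((dg wq H p - D p) * (dg wq H p - D p) + lin p * lin p)) (sym (crossing-degree p))
      (≤-by (0≤² (dg wq H p - D p + σ p * lin p)) (trans (cong (λ z → 2ℚ * ((dg wq H p - D p) * (dg wq H p - D p) + z))
          (trans (sym (ℚ.*-identityˡ (lin p * lin p))) (cong (_* (lin p * lin p)) (sym (unit p)))))
        (eq (dg wq H p) (D p) (σ p) (lin p))))
      where
      eq : ∀ d D s l → 2ℚ * ((d - D) * (d - D) + s * s * (l * l)) ≡ (d - s * l - D) * (d - s * l - D) + (d - D + s * l) * (d - D + s * l)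
      eq = solve-∀ ring

  private
    left right : Edge N → Fin N
    left e = if side (u e) then u e else v e
    right e = if side (u e) then v e else u e

    ∈-crossing : ∀ e → e ∈ crossing → e ∈ H × crosses e ≡ true
    ∈-crossing e e∈ with ∈-filter⁻ (λ f → Bool.T? (crosses f)) {xs = H} e∈
    ... | e∈H , t = e∈H , Equivalence.to Bool.T-≡ t

    xor-true : ∀ a b → a Bool.xor b ≡ true → (a ≡ true × b ≡ false) ⊎ (a ≡ false × b ≡ true)
    xor-true true  false _ = inj₁ (refl , refl)
    xor-true false true  _ = inj₂ (refl , refl)

    ≢-side : ∀ {p x} → side x ≡ false → side p ≡ true → x ≢ p
    ≢-side sx sp refl with trans (sym sx) sp
    ... | ()

    inc-left : ∀ e p → crosses e ≡ true → side p ≡ true → inc e p ≡ ι (left e) p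
    inc-left e p c sp with xor-true (side (u e)) (side (v e)) c
    ... | inj₁ (su , sv) = trans (cong (ι (u e) p +_) (ι-≢ (≢-side sv sp))) (trans (ℚ.+-identityʳ (ι (u e) p)) (cong (λ z → ι (if z then u e else v e) p) (sym su)))
    ... | inj₂ (su , sv) = trans (cong (_+ ι (v e) p) (ι-≢ (≢-side su sp))) (trans (ℚ.+-identityˡ (ι (v e) p)) (cong (λ z → ι (if z then u e else v e) p) (sym su)))

    inc-right : ∀ e p → crosses e ≡ true → side p ≡ false → inc e p ≡ ι (right e) p
    inc-right e p c sp with xor-true (side (u e)) (side (v e)) c
    ... | inj₁ (su , sv) = trans (cong (_+ ι (v e) p) (ι-≢ (λ up → ≢-side sp su (sym up)))) (trans (ℚ.+-identityˡ (ι (v e) p)) (cong (λ z → ι (if z then v e else u e) p) (sym su)))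
    ... | inj₂ (su , sv) = trans (cong (ι (u e) p +_) (ι-≢ (λ vp → ≢-side sp sv (sym vp)))) (trans (ℚ.+-identityʳ (ι (u e) p)) (cong (λ z → ι (if z then v e else u e) p) (sym su)))

  record Covering : Set where
    field
      S T      : MultiGraph N
      y        : Fin N → ℕ
      H↭       : H ↭ S ++ T
      matching : ∀ p → dg one S p ≤ 1ℚ
      y≤W      : ∀ p → y p ℕ.≤ W
      covers   : ∀ e → e ∈ crossing → wt e ℕ.≤ y (u e) ℕ.+ y (v e)
      tight    : ∑ᶠ (λ p → nat (y p)) ≤ ∑ S wq

  private
    build : Egerváry.Duality left right wt crossing → Covering
    build (S , disj , T , cr↭ , yl , yr , cover , tight) = record
      { S = S
      ; T = T ++ filterᵇ (not ∘ crosses) H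
      ; y = y
      ; H↭ = ↭-trans (filter-split crosses H) (↭-trans (↭.++⁺ʳ (filterᵇ (not ∘ crosses) H) cr↭) (↭.++-assoc S T (filterᵇ (not ∘ crosses) H)))
      ; matching = matching
      ; y≤W = λ p → ℕ.m⊓n≤n (y₀ p) W
      ; covers = covers
      ; tight = ℚ.≤-trans (ℚ.≤-trans (∑-mono (allFin N) y≤) (ℚ.≤-reflexive (∑-+ (allFin N) (λ p → nat (yl p)) (λ p → nat (yr p))))) tight
      }
      where
      y₀ y : Fin N → ℕ
      y₀ p = if side p then yl p else yr p
      -- No edge weighs more than W, so clamping preserves the cover; it does not increase the total
      -- and gives `y≤W`.
      y p = y₀ p ℕ.⊓ W
      S-crosses : ∀ e → e ∈ S → crosses e ≡ true
      S-crosses e e∈ = proj₂ (∈-crossing e (↭.∈-resp-↭ (↭-sym cr↭) (∈-++⁺ˡ e∈)))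
      matching : ∀ p → dg one S p ≤ 1ℚ
      matching p with side p in sp
      ... | true  = ℚ.≤-trans (ℚ.≤-reflexive (∑-cong∈ S (λ e e∈ → trans (ℚ.*-identityʳ (inc e p)) (inc-left e p (S-crosses e e∈) sp))))
                      (∑-distinct left p (AllPairs.map proj₁ disj))
      ... | false = ℚ.≤-trans (ℚ.≤-reflexive (∑-cong∈ S (λ e e∈ → trans (ℚ.*-identityʳ (inc e p)) (inc-right e p (S-crosses e e∈) sp))))
                      (∑-distinct right p (AllPairs.map proj₂ disj))
      y≤ : ∀ p → nat (y p) ≤ nat (yl p) + nat (yr p)
      y≤ p = subst (nat (y p) ≤_) (cast-+ (yl p) (yr p)) (cast-≤ (ℕ.≤-trans (ℕ.m⊓n≤m (y₀ p) W) (pick (side p))))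
        where
        pick : ∀ s → (if s then yl p else yr p) ℕ.≤ yl p ℕ.+ yr p
        pick true  = ℕ.m≤m+n (yl p) (yr p)
        pick false = ℕ.m≤n+m (yr p) (yl p)
      clamp : ∀ x a c → x ℕ.≤ W → x ℕ.≤ a ℕ.+ c → x ℕ.≤ a ℕ.⊓ W ℕ.+ c ℕ.⊓ W
      clamp x a c x≤W x≤ with ℕ.≤-total a W | ℕ.≤-total c W
      ... | inj₂ W≤a | _ = ℕ.≤-trans x≤W (ℕ.≤-trans (ℕ.≤-reflexive (sym (ℕ.m≥n⇒m⊓n≡n W≤a))) (ℕ.m≤m+n (a ℕ.⊓ W) (c ℕ.⊓ W)))
      ... | inj₁ _ | inj₂ W≤c = ℕ.≤-trans x≤W (ℕ.≤-trans (ℕ.≤-reflexive (sym (ℕ.m≥n⇒m⊓n≡n W≤c))) (ℕ.m≤n+m (c ℕ.⊓ W) (a ℕ.⊓ W)))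
      ... | inj₁ a≤W | inj₁ c≤W = subst₂ (λ s t → x ℕ.≤ s ℕ.+ t) (sym (ℕ.m≤n⇒m⊓n≡m a≤W)) (sym (ℕ.m≤n⇒m⊓n≡m c≤W)) x≤
      covers : ∀ e → e ∈ crossing → wt e ℕ.≤ y (u e) ℕ.+ y (v e)
      covers e e∈ = clamp (wt e) (y₀ (u e)) (y₀ (v e)) (w≤ e (proj₁ (∈-crossing e e∈))) (cover₀ (xor-true (side (u e)) (side (v e)) (proj₂ (∈-crossing e e∈))))
        where
        cover₀ : (side (u e) ≡ true × side (v e) ≡ false) ⊎ (side (u e) ≡ false × side (v e) ≡ true) → wt e ℕ.≤ y₀ (u e) ℕ.+ y₀ (v e)
        cover₀ (inj₁ (su , sv)) = ℕ.≤-trans (cover e e∈) (ℕ.≤-reflexive (cong₂ ℕ._+_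
          (trans (cong (λ z → yl (if z then u e else v e)) su) (cong (λ z → if z then yl (u e) else yr (u e)) (sym su)))
          (trans (cong (λ z → yr (if z then v e else u e)) su) (cong (λ z → if z then yl (v e) else yr (v e)) (sym sv)))))
        cover₀ (inj₂ (su , sv)) = ℕ.≤-trans (cover e e∈) (ℕ.≤-reflexive (trans (cong₂ ℕ._+_
          (trans (cong (λ z → yl (if z then u e else v e)) su) (cong (λ z → if z then yl (v e) else yr (v e)) (sym sv)))
          (trans (cong (λ z → yr (if z then v e else u e)) su) (cong (λ z → if z then yl (u e) else yr (u e)) (sym su))))
          (ℕ.+-comm (y₀ (v e)) (y₀ (u e)))))

  covering : Covering
  covering = build (Egerváry.duality left right wt crossing)

-- Combining spreading, signing and duality

split-map : ∀ {A B : Set} (f : A → B) xs {ys zs} → map f xs ≡ ys ++ zs →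
  ∃ λ xs₁ → ∃ λ xs₂ → xs ≡ xs₁ ++ xs₂ × map f xs₁ ≡ ys × map f xs₂ ≡ zs
split-map f xs {[]}  eq = [] , xs , refl , refl , eq
split-map f (x ∷ xs) {y ∷ ys} eq with split-map f xs {ys} (List.∷-injectiveʳ eq)
... | xs₁ , xs₂ , refl , eq₁ , eq₂ = x ∷ xs₁ , xs₂ , refl , cong₂ _∷_ (List.∷-injectiveˡ eq) eq₁ , eq₂

-- K consists of the edges of the given b-matching K ++ U that belong to the EDCS J ++ K.
module Combined {n : ℕ} (b : Fin n → ℕ) (1≤b : ∀ v → 1 ℕ.≤ b v) (W : ℕ) (1≤W : 1 ℕ.≤ W)
  (β β⁻ l τ iτ : ℚ) (0<β : 0ℚ < β) (0≤l : 0ℚ ≤ l) (0<τ : 0ℚ < τ) (τ*iτ : τ * iτ ≡ 1ℚ) (β-gap : β - β⁻ ≤ l * β)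
  (J K U : MultiGraph n)
  where

  open Lifting b 1≤b (slots b)
  open Spreading b 1≤b (slots b) W

  private
    H : MultiGraph n
    H = J ++ K
    w iW c : ℚ
    w = nat W
    iW = ratio 1 W
    c = 2ℚ * w - 1ℚ

  share : Fin n → ℚ
  share x = dg wq H x * ib x

  -- The slots are projected away: `S` is a b-matching of the original graph, and only the value `Y`
  -- of the cover and the squared error `X` are retained.
  record Outcome : Set where
    field
      S T      : MultiGraph n
      H↭       : H ↭ S ++ T
      matching : ∀ x → dg one S x ≤ bq x
      Y X      : ℚ
      0≤Y      : 0ℚ ≤ Y
      Y≤       : Y ≤ ∑ S wq
      X≤       : X ≤ 2ℚ * (2ℚ * 2ℚ * 2ℚ * w * ∑ H wq)
      bound    : ½ * c * (β * β) * (∑ K wq + ∑ U wq - Y - 2ℚ * l * ∑ U wq) ≤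
                 ¼ * c * c * iW * β * β * Y + c * β * (τ * (2ℚ * ∑ U one + Y) + ¼ * iτ * X)

  module _ (thin : Thin H) (nl : NoLoops (K ++ U)) (deg≤ : ∀ x → dg one (K ++ U) x ≤ bq x)
    (share≤ : ∀ x → share x ≤ β * w)
    (H-load : ∀ e → e ∈ H → share (u e) + share (v e) ≤ β * wq e)
    (U-load : ∀ e → e ∈ U → β⁻ * wq e ≤ share (u e) + share (v e)) where

    private
      module FromSpread (K′ U′ J′ : MultiGraph N) (liftK : map π K′ ≡ K) (liftU : map π U′ ≡ U) (liftJ : map π J′ ≡ J)
        (deg′≤ : ∀ p → dg one (K′ ++ U′) p ≤ 1ℚ)
        (spread≤ : potential (J′ ++ K′) ≤ ideal H + 2ℚ * 2ℚ * 2ℚ * w * ∑ H wq)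
        (σ : Fin N → ℚ) (unit : ∀ p → σ p * σ p ≡ 1ℚ) (opp : ∀ e → e ∈ K′ ++ U′ → σ (u e) + σ (v e) ≡ 0ℚ)
        (energy≤ : Balancing.energy (mult (J′ ++ K′)) (0≤mult (J′ ++ K′)) σ ≤ ∑ᶠ (Balancing.column (mult (J′ ++ K′)) (0≤mult (J′ ++ K′))))
        where

        H′ : MultiGraph N
        H′ = J′ ++ K′

        liftH : map π H′ ≡ H
        liftH = trans (List.map-++ π J′ K′) (cong₂ _++_ liftJ liftK)

        π∈ : ∀ {L L′} → map π L′ ≡ L → ∀ e → e ∈ L′ → π e ∈ L
        π∈ lift e e∈ = subst (π e ∈_) lift (∈-map⁺ π e∈)

        H′≤W : ∀ e → e ∈ H′ → wt e ℕ.≤ W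
        H′≤W e e∈ = proj₁ (proj₂ thin) (π e) (π∈ liftH e e∈)

        module Cr = Crossing H′ W H′≤W σ unit
        open Cr.Covering Cr.covering renaming (S to S′; T to T′; matching to matching′; H↭ to H′↭)

        D : Fin N → ℚ
        D = load H

        crossing⊆ : ∀ e → e ∈ Cr.crossing → e ∈ H′
        crossing⊆ e e∈ = proj₁ (∈-filter⁻ (λ f → Bool.T? (Cr.crosses f)) {xs = H′} e∈)

        -- Because the signs are opposite along `K′`, all of it lies in the bipartite graph and is
        -- covered by `y`.
        K-crossing : ∀ e → e ∈ K′ → e ∈ Cr.crossing
        K-crossing e e∈ = ∈-filter⁺ (λ f → Bool.T? (Cr.crosses f)) (∈-++⁺ʳ J′ e∈)
          (Equivalence.from Bool.T-≡ (Cr.opposite-crosses e (opp e (∈-++⁺ˡ e∈))))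

        0≤D : ∀ p → 0ℚ ≤ D p
        0≤D p = 0≤* (0≤dg wq H (owner p) (λ e → 0≤cast (wt e))) (0≤ib (owner p))

        module Cv = Cover W 1≤W β β⁻ l τ iτ 0<β 0≤l 0<τ τ*iτ β-gap D 0≤D (λ p → share≤ (owner p)) y y≤W Cr.crossing K′ U′
          (λ e e∈ → H-load (π e) (π∈ liftH e (crossing⊆ e e∈))) (λ e e∈ → U-load (π e) (π∈ liftU e e∈)) covers
          (λ e e∈ → covers e (K-crossing e e∈)) deg′≤

        error≤ : ∑ᶠ (λ p → Cv.excess p * Cv.excess p) ≤ 2ℚ * (2ℚ * 2ℚ * 2ℚ * w * ∑ H wq)
        error≤ = ℚ.≤-trans (Cr.crossing-error D) (*-monoˡ 0≤2 (begin
          dev + ∑ᶠ (λ p → lin p * lin p)  ≤⟨ ℚ.+-monoʳ-≤ dev energy≤ ⟩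
          dev + ∑ᶠ (λ q → ∑ᶠ (λ p → mult H′ p q * mult H′ p q))  ≡⟨ cong (dev +_) (∑-swap (allFin N) (allFin N) (λ q p → mult H′ p q * mult H′ p q)) ⟩
          dev + ∑ᶠ (λ p → ∑ᶠ (λ q → mult H′ p q * mult H′ p q))  ≡⟨ deviation H H′ liftH ⟩
          potential H′ - ideal H  ≤⟨ ≤-by (0≤- spread≤) (eq (potential H′) (ideal H) (2ℚ * 2ℚ * 2ℚ * w * ∑ H wq)) ⟩
          2ℚ * 2ℚ * 2ℚ * w * ∑ H wq  ∎))
          where
          open ℚ.≤-Reasoning
          dev : ℚ
          dev = ∑ᶠ (λ p → (dg wq H′ p - D p) * (dg wq H′ p - D p))
          lin : Fin N → ℚ
          lin p = ∑ᶠ (λ q → σ q * mult H′ p q)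
          eq : ∀ p i x → x ≡ p - i + (i + x - p)
          eq = solve-∀ ring

        sum-lift : ∀ {L L′} → map π L′ ≡ L → (f : ∀ {k} → Edge k → ℚ) → (∀ e → f (π e) ≡ f e) → ∑ L′ f ≡ ∑ L f
        sum-lift {L} {L′} refl f f-π = trans (∑-cong L′ (λ e → sym (f-π e))) (sym (∑-map π L′ f))

        S-degree : ∀ x → dg one (map π S′) x ≤ bq x
        S-degree x = begin
          dg one (map π S′) x  ≡⟨ sym (dg-owner one (λ _ → refl) S′ x) ⟩
          ∑ᶠ (λ p → ι x (owner p) * dg one S′ p)       ≤⟨ ∑-mono (allFin N) (λ p → *-monoˡ (0≤ι x (owner p)) (matching′ p)) ⟩
          ∑ᶠ (λ p → ι x (owner p) * 1ℚ)  ≡⟨ ∑-cong (allFin N) (λ p → ℚ.*-identityʳ (ι x (owner p))) ⟩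
          ∑ᶠ (λ p → ι x (owner p))  ≡⟨ fiber-size x ⟩
          bq x  ∎
          where open ℚ.≤-Reasoning

        result : Outcome
        result = record
          { S        = map π S′
          ; T        = map π T′
          ; H↭       = ↭-trans (↭-reflexive (sym liftH)) (↭-trans (↭.map⁺ π H′↭) (↭-reflexive (List.map-++ π S′ T′)))
          ; matching = S-degree
          ; Y        = ∑ᶠ (λ p → nat (y p))
          ; X        = ∑ᶠ (λ p → Cv.excess p * Cv.excess p)
          ; 0≤Y      = 0≤∑ (allFin N) (λ p → 0≤cast (y p))
          ; Y≤       = ℚ.≤-trans tight (ℚ.≤-reflexive (sym (∑-map π S′ wq)))
          ; X≤       = error≤
          ; bound    = subst₂ _≤_
              (cong₂ (λ k m → ½ * c * (β * β) * (k + m - ∑ᶠ (λ p → nat (y p)) - 2ℚ * l * m)) (sum-lift liftK wq (λ _ → refl)) (sum-lift liftU wq (λ _ → refl)))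
              (cong (λ m → ¼ * c * c * iW * β * β * ∑ᶠ (λ p → nat (y p)) + c * β * (τ * (2ℚ * m + ∑ᶠ (λ p → nat (y p))) + ¼ * iτ * ∑ᶠ (λ p → Cv.excess p * Cv.excess p)))
                (sum-lift liftU one (λ _ → refl)))
              Cv.cover-inequality
          }

      from-matching : (∃ λ L′ → map π L′ ≡ K ++ U × (∀ p → dg one L′ p ≤ 1ℚ)) → Outcome
      from-matching (L′ , liftL , degL) = from-split (split-map π L′ liftL)
        where
        from-split : (∃ λ K′ → ∃ λ U′ → L′ ≡ K′ ++ U′ × map π K′ ≡ K × map π U′ ≡ U) → Outcome
        from-split (K′ , U′ , refl , liftK , liftU) = from-spread (spread K K′ liftK base J thin)
          where
          base : potential K′ ≤ ideal K + 2ℚ * 2ℚ * 2ℚ * w * ∑ K wq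
          base = matching-potential K K′ liftK (λ e e∈ → proj₁ (proj₂ thin) e (∈-++⁺ʳ J e∈))
            (λ p → ℚ.≤-trans (≤-by (0≤dg one U′ p (λ _ → 0≤1)) (dg-++ one K′ U′ p)) (degL p))
          from-spread : (∃ λ J′ → map π J′ ≡ J × potential (J′ ++ K′) ≤ ideal H + 2ℚ * 2ℚ * 2ℚ * w * ∑ H wq) → Outcome
          from-spread (J′ , liftJ , spread≤) = from-signs (Balancing.balanced (mult (J′ ++ K′)) (0≤mult (J′ ++ K′)) (K′ ++ U′)
              (NoLoops-lift (subst NoLoops (sym liftL) nl)) degL)
            where
            from-signs : (∃ λ (σ : Fin N → ℚ) → (∀ q → σ q * σ q ≡ 1ℚ) × (∀ e → e ∈ K′ ++ U′ → σ (u e) + σ (v e) ≡ 0ℚ) ×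
                Balancing.energy (mult (J′ ++ K′)) (0≤mult (J′ ++ K′)) σ ≤ ∑ᶠ (Balancing.column (mult (J′ ++ K′)) (0≤mult (J′ ++ K′)))) → Outcome
            from-signs (σ , unit , opp , energy≤) = FromSpread.result K′ U′ J′ liftK liftU liftJ degL spread≤ σ unit opp energy≤

    outcome : Outcome
    outcome = from-matching (lift-matching (K ++ U) nl deg≤)

-- Replacing the dropped edges of a b-matching by relevant ones

-- With repeated edges, the intersection of two parts of a multiset is not a matter of membership;
-- the two-by-two table of blocks is filled one occurrence at a time.
common-refinement : ∀ {A : Set} (as : List A) {bs cs ds} → as ++ bs ↭ cs ++ ds →
  ∃ λ ps → ∃ λ qs → ∃ λ ss → ∃ λ ts → as ↭ ps ++ qs × bs ↭ ss ++ ts × cs ↭ ps ++ ss × ds ↭ qs ++ ts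
common-refinement []       {cs = cs} {ds} eq = [] , [] , cs , ds , ↭-refl , eq , ↭-refl , ↭-refl
common-refinement (a ∷ as) {bs} {cs} {ds} eq with ∈-++⁻ cs (↭.∈-resp-↭ eq (here refl))
... | inj₁ a∈cs with ∈-↭∷ a∈cs
...   | cs′ , cs↭ with common-refinement as {bs} {cs′} {ds} (↭.drop-∷ (↭-trans eq (↭.++⁺ʳ ds cs↭)))
...     | ps , qs , ss , ts , as↭ , bs↭ , cs′↭ , ds↭ = a ∷ ps , qs , ss , ts , prep a as↭ , bs↭ , ↭-trans cs↭ (prep a cs′↭) , ds↭
common-refinement (a ∷ as) {bs} {cs} {ds} eq | inj₂ a∈ds with ∈-↭∷ a∈ds
...   | ds′ , ds↭ with common-refinement as {bs} {cs} {ds′} (↭.drop-∷ (↭-trans eq (↭-trans (↭.++⁺ˡ cs ds↭) (↭.shift a cs ds′))))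
...     | ps , qs , ss , ts , as↭ , bs↭ , cs↭ , ds′↭ = ps , a ∷ qs , ss , ts , ↭-trans (prep a as↭) (↭-sym (↭.shift a ps qs)) , bs↭ , cs↭ , ↭-trans ds↭ (prep a ds′↭)

between⇒ : ∀ {n} (x y : Fin n) e → betweenᵇ x y e ≡ true → (u e ≡ x × v e ≡ y) ⊎ (u e ≡ y × v e ≡ x)
between⇒ x y e h with u e ≟ x | v e ≟ y | u e ≟ y | v e ≟ x
... | yes p | yes q | _     | _     = inj₁ (p , q)
... | yes _ | no _  | yes p | yes q = inj₂ (p , q)
... | no _  | _     | yes p | yes q = inj₂ (p , q)
between⇒ x y e () | yes _ | no _ | yes _ | no _
between⇒ x y e () | yes _ | no _ | no _ | _
between⇒ x y e () | no _ | _ | yes _ | no _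
between⇒ x y e () | no _ | _ | no _ | _

between⇐ : ∀ {n} (x y : Fin n) e → (u e ≡ x × v e ≡ y) ⊎ (u e ≡ y × v e ≡ x) → betweenᵇ x y e ≡ true
between⇐ x y e (inj₁ (p , q)) with u e ≟ x | v e ≟ y
... | yes _ | yes _ = refl
... | no ¬p | _     = ⊥-elim (¬p p)
... | _     | no ¬q = ⊥-elim (¬q q)
between⇐ x y e (inj₂ (p , q)) with u e ≟ y | v e ≟ x
... | yes _ | yes _ = Bool.∨-zeroʳ _
... | no ¬p | _     = ⊥-elim (¬p p)
... | _     | no ¬q = ⊥-elim (¬q q)

between-inc : ∀ {n} (x y : Fin n) e → ⟨ betweenᵇ x y e ⟩ ≤ inc e x × ⟨ betweenᵇ x y e ⟩ ≤ inc e y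
between-inc x y e with betweenᵇ x y e in eq
... | false = 0≤inc e x , 0≤inc e y
... | true with between⇒ x y e eq
...   | inj₁ (refl , refl) = 1≤inc-u e , 1≤inc-v e
...   | inj₂ (refl , refl) = 1≤inc-v e , 1≤inc-u e

cast-between : ∀ {n} (L : MultiGraph n) x y → nat (length (edgesBetween L x y)) ≡ ∑ L (λ e → ⟨ betweenᵇ x y e ⟩)
cast-between L x y = trans (sym (∑-1 (edgesBetween L x y))) (trans (∑-filter (betweenᵇ x y) L (λ _ → 1ℚ)) (∑-cong L (λ e → ℚ.*-identityʳ ⟨ betweenᵇ x y e ⟩)))

dg-↭ : ∀ {n} c {L L′ : MultiGraph n} x → L ↭ L′ → dg c L x ≡ dg c L′ x
dg-↭ c x p = ∑-↭ (λ e → inc e x * c e) p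

module Exchange {n : ℕ} (b : Fin n → ℕ) (G Gbar R : MultiGraph n) (G↭ : G ↭ Gbar ++ R)
  (count : ∀ x y → length (edgesBetween Gbar x y) ≡ (b x ℕ.⊓ b y) ℕ.⊓ length (edgesBetween G x y))
  (heavy : ∀ e e′ → e ∈ Gbar → e′ ∈ R → betweenᵇ (u e) (v e) e′ ≡ true → wt e′ ℕ.≤ wt e) where

  private
    ⊓-≥ : ∀ {a} x y → a ≤ nat x → a ≤ nat y → a ≤ nat (x ℕ.⊓ y)
    ⊓-≥ {a} x y a≤x a≤y with ℕ.⊓-sel x y
    ... | inj₁ eq = subst (λ z → a ≤ nat z) (sym eq) a≤x
    ... | inj₂ eq = subst (λ z → a ≤ nat z) (sym eq) a≤y

    -- A dropped edge shows that `G` has strictly more edges between these ends than `Gbar`, so the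
    -- minimum in `count` must be attained by the capacities.
    saturated : ∀ e → e ∈ R → length (edgesBetween Gbar (u e) (v e)) ≡ b (u e) ℕ.⊓ b (v e)
    saturated e e∈ with ℕ.⊓-sel (b (u e) ℕ.⊓ b (v e)) (length (edgesBetween G (u e) (v e)))
    ... | inj₁ eq = trans (count (u e) (v e)) eq
    ... | inj₂ eq = ⊥-elim (ℕ.<-irrefl (trans (count (u e) (v e)) eq) (cast-cancel-< {length (edgesBetween Gbar (u e) (v e))} {length (edgesBetween G (u e) (v e))} fewer))
      where
      bt : Edge n → ℚ
      bt f = ⟨ betweenᵇ (u e) (v e) f ⟩
      1≤R : 1ℚ ≤ ∑ R bt
      1≤R = subst (_≤ ∑ R bt) (cong ⟨_⟩ (between⇐ (u e) (v e) e (inj₁ (refl , refl)))) (≤∑ R (λ f → 0≤⟨⟩ (betweenᵇ (u e) (v e) f)) e∈)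
      fewer : nat (length (edgesBetween Gbar (u e) (v e))) < nat (length (edgesBetween G (u e) (v e)))
      fewer = subst₂ _<_ (trans (ℚ.+-identityʳ (∑ Gbar bt)) (sym (cast-between Gbar (u e) (v e))))
        (trans (sym (∑-↭++ {ys = Gbar} {R} bt G↭)) (sym (cast-between G (u e) (v e)))) (ℚ.+-monoʳ-< (∑ Gbar bt) (ℚ.<-≤-trans (ℚ.positive⁻¹ 1ℚ) 1≤R))

    -- Together with `e`, the edges of `K` between the two ends respect both capacities. So `K`
    -- contains at most min(b u, b v) - 1 of the min(b u, b v) relevant ones, and another is left.
    substitute : ∀ K K̄ e U → Gbar ↭ K ++ K̄ → e ∈ R → (∀ x → dg one (K ++ e ∷ U) x ≤ nat (b x)) →
      ∃ λ f → f ∈ K̄ × ((u f ≡ u e × v f ≡ v e) ⊎ (u f ≡ v e × v f ≡ u e))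
    substitute K K̄ e U Gbar↭ e∈ deg≤ with search (λ f → betweenᵇ (u e) (v e) f Bool.≟ true) K̄
    ... | inj₁ (f , f∈ , bf) = f , f∈ , between⇒ (u e) (v e) f bf
    ... | inj₂ none = ⊥-elim (≰-< (ℚ.positive⁻¹ 1ℚ) (≤-by (0≤- too-few) (eq (∑ K bt))))
      where
      bt : Edge n → ℚ
      bt f = ⟨ betweenᵇ (u e) (v e) f ⟩
      bt-e : bt e ≡ 1ℚ
      bt-e = cong ⟨_⟩ (between⇐ (u e) (v e) e (inj₁ (refl , refl)))
      K̄-none : ∑ K̄ bt ≡ 0ℚ
      K̄-none = trans (∑-cong∈ K̄ (λ f f∈ → cong ⟨_⟩ (Bool.¬-not (none f f∈)))) (∑-0 K̄)
      below : ∀ x → (∀ f → bt f ≤ inc f x) → ∑ K bt + 1ℚ ≤ nat (b x)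
      below x bt≤ = ℚ.≤-trans
          (≤-by (0≤+ (0≤∑ U (λ f → 0≤⟨⟩ (betweenᵇ (u e) (v e) f))) (0≤- (∑-mono (K ++ e ∷ U) (λ f → subst (bt f ≤_) (sym (ℚ.*-identityʳ (inc f x))) (bt≤ f)))))
            (trans (eq′ (∑ K bt) (∑ U bt) (dg one (K ++ e ∷ U) x)) (cong (λ z → ∑ K bt + 1ℚ + (∑ U bt + (dg one (K ++ e ∷ U) x - z))) (sym total))))
          (deg≤ x)
        where
        total : ∑ (K ++ e ∷ U) bt ≡ ∑ K bt + (1ℚ + ∑ U bt)
        total = trans (∑-++ K (e ∷ U) bt) (cong (λ z → ∑ K bt + (z + ∑ U bt)) bt-e)
        eq′ : ∀ k s d → d ≡ k + 1ℚ + (s + (d - (k + (1ℚ + s))))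
        eq′ = solve-∀ ring
      too-few : ∑ K bt + 1ℚ ≤ ∑ K bt + 0ℚ
      too-few = subst (∑ K bt + 1ℚ ≤_)
        (trans (cong nat (sym (saturated e e∈))) (trans (cast-between Gbar (u e) (v e)) (trans (∑-↭++ {ys = K} {K̄} bt Gbar↭) (cong (∑ K bt +_) K̄-none))))
        (⊓-≥ (b (u e)) (b (v e)) (below (u e) (λ f → proj₁ (between-inc (u e) (v e) f))) (below (v e) (λ f → proj₂ (between-inc (u e) (v e) f))))
      eq : ∀ k → 0ℚ ≡ 1ℚ + (k + 0ℚ - (k + 1ℚ))
      eq = solve-∀ ring

    same-inc : ∀ (e f : Edge n) x → (u f ≡ u e × v f ≡ v e) ⊎ (u f ≡ v e × v f ≡ u e) → inc f x ≡ inc e x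
    same-inc e f x (inj₁ (p , q)) = cong₂ (λ s t → ι s x + ι t x) p q
    same-inc e f x (inj₂ (p , q)) = trans (cong₂ (λ s t → ι s x + ι t x) p q) (ℚ.+-comm (ι (v e) x) (ι (u e) x))

  -- One dropped edge at a time is exchanged for a relevant one with the same ends. Degrees do not
  -- change, and by `heavy` the weight does not decrease.
  relevant-matching : ∀ U K K̄ → Gbar ↭ K ++ K̄ → (∀ e → e ∈ U → e ∈ R) → (∀ x → dg one (K ++ U) x ≤ nat (b x)) →
    ∃ λ M → ∃ λ M̄ → Gbar ↭ M ++ M̄ × (∀ x → dg one M x ≤ nat (b x)) × ∑ (K ++ U) wq ≤ ∑ M wq
  relevant-matching [] K K̄ Gbar↭ U⊆R deg≤ = K , K̄ , Gbar↭ , subst (λ L → ∀ x → dg one L x ≤ nat (b x)) (List.++-identityʳ K) deg≤ ,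
    ℚ.≤-reflexive (cong (λ L → ∑ L wq) (List.++-identityʳ K))
  relevant-matching (e ∷ U) K K̄ Gbar↭ U⊆R deg≤ with substitute K K̄ e U Gbar↭ (U⊆R e (here refl)) deg≤
  ... | f , f∈ , ends with ∈-↭∷ f∈
  ...   | K̄′ , K̄↭ with relevant-matching U (f ∷ K) K̄′ Gbar↭′ (λ g g∈ → U⊆R g (there g∈)) deg′≤
    where
    Gbar↭′ : Gbar ↭ (f ∷ K) ++ K̄′
    Gbar↭′ = ↭-trans Gbar↭ (↭-trans (↭.++⁺ˡ K K̄↭) (↭.shift f K K̄′))
    deg′≤ : ∀ x → dg one ((f ∷ K) ++ U) x ≤ nat (b x)
    deg′≤ x = subst (_≤ nat (b x)) (trans (dg-↭ one x (↭.shift e K U)) (cong (λ z → z * 1ℚ + dg one (K ++ U) x) (sym (same-inc e f x ends)))) (deg≤ x)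
  ...     | M , M̄ , M↭ , degM , w≤ = M , M̄ , M↭ , degM ,
            ℚ.≤-trans (ℚ.≤-reflexive (∑-↭ wq (↭.shift e K U))) (ℚ.≤-trans (ℚ.+-monoˡ-≤ (∑ (K ++ U) wq) (cast-≤ {wt e} {wt f} we≤wf)) w≤)
    where
    f∈Gbar : f ∈ Gbar
    f∈Gbar = ↭.∈-resp-↭ (↭-sym Gbar↭) (∈-++⁺ʳ K f∈)
    flip : (u f ≡ u e × v f ≡ v e) ⊎ (u f ≡ v e × v f ≡ u e) → (u e ≡ u f × v e ≡ v f) ⊎ (u e ≡ v f × v e ≡ u f)
    flip (inj₁ (p , q)) = inj₁ (sym p , sym q)
    flip (inj₂ (p , q)) = inj₂ (sym q , sym p)
    we≤wf : wt e ℕ.≤ wt f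
    we≤wf = heavy f e f∈Gbar (U⊆R e (here refl)) (between⇐ (u f) (v f) e (flip ends))

-- Every edge of J could be added to M, so one of its ends is saturated.
module Saturation {n : ℕ} (b : Fin n → ℕ) (1≤b : ∀ x → 1 ℕ.≤ b x) (M J : MultiGraph n) (nlM : NoLoops M) (C : ℚ) (0≤C : 0ℚ ≤ C)
  (maximal : ∀ e → e ∈ J → ¬ (suc (deg M (u e)) ℕ.≤ b (u e) × suc (deg M (v e)) ℕ.≤ b (v e)))
  (wdeg≤ : ∀ x → dg wq J x ≤ C * nat (b x)) where

  private
    sat : Fin n → ℚ
    sat x = ⟨ ⌊ b x ℕ.≤? deg M x ⌋ ⟩

    0≤sat : ∀ x → 0ℚ ≤ sat x
    0≤sat x = 0≤⟨⟩ ⌊ b x ℕ.≤? deg M x ⌋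

    1≤sat : ∀ e → e ∈ J → 1ℚ ≤ sat (u e) + sat (v e)
    1≤sat e e∈ with b (u e) ℕ.≤? deg M (u e) | b (v e) ℕ.≤? deg M (v e)
    ... | yes _ | yes _ = ≤-by 0≤1 refl
    ... | yes _ | no _  = ℚ.≤-reflexive refl
    ... | no _  | yes _ = ℚ.≤-reflexive refl
    ... | no ¬p | no ¬q = ⊥-elim (maximal e e∈ (ℕ.≰⇒> ¬p , ℕ.≰⇒> ¬q))

    sat≤deg : ∀ x → nat (b x) * sat x ≤ dg one M x * 1ℚ
    sat≤deg x with b x ℕ.≤? deg M x
    ... | yes h = subst₂ _≤_ (sym (ℚ.*-identityʳ (nat (b x)))) (sym (ℚ.*-identityʳ (dg one M x))) (subst (nat (b x) ≤_) (cast-deg M x nlM) (cast-≤ h))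
    ... | no _  = subst₂ _≤_ (sym (ℚ.*-zeroʳ (nat (b x)))) (sym (ℚ.*-identityʳ (dg one M x))) (0≤dg one M x (λ _ → 0≤1))

  -- Each edge is charged to a saturated end x. The weight charged there is at most C b(x) ≤ C deg M
  -- x, and the degrees of `M` add up to twice its size.
  saturation-bound : ∑ J wq ≤ 2ℚ * C * ∑ M one
  saturation-bound = begin
    ∑ J wq  ≤⟨ ∑-mono∈ J (λ e e∈ → ℚ.≤-trans (ℚ.≤-reflexive (sym (ℚ.*-identityʳ (wq e)))) (*-monoˡ (0≤cast (wt e)) (1≤sat e e∈))) ⟩
    ∑ J (λ e → wq e * (sat (u e) + sat (v e)))      ≡⟨ sym (∑-dg wq J sat) ⟩
    ∑ᶠ (λ x → dg wq J x * sat x)  ≤⟨ ∑-mono (allFin n) (λ x → ℚ.≤-trans (*-mono (0≤dg wq J x (λ e → 0≤cast (wt e))) (0≤sat x) (wdeg≤ x) ℚ.≤-refl)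
                        (ℚ.≤-trans (ℚ.≤-reflexive (ℚ.*-assoc C (nat (b x)) (sat x))) (*-monoˡ 0≤C (sat≤deg x)))) ⟩
    ∑ᶠ (λ x → C * (dg one M x * 1ℚ))  ≡⟨ ∑-*ˡ (allFin n) C (λ x → dg one M x * 1ℚ) ⟩
    C * ∑ᶠ (λ x → dg one M x * 1ℚ)  ≡⟨ cong (C *_) (trans (∑-dg one M (λ _ → 1ℚ)) (∑-*ˡ M 2ℚ one)) ⟩
    C * (2ℚ * ∑ M one)  ≡⟨ eq C (∑ M one) ⟩
    2ℚ * C * ∑ M one  ∎
    where
    open ℚ.≤-Reasoning
    eq : ∀ c m → c * (2ℚ * m) ≡ 2ℚ * c * m
    eq = solve-∀ ring

-- Numerical estimates

ratio1≤1 : ∀ d → 1 ℕ.≤ d → ratio 1 d ≤ 1ℚ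
ratio1≤1 d 1≤d = *-cancelˡ-≤ (0<cast 1≤d) (subst₂ _≤_ (sym (cast*ratio1 d 1≤d)) (sym (ℚ.*-identityʳ (nat d))) (1≤cast 1≤d))

0≤pow : ∀ q k → 0ℚ ≤ q → 0ℚ ≤ pow q k
0≤pow q zero    0≤q = 0≤1
0≤pow q (suc k) 0≤q = 0≤* 0≤q (0≤pow q k 0≤q)

pow-mono : ∀ q r k → 0ℚ ≤ q → q ≤ r → pow q k ≤ pow r k
pow-mono q r zero    0≤q q≤r = ℚ.≤-refl
pow-mono q r (suc k) 0≤q q≤r = *-mono 0≤q (0≤pow r k (ℚ.≤-trans 0≤q q≤r)) q≤r (pow-mono q r k 0≤q q≤r)

-- Without the factorials the series is dominated by the geometric series of ratio 1/2.
expPartial≤2 : ∀ q K → 0ℚ ≤ q → q ≤ ½ → expPartial q K ≤ 2ℚ - pow ½ K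
expPartial≤2 q zero    0≤q q≤½ = ℚ.≤-refl
expPartial≤2 q (suc K) 0≤q q≤½ = ℚ.≤-trans
  (ℚ.+-mono-≤ (expPartial≤2 q K 0≤q q≤½)
    (*-mono (0≤pow q (suc K) 0≤q) 0≤1 (pow-mono q ½ (suc K) 0≤q q≤½) (ratio1≤1 (suc K ℕ.!) (ℕ.1≤n! (suc K)))))
  (ℚ.≤-reflexive (eq (pow ½ K)))
  where
  eq : ∀ p → 2ℚ - p + ½ * p * 1ℚ ≡ 2ℚ - ½ * p
  eq = solve-∀ ring

-- For `q` below 1/2 all partial sums stay strictly below 2, so none of them reaches `x`.
exp-large : ∀ q x → 0ℚ ≤ q → 2ℚ ≤ x → ExpAtLeast q x → ½ ≤ q
exp-large q x 0≤q 2≤x (K , x≤) with ½ ℚ.≤? q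
... | yes ½≤q = ½≤q
... | no ½≰q  = ⊥-elim (≰-< (0<pow K) (≤-by (0≤+ (0≤- 2≤x) (0≤- (ℚ.≤-trans x≤ (expPartial≤2 q K 0≤q (ℚ.<⇒≤ (ℚ.≰⇒> ½≰q)))))) (eq x (pow ½ K))))
  where
  0<pow : ∀ k → 0ℚ < pow ½ k
  0<pow zero    = ℚ.positive⁻¹ 1ℚ
  0<pow (suc k) = 0<* (ℚ.positive⁻¹ ½) (0<pow k)
  eq : ∀ x p → 0ℚ ≡ p + (x - 2ℚ + (2ℚ - p - x))
  eq = solve-∀ ring

[_] : ℕ → ℚ
[ k ] = ℕtoℚ k

0≤[_] : ∀ k → 0ℚ ≤ [ k ]
0≤[ k ] = subst (0ℚ ≤_) (nat≡ℕtoℚ k) (0≤cast k)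

centi third : ℚ
centi = ratio 1 100
third = ratio 1 3

0≤centi : 0ℚ ≤ centi
0≤centi = 0≤ratio 1 100

-- With l = ε / (100 w), the last hypothesis says ε² B ≥ 10000 w⁴; as w ≥ 1, this is weakened to w².
scale-large : ∀ w ε l B i → 1ℚ ≤ w → 0ℚ ≤ B → [ 100 ] * w * l ≡ ε → 2ℚ * (w * w) * i ≡ 1ℚ → ½ ≤ B * (l * l) * i →
  [ 10000 ] * (w * w) ≤ ε * ε * B
scale-large w ε l B i 1≤w 0≤B refl i-inv h = ≤-by
  (0≤+ (0≤* (0≤[ 10000 ]) (0≤* (0≤² w) (0≤* (0≤+ 0≤w 0≤1) (0≤- 1≤w)))) (0≤* (0≤* (0≤[ 20000 ]) (0≤² (w * w))) (0≤- h)))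
  (trans (sym (ℚ.*-identityʳ _)) (trans (cong ([ 100 ] * w * l * ([ 100 ] * w * l) * B *_) (sym i-inv)) (eq w l B i)))
  where
  0≤w : 0ℚ ≤ w
  0≤w = ℚ.≤-trans 0≤1 1≤w
  eq : ∀ w l B i → [ 100 ] * w * l * ([ 100 ] * w * l) * B * (2ℚ * (w * w) * i) ≡
    [ 10000 ] * (w * w) + ([ 10000 ] * (w * w * ((w + 1ℚ) * (w - 1ℚ))) + [ 20000 ] * (w * w * (w * w)) * (B * (l * l) * i - ½))
  eq = solve-∀ ring

module Estimate (w iW ε l β τ iτ : ℚ) (1≤w : 1ℚ ≤ w) (w*iW : w * iW ≡ 1ℚ) (0≤iW : 0ℚ ≤ iW) (0<ε : 0ℚ < ε) (ε<½ : ε < ½) (0<β : 0ℚ < β)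
  (large : [ 9000 ] * (w * w) ≤ ε * ε * β) (l-def : [ 100 ] * w * l ≡ ε) (0≤l : 0ℚ ≤ l)
  (τ-def : τ ≡ ε * β * ([ 10 ] * centi * third)) (τ*iτ : τ * iτ ≡ 1ℚ) (0≤iτ : 0ℚ ≤ iτ) where

  private
    c : ℚ
    c = 2ℚ * w - 1ℚ
    0≤w : 0ℚ ≤ w
    0≤w = ℚ.≤-trans 0≤1 1≤w
    0≤β : 0ℚ ≤ β
    0≤β = ℚ.<⇒≤ 0<β
    0≤ε : 0ℚ ≤ ε
    0≤ε = ℚ.<⇒≤ 0<ε
    0<c : 0ℚ < c
    0<c = ℚ.<-≤-trans (ℚ.positive⁻¹ 1ℚ) (≤-by (0≤+ (0≤- 1≤w) (0≤- 1≤w)) (eq w))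
      where
      eq : ∀ w → 2ℚ * w - 1ℚ ≡ 1ℚ + ((w - 1ℚ) + (w - 1ℚ))
      eq = solve-∀ ring

    l≤ : l ≤ centi * ε
    l≤ = subst (λ z → l ≤ centi * z) l-def (≤-by (0≤* 0≤l (0≤- 1≤w)) (eq w l))
      where
      eq : ∀ w l → centi * ([ 100 ] * w * l) ≡ l + l * (w - 1ℚ)
      eq = solve-∀ ring

    -- Here X ≤ 48 β w² m and τ = ε β / 30, so X / τ ≤ 1440 w² m / ε. The constant 9000 = 1440 /
    -- 0.16 turns this into 0.16 ε β m.
    error≤ : ∀ m X → 0ℚ ≤ m → X ≤ 2ℚ * (2ℚ * 2ℚ * 2ℚ * w * ([ 3 ] * β * w * m)) → iτ * X ≤ [ 16 ] * centi * (ε * β * m)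
    error≤ m X 0≤m X≤ = ℚ.≤-trans (*-monoˡ 0≤iτ X≤τ)
      (ℚ.≤-reflexive (trans (eq iτ τ ([ 16 ] * centi * (ε * β * m))) (trans (cong (_* ([ 16 ] * centi * (ε * β * m))) τ*iτ) (ℚ.*-identityˡ _))))
      where
      eq : ∀ i t x → i * (t * x) ≡ t * i * x
      eq = solve-∀ ring
      eq′ : ∀ w ε β m → ε * β * ([ 10 ] * centi * third) * ([ 16 ] * centi * (ε * β * m)) ≡
        2ℚ * (2ℚ * 2ℚ * 2ℚ * w * ([ 3 ] * β * w * m)) + [ 16 ] * centi * ([ 10 ] * centi * third) * β * m * (ε * ε * β - [ 9000 ] * (w * w))
      eq′ = solve-∀ ring
      X≤τ : X ≤ τ * ([ 16 ] * centi * (ε * β * m))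
      X≤τ = subst (λ t → X ≤ t * ([ 16 ] * centi * (ε * β * m))) (sym τ-def) (ℚ.≤-trans X≤ (≤-by
        (0≤* (0≤* (0≤* (0≤* (0≤* (0≤[ 16 ]) 0≤centi) (0≤* (0≤* (0≤[ 10 ]) 0≤centi) (0≤ratio 1 3))) 0≤β) 0≤m) (0≤- large)) (eq′ w ε β m)))

  estimate : ∀ m mU k Y X s → 0ℚ ≤ m → mU ≤ m → k ≤ m → 0ℚ ≤ Y → Y ≤ s → s ≤ m →
    X ≤ 2ℚ * (2ℚ * 2ℚ * 2ℚ * w * ([ 3 ] * β * w * m)) →
    ½ * c * (β * β) * (m - Y - 2ℚ * l * mU) ≤ ¼ * c * c * iW * β * β * Y + c * β * (τ * (2ℚ * k + Y) + ¼ * iτ * X) →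
    m ≤ (2ℚ - ½ * iW + ε) * s
  estimate m mU k Y X s 0≤m mU≤ k≤ 0≤Y Y≤s s≤m X≤ bound = *-cancelˡ-≤ 0<1-ρ final
    where
    -- The budget is 0.30: twice 0.14 from `bracket`, and 0.02 from `2ℚ * l` with l ≤ ε / 100.
    ρ : ℚ
    ρ = [ 30 ] * centi
    -- The first term is at most 3 τ m = 0.10 ε β m, and a quarter of 0.16 adds 0.04.
    bracket : τ * (2ℚ * k + Y) + ¼ * iτ * X ≤ [ 14 ] * centi * (ε * β * m)
    bracket = subst (λ t → t * (2ℚ * k + Y) + ¼ * iτ * X ≤ [ 14 ] * centi * (ε * β * m)) (sym τ-def) (≤-by
      (0≤+ (0≤* (0≤* (0≤* 0≤ε 0≤β) (0≤* (0≤* (0≤[ 10 ]) 0≤centi) (0≤ratio 1 3))) (0≤+ (0≤* 0≤2 (0≤- k≤)) (0≤- (ℚ.≤-trans Y≤s s≤m)))) (0≤* 0≤¼ (0≤- (error≤ m X 0≤m X≤))))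
      (eq ε β m k Y iτ X))
      where
      eq : ∀ ε β m k Y i X → [ 14 ] * centi * (ε * β * m) ≡ ε * β * ([ 10 ] * centi * third) * (2ℚ * k + Y) + ¼ * i * X +
        (ε * β * ([ 10 ] * centi * third) * (2ℚ * (m - k) + (m - Y)) + ¼ * ([ 16 ] * centi * (ε * β * m) - i * X))
      eq = solve-∀ ring
    divided : ½ * (m - Y - 2ℚ * l * mU) ≤ ¼ * (2ℚ - iW) * Y + [ 14 ] * centi * (ε * m)
    divided = *-cancelˡ-≤ (0<* 0<c (0<* 0<β 0<β)) (ℚ.≤-trans (ℚ.≤-reflexive (eq₁ c β (m - Y - 2ℚ * l * mU)))
      (ℚ.≤-trans bound (ℚ.≤-trans (ℚ.+-monoʳ-≤ (¼ * c * c * iW * β * β * Y) (*-monoˡ (0≤* (ℚ.<⇒≤ 0<c) 0≤β) bracket))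
        (ℚ.≤-reflexive (trans (eq₂ w iW β Y ε m) (trans (cong (λ z → ¼ * (2ℚ * w - 1ℚ) * (2ℚ * z - iW) * β * β * Y + (2ℚ * w - 1ℚ) * β * ([ 14 ] * centi * (ε * β * m))) w*iW)
          (eq₃ c iW β Y ε m)))))))
      where
      eq₁ : ∀ c β x → c * (β * β) * (½ * x) ≡ ½ * c * (β * β) * x
      eq₁ = solve-∀ ring
      eq₂ : ∀ w i β Y ε m → ¼ * (2ℚ * w - 1ℚ) * (2ℚ * w - 1ℚ) * i * β * β * Y + (2ℚ * w - 1ℚ) * β * ([ 14 ] * centi * (ε * β * m)) ≡
        ¼ * (2ℚ * w - 1ℚ) * (2ℚ * (w * i) - i) * β * β * Y + (2ℚ * w - 1ℚ) * β * ([ 14 ] * centi * (ε * β * m))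
      eq₂ = solve-∀ ring
      eq₃ : ∀ c i β Y ε m → ¼ * c * (2ℚ * 1ℚ - i) * β * β * Y + c * β * ([ 14 ] * centi * (ε * β * m)) ≡
        c * (β * β) * (¼ * (2ℚ - i) * Y + [ 14 ] * centi * (ε * m))
      eq₃ = solve-∀ ring
    iW≤1 : iW ≤ 1ℚ
    iW≤1 = subst (iW ≤_) w*iW (≤-by (0≤* 0≤iW (0≤- 1≤w)) (eq w iW))
      where
      eq : ∀ w i → w * i ≡ i + i * (w - 1ℚ)
      eq = solve-∀ ring
    0≤κ : 0ℚ ≤ 2ℚ - ½ * iW
    0≤κ = ≤-by (0≤+ (0≤* 0≤½ (0≤- iW≤1)) (0≤+ 0≤1 0≤½)) (eq iW)
      where
      eq : ∀ i → 2ℚ - ½ * i ≡ 0ℚ + (½ * (1ℚ - i) + (1ℚ + ½))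
      eq = solve-∀ ring
    0<1-ρ : 0ℚ < 1ℚ - ρ * ε
    0<1-ρ = ℚ.<-≤-trans (ℚ.positive⁻¹ ½) (≤-by (0≤+ (0≤* (0≤* (0≤[ 30 ]) 0≤centi) (0≤- (ℚ.<⇒≤ ε<½))) (0≤* (0≤[ 35 ]) 0≤centi)) (eq ε))
      where
      eq : ∀ ε → 1ℚ - [ 30 ] * centi * ε ≡ ½ + ([ 30 ] * centi * (½ - ε) + [ 35 ] * centi)
      eq = solve-∀ ring
    0≤s : 0ℚ ≤ s
    0≤s = ℚ.≤-trans 0≤Y Y≤s
    final : (1ℚ - ρ * ε) * m ≤ (1ℚ - ρ * ε) * ((2ℚ - ½ * iW + ε) * s)
    final = ℚ.≤-trans
      (≤-by (0≤+ (0≤+ (0≤* 0≤2 (0≤- divided)) (0≤* (0≤* 0≤2 0≤l) (0≤- mU≤))) (0≤+ (0≤* (0≤* 0≤2 0≤m) (0≤- l≤)) (0≤* 0≤κ (0≤- Y≤s)))) (eq₁ ε l m mU Y s iW))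
      -- The slack is ε s times 0.4 + 0.15 iW - 0.3 ε, which is at least 0.25 because ε < 1/2.
      (≤-by (0≤* (0≤* 0≤ε 0≤s) (0≤+ (0≤+ (0≤* (0≤* (0≤* (0≤[ 30 ]) 0≤centi) 0≤½) 0≤iW) (0≤* (0≤* (0≤[ 30 ]) 0≤centi) (0≤- (ℚ.<⇒≤ ε<½)))) (0≤* (0≤[ 25 ]) 0≤centi))) (eq₂ ε s iW))
      where
      eq₁ : ∀ ε l m mU Y s i → (2ℚ - ½ * i) * s ≡ (1ℚ - [ 30 ] * centi * ε) * m +
        (2ℚ * (¼ * (2ℚ - i) * Y + [ 14 ] * centi * (ε * m) - ½ * (m - Y - 2ℚ * l * mU)) + 2ℚ * l * (m - mU) + (2ℚ * m * (centi * ε - l) + (2ℚ - ½ * i) * (s - Y)))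
      eq₁ = solve-∀ ring
      eq₂ : ∀ ε s i → (1ℚ - [ 30 ] * centi * ε) * ((2ℚ - ½ * i + ε) * s) ≡ (2ℚ - ½ * i) * s +
        ε * s * ([ 30 ] * centi * ½ * i + [ 30 ] * centi * (½ - ε) + [ 25 ] * centi)
      eq₂ = solve-∀ ring

inverse : ∀ a → 0ℚ < a → ∃ λ i → a * i ≡ 1ℚ × 0ℚ ≤ i
inverse a 0<a = i , a*i≡1 , *-cancelˡ-≤ 0<a (subst₂ _≤_ (sym (ℚ.*-zeroʳ a)) (sym a*i≡1) 0≤1)
  where
  instance
    a≢0 : ℚ.NonZero a
    a≢0 = ℚ.pos⇒nonZero a {{ℚ.positive 0<a}}
  i : ℚ
  i = ℚ.1/ a
  a*i≡1 : a * i ≡ 1ℚ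
  a*i≡1 = ℚ.*-inverseʳ a

-- From the graph to the estimate

module Assembly (W : ℕ) (1≤W : 1 ℕ.≤ W) (β β⁻ : ℕ) (3≤β : 3 ℕ.≤ β)
  (n : ℕ) (b : Fin n → ℕ) (1≤b : ∀ x → 1 ℕ.≤ b x) (G : MultiGraph n) (wf : WellFormed W G)
  (Gbar : MultiGraph n) (relevant : IsRelevantSubgraph b G Gbar) (H : MultiGraph n) (edcs : IsEDCS b β β⁻ Gbar H)
  (MG : MultiGraph n) (max : IsMaxBMatching b G MG) where

  private
    R : MultiGraph n
    R = proj₁ relevant
    G↭ : G ↭ Gbar ++ R
    G↭ = proj₁ (proj₂ relevant)
    R-H : MultiGraph n
    R-H = proj₁ edcs
    Gbar↭H : Gbar ↭ H ++ R-H
    Gbar↭H = proj₁ (proj₂ edcs)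

    Gbar⊆G : ∀ e → e ∈ Gbar → e ∈ G
    Gbar⊆G e e∈ = ↭.∈-resp-↭ (↭-sym G↭) (∈-++⁺ˡ e∈)

    ⊆Gbar : ∀ {A B} → Gbar ↭ A ++ B → ∀ e → e ∈ A → e ∈ G
    ⊆Gbar p e e∈ = Gbar⊆G e (↭.∈-resp-↭ (↭-sym p) (∈-++⁺ˡ e∈))

    noLoops : ∀ {L} → (∀ e → e ∈ L → e ∈ G) → NoLoops L
    noLoops L⊆G e e∈ = proj₁ (wf e (L⊆G e e∈))

    extend-split : ∀ {A B} → Gbar ↭ A ++ B → G ↭ A ++ (B ++ R)
    extend-split {A} {B} p = ↭-trans G↭ (↭-trans (↭.++⁺ʳ R p) (↭.++-assoc A B R))

    one≤wq : ∀ L → (∀ e → e ∈ L → e ∈ G) → ∑ L one ≤ ∑ L wq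
    one≤wq L L⊆G = ∑-mono∈ L (λ e e∈ → 1≤cast (proj₁ (proj₂ (wf e (L⊆G e e∈)))))

  RelevantMax : Set
  RelevantMax = ∃ λ M → ∃ λ M̄ → Gbar ↭ M ++ M̄ × (∀ x → dg one M x ≤ nat (b x)) × nat (weight MG) ≤ ∑ M wq

  -- A maximum b-matching may be taken inside `Gbar`, where each of its edges is subject to one of
  -- the two EDCS conditions.
  relevant-max : RelevantMax
  relevant-max = from-refinement (common-refinement MG (↭-trans (↭-sym (proj₂ (proj₁ (proj₁ max)))) G↭))
    where
    MG⊆G : ∀ e → e ∈ MG → e ∈ G
    MG⊆G e e∈ = ↭.∈-resp-↭ (↭-sym (proj₂ (proj₁ (proj₁ max)))) (∈-++⁺ˡ e∈)
    from-refinement : (∃ λ ps → ∃ λ qs → ∃ λ ss → ∃ λ ts → MG ↭ ps ++ qs × proj₁ (proj₁ (proj₁ max)) ↭ ss ++ ts × Gbar ↭ ps ++ ss × R ↭ qs ++ ts) → RelevantMax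
    from-refinement (ps , qs , ss , ts , MG↭ , _ , Gbar↭ , R↭) = from-exchange
      (Exchange.relevant-matching b G Gbar R G↭ (proj₁ (proj₂ (proj₂ relevant))) (proj₂ (proj₂ (proj₂ relevant))) qs ps ss Gbar↭
        (λ e e∈ → ↭.∈-resp-↭ (↭-sym R↭) (∈-++⁺ˡ e∈))
        (λ x → ℚ.≤-trans (ℚ.≤-reflexive (trans (sym (dg-↭ one x MG↭)) (sym (cast-deg MG x (noLoops MG⊆G))))) (cast-≤ (proj₂ (proj₁ max) x))))
      where
      from-exchange : (∃ λ M → ∃ λ M̄ → Gbar ↭ M ++ M̄ × (∀ x → dg one M x ≤ nat (b x)) × ∑ (ps ++ qs) wq ≤ ∑ M wq) → RelevantMax
      from-exchange (M , M̄ , Gbar↭M , deg≤ , w≤) = M , M̄ , Gbar↭M , deg≤ ,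
        ℚ.≤-trans (ℚ.≤-reflexive (trans (weight-∑ MG) (∑-↭ wq MG↭))) w≤

  -- The four blocks of `Gbar` cut out by `H` and `M`: `K` lies in both, `J` only in `H`, `U` only
  -- in `M`, and `T` in neither.
  module WithParts (M M̄ : MultiGraph n) (Gbar↭M : Gbar ↭ M ++ M̄) (degM : ∀ x → dg one M x ≤ nat (b x)) (MG≤M : nat (weight MG) ≤ ∑ M wq)
    (K J U T : MultiGraph n) (H↭ : H ↭ K ++ J) (R-H↭ : R-H ↭ U ++ T) (M↭ : M ↭ K ++ U) (M̄↭ : M̄ ↭ J ++ T)
    (l τ iτ : ℚ) (0≤l : 0ℚ ≤ l) (0<τ : 0ℚ < τ) (τ*iτ : τ * iτ ≡ 1ℚ) (β-gap : nat β - nat β⁻ ≤ l * nat β) where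

    w βq : ℚ
    w = nat W
    βq = nat β

    private
      0<β : 0ℚ < βq
      0<β = 0<cast (ℕ.≤-trans (s≤s z≤n) 3≤β)
      0≤β : 0ℚ ≤ βq
      0≤β = 0≤cast β

      H′ : MultiGraph n
      H′ = J ++ K
      H↭H′ : H ↭ H′
      H↭H′ = ↭-trans H↭ (↭.++-comm K J)

      H⊆G : ∀ e → e ∈ H → e ∈ G
      H⊆G = ⊆Gbar Gbar↭H
      H′⊆H : ∀ e → e ∈ H′ → e ∈ H
      H′⊆H e e∈ = ↭.∈-resp-↭ (↭-sym H↭H′) e∈
      M⊆G : ∀ e → e ∈ M → e ∈ G
      M⊆G = ⊆Gbar Gbar↭M
      KU⊆G : ∀ e → e ∈ K ++ U → e ∈ G
      KU⊆G e e∈ = M⊆G e (↭.∈-resp-↭ (↭-sym M↭) e∈)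

      module C = Combined b 1≤b W 1≤W βq (nat β⁻) l τ iτ 0<β 0≤l 0<τ τ*iτ β-gap J K U

      share-ratio : ∀ x → C.share x ≡ ratio (wdeg H x) (b x)
      share-ratio x = trans (cong (_* ratio 1 (b x)) (trans (sym (dg-↭ wq x H↭H′)) (sym (cast-wdeg H x (noLoops H⊆G))))) (sym (ratio≡ (wdeg H x) (b x) (1≤b x)))

      load≡ : ∀ e → C.share (u e) + C.share (v e) ≡ edgeLoad b H e
      load≡ e = cong₂ _+_ (share-ratio (u e)) (share-ratio (v e))

      H-load : ∀ e → e ∈ H′ → C.share (u e) + C.share (v e) ≤ βq * wq e
      H-load e e∈ = subst₂ _≤_ (sym (load≡ e)) (cong₂ _*_ (sym (nat≡ℕtoℚ β)) (sym (nat≡ℕtoℚ (wt e)))) (proj₁ (proj₂ (proj₂ edcs)) e (H′⊆H e e∈))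

      U-load : ∀ e → e ∈ U → nat β⁻ * wq e ≤ C.share (u e) + C.share (v e)
      U-load e e∈ = subst₂ _≤_ (cong₂ _*_ (sym (nat≡ℕtoℚ β⁻)) (sym (nat≡ℕtoℚ (wt e)))) (sym (load≡ e)) (proj₂ (proj₂ (proj₂ edcs)) e (↭.∈-resp-↭ (↭-sym R-H↭) (∈-++⁺ˡ e∈)))

      0≤share : ∀ x → 0ℚ ≤ C.share x
      0≤share x = 0≤* (0≤dg wq H′ x (λ e → 0≤cast (wt e))) (0≤ratio 1 (b x))

      w≤W : ∀ e → e ∈ H′ → wt e ℕ.≤ W
      w≤W e e∈ = proj₂ (proj₂ (wf e (H⊆G e (H′⊆H e e∈))))

      -- Any edge of `H` at `x` bounds the share there by its own load, which is at most β W;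
      -- without such an edge the share is zero.
      share≤ : ∀ x → C.share x ≤ βq * w
      share≤ x with search (λ e → incidentᵇ x e Bool.≟ true) H′
      ... | inj₂ none = ℚ.≤-trans (ℚ.≤-reflexive (trans (cong (_* ratio 1 (b x)) isolated) (ℚ.*-zeroˡ (ratio 1 (b x))))) (0≤* 0≤β (0≤cast W))
        where
        isolated : dg wq H′ x ≡ 0ℚ
        isolated = trans (∑-cong∈ H′ (λ e e∈ → trans (cong (_* wq e) (trans (inc≡incident e x (proj₁ (wf e (H⊆G e (H′⊆H e e∈))))) (cong ⟨_⟩ (Bool.¬-not (none e e∈))))) (ℚ.*-zeroˡ (wq e)))) (∑-0 H′)
      ... | inj₁ (e , e∈ , inc-e) = ℚ.≤-trans (end (u e ≟ x) (v e ≟ x) inc-e) (ℚ.≤-trans (H-load e e∈) (*-monoˡ 0≤β (cast-≤ {wt e} {W} (w≤W e e∈))))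
        where
        end : (p : Dec (u e ≡ x)) (q : Dec (v e ≡ x)) → (⌊ p ⌋ Bool.∨ ⌊ q ⌋) ≡ true → C.share x ≤ C.share (u e) + C.share (v e)
        end (yes refl) _ _ = ≤-by (0≤share (v e)) refl
        end (no _) (yes refl) _ = ≤-by (0≤share (u e)) (ℚ.+-comm (C.share (u e)) (C.share (v e)))

      few : ∀ x y → length (edgesBetween H′ x y) ℕ.≤ b y
      few x y = ℕ.≤-trans (cast-cancel-≤ {length (edgesBetween H′ x y)} {length (edgesBetween Gbar x y)} (begin
          nat (length (edgesBetween H′ x y))  ≡⟨ cast-between H′ x y ⟩
          ∑ H′ bt  ≡⟨ sym (∑-↭ bt H↭H′) ⟩
          ∑ H bt  ≤⟨ ≤-by (0≤∑ R-H (λ e → 0≤⟨⟩ (betweenᵇ x y e))) (∑-↭++ {ys = H} {R-H} bt Gbar↭H) ⟩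
          ∑ Gbar bt  ≡⟨ sym (cast-between Gbar x y) ⟩
          nat (length (edgesBetween Gbar x y))       ∎))
        (ℕ.≤-trans (ℕ.≤-reflexive (proj₁ (proj₂ (proj₂ relevant)) x y)) (ℕ.≤-trans (ℕ.m⊓n≤m (b x ℕ.⊓ b y) (length (edgesBetween G x y))) (ℕ.m⊓n≤n (b x) (b y))))
        where
        open ℚ.≤-Reasoning
        bt : Edge n → ℚ
        bt e = ⟨ betweenᵇ x y e ⟩

      deg≤ : ∀ x → dg one (K ++ U) x ≤ nat (b x)
      deg≤ x = subst (_≤ nat (b x)) (dg-↭ one x M↭) (degM x)

    private
      result : C.Outcome
      result = C.outcome (noLoops (λ e e∈ → H⊆G e (H′⊆H e e∈)) , w≤W , few) (noLoops KU⊆G) deg≤ share≤ H-load U-load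

      open C.Outcome result hiding (H↭) renaming (T to S̄)

      H↭ST : H ↭ S ++ S̄
      H↭ST = ↭-trans H↭H′ (C.Outcome.H↭ result)

      S⊆G : ∀ e → e ∈ S → e ∈ G
      S⊆G e e∈ = H⊆G e (↭.∈-resp-↭ (↭-sym H↭ST) (∈-++⁺ˡ e∈))

      S-matching : IsBMatching b S
      S-matching x = cast-cancel-≤ {deg S x} {b x} (subst (_≤ nat (b x)) (sym (cast-deg S x (noLoops S⊆G))) (matching x))

      G↭S : G ↭ S ++ ((S̄ ++ R-H) ++ R)
      G↭S = extend-split {S} {S̄ ++ R-H} (↭-trans Gbar↭H (↭-trans (↭.++⁺ʳ R-H H↭ST) (↭.++-assoc S (S̄) R-H)))

      m s : ℚ
      m = ∑ M wq
      s = ∑ S wq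

      s≤m : s ≤ m
      s≤m = ℚ.≤-trans (ℚ.≤-reflexive (sym (weight-∑ S))) (ℚ.≤-trans (cast-≤ {weight S} {weight MG} (proj₂ max S ((_ , G↭S) , S-matching))) MG≤M)

      m≡ : m ≡ ∑ K wq + ∑ U wq
      m≡ = ∑-↭++ {ys = K} {U} wq M↭

      0≤wq : ∀ (e : Edge n) → 0ℚ ≤ wq e
      0≤wq e = 0≤cast (wt e)

      U≤m : ∑ U wq ≤ m
      U≤m = ≤-by (0≤∑ K 0≤wq) (trans m≡ (ℚ.+-comm (∑ K wq) (∑ U wq)))

      -- `M` is at least as heavy as `MG`, so adding an edge with room at both ends would beat the
      -- maximum.
      unsaturated : ∀ e → e ∈ J → ¬ (suc (deg M (u e)) ℕ.≤ b (u e) × suc (deg M (v e)) ℕ.≤ b (v e))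
      unsaturated e e∈ (fu , fv) = from-removal (∈-↭∷ e∈)
        where
        from-removal : (∃ λ J′ → J ↭ e ∷ J′) → ⊥
        from-removal (J′ , J↭) = ≰-< (ℚ.<-≤-trans heavier (ℚ.≤-reflexive (sym (weight-∑ (e ∷ M)))))
            (ℚ.≤-trans (cast-≤ {weight (e ∷ M)} {weight MG} (proj₂ max (e ∷ M) ((_ , G↭eM) , eM-matching))) MG≤M)
          where
          e∈G : e ∈ G
          e∈G = H⊆G e (H′⊆H e (∈-++⁺ˡ e∈))
          G↭eM : G ↭ (e ∷ M) ++ ((J′ ++ T) ++ R)
          G↭eM = extend-split {e ∷ M} {J′ ++ T} (↭-trans Gbar↭M (↭-trans (↭.++⁺ˡ M (↭-trans M̄↭ (↭.++⁺ʳ T J↭))) (↭.shift e M (J′ ++ T))))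
          heavier : m < wq e + m
          heavier = subst (_< wq e + m) (ℚ.+-identityˡ m) (ℚ.+-monoˡ-< m (ℚ.<-≤-trans (ℚ.positive⁻¹ 1ℚ) (1≤cast (proj₁ (proj₂ (wf e e∈G))))))
          eM-matching : IsBMatching b (e ∷ M)
          eM-matching x with u e ≟ x | v e ≟ x
          ... | yes refl | _        = fu
          ... | no _     | yes refl = fv
          ... | no _     | no _     = cast-cancel-≤ {deg M x} {b x} (subst (_≤ nat (b x)) (sym (cast-deg M x (noLoops M⊆G))) (degM x))

      J-degree : ∀ x → dg wq J x ≤ βq * w * nat (b x)
      J-degree x = ℚ.≤-trans (≤-by (0≤dg wq K x 0≤wq) (dg-++ wq J K x)) (ℚ.≤-trans (ℚ.≤-reflexive degree≡) (*-mono (0≤share x) (0≤cast (b x)) (share≤ x) ℚ.≤-refl))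
        where
        eq : ∀ d i c → d * i * c ≡ d * (c * i)
        eq = solve-∀ ring
        degree≡ : dg wq H′ x ≡ C.share x * nat (b x)
        degree≡ = sym (trans (eq (dg wq H′ x) (ratio 1 (b x)) (nat (b x))) (trans (cong (dg wq H′ x *_) (cast*ratio1 (b x) (1≤b x))) (ℚ.*-identityʳ (dg wq H′ x))))

      -- Saturation bounds `J` by 2 β W |M| ≤ 2 β W m, and `K` weighs at most m ≤ β W m.
      H-weight : ∑ H′ wq ≤ [ 3 ] * βq * w * m
      H-weight = ℚ.≤-trans (ℚ.≤-reflexive (∑-++ J K wq)) (≤-by
        (0≤+ (0≤+ (0≤- (Saturation.saturation-bound b 1≤b M J (noLoops M⊆G) (βq * w) (0≤* 0≤β (0≤cast W)) unsaturated J-degree))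
                  (0≤* (0≤* 0≤2 (0≤* 0≤β (0≤cast W))) (0≤- (one≤wq M M⊆G))))
             (0≤+ (0≤- K≤m) (0≤* (0≤- 1≤βw) (0≤∑ M 0≤wq))))
        (eq (βq * w) m (∑ J wq) (∑ K wq) (∑ M one) βq w refl))
        where
        K≤m : ∑ K wq ≤ m
        K≤m = ≤-by (0≤∑ U 0≤wq) m≡
        1≤βw : 1ℚ ≤ βq * w
        1≤βw = *-mono 0≤1 (0≤cast W) (1≤cast (ℕ.≤-trans (s≤s z≤n) 3≤β)) (1≤cast 1≤W)
        eq₁ : ∀ C m j k o → [ 3 ] * C * m ≡ j + k + (2ℚ * C * o - j + 2ℚ * C * (m - o) + (m - k + (C - 1ℚ) * m))
        eq₁ = solve-∀ ring
        eq : ∀ C m j k o β w → C ≡ β * w → [ 3 ] * β * w * m ≡ j + k + (2ℚ * C * o - j + 2ℚ * C * (m - o) + (m - k + (C - 1ℚ) * m))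
        eq C m j k o β w refl = trans (cong (_* m) (ℚ.*-assoc [ 3 ] β w)) (eq₁ C m j k o)

    module _ (ε : ℚ) (0<ε : 0ℚ < ε) (ε<½ : ε < ½) (large : [ 9000 ] * (w * w) ≤ ε * ε * βq) (l-def : [ 100 ] * w * l ≡ ε)
      (τ-def : τ ≡ ε * βq * ([ 10 ] * centi * third)) (0≤iτ : 0ℚ ≤ iτ) where

      approximation : ∃ λ MH → IsBMatchingOf b H MH × nat (weight MG) ≤ (2ℚ - ½ * ratio 1 W + ε) * nat (weight MH)
      approximation = S , ((S̄ , H↭ST) , S-matching) , ℚ.≤-trans MG≤M
        (ℚ.≤-trans (Estimate.estimate w (ratio 1 W) ε l βq τ iτ (1≤cast 1≤W) (cast*ratio1 W 1≤W) (0≤ratio 1 W) 0<ε ε<½ 0<β large l-def 0≤l τ-def τ*iτ 0≤iτ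
            m (∑ U wq) (∑ U one) Y X s (0≤∑ M 0≤wq) U≤m (ℚ.≤-trans (one≤wq U (λ e e∈ → KU⊆G e (∈-++⁺ʳ K e∈))) U≤m) 0≤Y Y≤ s≤m
            (ℚ.≤-trans X≤ (*-monoˡ 0≤2 (*-monoˡ (0≤* (0≤* (0≤* 0≤2 0≤2) 0≤2) (0≤cast W)) H-weight)))
            (subst (λ z → ½ * (2ℚ * w - 1ℚ) * (βq * βq) * (z - Y - 2ℚ * l * ∑ U wq) ≤
                ¼ * (2ℚ * w - 1ℚ) * (2ℚ * w - 1ℚ) * ratio 1 W * βq * βq * Y + (2ℚ * w - 1ℚ) * βq * (τ * (2ℚ * ∑ U one + Y) + ¼ * iτ * X)) (sym m≡) bound))
          (ℚ.≤-reflexive (cong ((2ℚ - ½ * ratio 1 W + ε) *_) (sym (weight-∑ S)))))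

theorem34 : (ε : ℚ) → 0ℚ ℚ.< ε → ε ℚ.< ½
    → (W : ℕ) → 1 ℕ.≤ W
    → (β β⁻ : ℕ) → β⁻ ℕ.+ 2 ℕ.≤ β → 3 ℕ.≤ β
    → ExpAtLeast (ℕtoℚ (β ℕ.+ 6 ℕ.* W) ℚ.* ((ε ℚ.* ratio 1 (100 ℕ.* W)) ℚ.* (ε ℚ.* ratio 1 (100 ℕ.* W)))
                    ℚ.* ratio 1 (2 ℕ.* (W ℕ.* W)))
                 (ℕtoℚ (β ℕ.+ 6 ℕ.* W))
    → (1ℚ ℚ.- ε ℚ.* ratio 1 (100 ℕ.* W)) ℚ.* ℕtoℚ (β ℕ.+ 6 ℕ.* W)
        ℚ.≤ ℕtoℚ β⁻ ℚ.- ℕtoℚ (6 ℕ.* W)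
    → (n : ℕ) (b : Fin n → ℕ) → (∀ x → 1 ℕ.≤ b x)
    → (G : MultiGraph n) → WellFormed W G
    → (Gbar : MultiGraph n) → IsRelevantSubgraph b G Gbar
    → (H : MultiGraph n) → IsEDCS b β β⁻ Gbar H
    → (MG : MultiGraph n) → IsMaxBMatching b G MG
    → ∃ λ MH → IsBMatchingOf b H MH
        × ℕtoℚ (weight MG)
            ℚ.≤ ((ℕtoℚ 2 ℚ.- ratio 1 (2 ℕ.* W)) ℚ.+ ε) ℚ.* ℕtoℚ (weight MH)
theorem34 ε 0<ε ε<½ W 1≤W β β⁻ _ 3≤β exp-bound gap n b 1≤b G wf Gbar relevant H edcs MG max =
  from-max A.relevant-max
  where
  module A = Assembly W 1≤W β β⁻ 3≤β n b 1≤b G wf Gbar relevant H edcs MG max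

  w βq l B i τ : ℚ
  w = nat W
  βq = nat β
  l = ε * ratio 1 (100 ℕ.* W)
  B = ℕtoℚ (β ℕ.+ 6 ℕ.* W)
  i = ratio 1 (2 ℕ.* (W ℕ.* W))
  -- This is ε β / 30, which splits the error into 0.10 for the linear part and 0.04 for the
  -- quadratic part, in units of ε β m.
  τ = ε * βq * ([ 10 ] * centi * third)

  0≤ε : 0ℚ ≤ ε
  0≤ε = ℚ.<⇒≤ 0<ε
  1≤w : 1ℚ ≤ w
  1≤w = 1≤cast 1≤W
  0≤w : 0ℚ ≤ w
  0≤w = 0≤cast W

  0≤l : 0ℚ ≤ l
  0≤l = 0≤* 0≤ε (0≤ratio 1 (100 ℕ.* W))

  cast-[] : ∀ k → nat (k ℕ.* W) ≡ [ k ] * w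
  cast-[] k = trans (cast-* k W) (cong (_* w) (nat≡ℕtoℚ k))

  l-def : [ 100 ] * w * l ≡ ε
  l-def = trans (cong (_* l) (sym (cast-[] 100))) (trans (eq (nat (100 ℕ.* W)) ε (ratio 1 (100 ℕ.* W)))
    (trans (cong (ε *_) (cast*ratio1 (100 ℕ.* W) (ℕ.*-mono-≤ {1} {100} (s≤s z≤n) 1≤W))) (ℚ.*-identityʳ ε)))
    where
    eq : ∀ a e r → a * (e * r) ≡ e * (a * r)
    eq = solve-∀ ring

  l≤1 : l ≤ 1ℚ
  l≤1 = *-mono 0≤ε 0≤1 (ℚ.≤-trans (ℚ.<⇒≤ ε<½) (≤-by 0≤½ refl)) (ratio1≤1 (100 ℕ.* W) (ℕ.*-mono-≤ {1} {100} (s≤s z≤n) 1≤W))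

  B≡ : B ≡ βq + [ 6 ] * w
  B≡ = trans (sym (nat≡ℕtoℚ (β ℕ.+ 6 ℕ.* W))) (trans (cast-+ β (6 ℕ.* W)) (cong (βq +_) (cast-[] 6)))

  i-inv : 2ℚ * (w * w) * i ≡ 1ℚ
  i-inv = trans (cong (_* i) (sym (trans (cast-* 2 (W ℕ.* W)) (cong₂ _*_ (nat≡ℕtoℚ 2) (cast-* W W)))))
    (cast*ratio1 (2 ℕ.* (W ℕ.* W)) (ℕ.*-mono-≤ {1} {2} (s≤s z≤n) (ℕ.*-mono-≤ 1≤W 1≤W)))

  ½≤ : ½ ≤ B * (l * l) * i
  ½≤ = exp-large (B * (l * l) * i) B (0≤* (0≤* 0≤[ β ℕ.+ 6 ℕ.* W ] (0≤² l)) (0≤ratio 1 (2 ℕ.* (W ℕ.* W))))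
    (subst₂ _≤_ (nat≡ℕtoℚ 2) (nat≡ℕtoℚ (β ℕ.+ 6 ℕ.* W)) (cast-≤ (ℕ.≤-trans (ℕ.≤-trans (s≤s (s≤s z≤n)) 3≤β) (ℕ.m≤m+n β (6 ℕ.* W))))) exp-bound

  -- Passing from β + 6W to β costs 6 W ε² ≤ 6 W², so 9994 W² would remain of 10000 W².
  large : [ 9000 ] * (w * w) ≤ ε * ε * βq
  large = ≤-by
    (0≤+ (0≤+ (0≤- (subst (λ z → [ 10000 ] * (w * w) ≤ ε * ε * z) B≡ (scale-large w ε l B i 1≤w 0≤[ β ℕ.+ 6 ℕ.* W ] l-def i-inv ½≤)))
              (0≤* (0≤[ 994 ]) (0≤² w)))
         (0≤+ (0≤* (0≤* (0≤[ 6 ]) 0≤w) (0≤- 1≤w)) (0≤* (0≤* (0≤[ 6 ]) 0≤w) (0≤* (0≤- ε≤1) (0≤+ 0≤1 0≤ε)))))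
    (eq w ε βq)
    where
    ε≤1 : ε ≤ 1ℚ
    ε≤1 = ℚ.≤-trans (ℚ.<⇒≤ ε<½) (≤-by 0≤½ refl)
    eq : ∀ w ε β → ε * ε * β ≡ [ 9000 ] * (w * w) +
      ((ε * ε * (β + [ 6 ] * w) - [ 10000 ] * (w * w)) + [ 994 ] * (w * w) + ([ 6 ] * w * (w - 1ℚ) + [ 6 ] * w * ((1ℚ - ε) * (1ℚ + ε))))
    eq = solve-∀ ring

  -- Rearranging the hypothesis on β⁻ leaves the nonnegative surplus 6W (1 + (1 - l)), which is
  -- given away.
  β-gap : βq - nat β⁻ ≤ l * βq
  β-gap = ≤-by (0≤+ (0≤- (subst₂ (λ y z → (1ℚ - l) * y ≤ nat β⁻ - z) B≡ (trans (sym (nat≡ℕtoℚ (6 ℕ.* W))) (cast-[] 6)) (subst (λ z → (1ℚ - l) * B ≤ z - ℕtoℚ (6 ℕ.* W)) (sym (nat≡ℕtoℚ β⁻)) gap))) (0≤* (0≤* (0≤[ 6 ]) 0≤w) (0≤+ 0≤1 (0≤- l≤1))))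
    (eq l βq (nat β⁻) w)
    where
    eq : ∀ l β β⁻ w → l * β ≡ β - β⁻ + ((β⁻ - [ 6 ] * w - (1ℚ - l) * (β + [ 6 ] * w)) + [ 6 ] * w * (1ℚ + (1ℚ - l)))
    eq = solve-∀ ring

  0<τ : 0ℚ < τ
  0<τ = 0<* (0<* 0<ε (0<cast (ℕ.≤-trans (s≤s z≤n) 3≤β))) (ℚ.positive⁻¹ ([ 10 ] * centi * third))

  half-ratio : 2ℚ - ½ * ratio 1 W ≡ ℕtoℚ 2 - ratio 1 (2 ℕ.* W)
  half-ratio = cong (λ z → 2ℚ - z) (trans (sym (ℚ.*-identityʳ (½ * ratio 1 W))) (trans
    (cong (½ * ratio 1 W *_) (sym (trans (cong (_* ratio 1 (2 ℕ.* W)) (sym (cast-[] 2))) (cast*ratio1 (2 ℕ.* W) (ℕ.*-mono-≤ {1} {2} (s≤s z≤n) 1≤W)))))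
    (trans (eq (ratio 1 W) w (ratio 1 (2 ℕ.* W))) (trans (cong (_* ratio 1 (2 ℕ.* W)) (cast*ratio1 W 1≤W)) (ℚ.*-identityˡ (ratio 1 (2 ℕ.* W)))))))
    where
    eq : ∀ i w r → ½ * i * (2ℚ * w * r) ≡ w * i * r
    eq = solve-∀ ring

  Goal : Set
  Goal = ∃ λ MH → IsBMatchingOf b H MH × ℕtoℚ (weight MG) ≤ ((ℕtoℚ 2 - ratio 1 (2 ℕ.* W)) + ε) * ℕtoℚ (weight MH)

  from-max : A.RelevantMax → Goal
  from-max (M , M̄ , Gbar↭M , degM , MG≤M) = from-parts (common-refinement H (↭-trans (↭-sym (proj₁ (proj₂ edcs))) Gbar↭M))
    where
    from-parts : (∃ λ K → ∃ λ J → ∃ λ U → ∃ λ T → H ↭ K ++ J × proj₁ edcs ↭ U ++ T × M ↭ K ++ U × M̄ ↭ J ++ T) → Goal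
    from-parts (K , J , U , T , H↭ , R-H↭ , M↭ , M̄↭) = from-inverse (inverse τ 0<τ)
      where
      from-inverse : (∃ λ iτ → τ * iτ ≡ 1ℚ × 0ℚ ≤ iτ) → Goal
      from-inverse (iτ , τ*iτ , 0≤iτ) = MH , isM , subst₂ _≤_ (nat≡ℕtoℚ (weight MG)) (cong₂ (λ y z → (y + ε) * z) half-ratio (nat≡ℕtoℚ (weight MH))) w≤
        where
        approx = A.WithParts.approximation M M̄ Gbar↭M degM MG≤M K J U T H↭ R-H↭ M↭ M̄↭ l τ iτ 0≤l 0<τ τ*iτ β-gap ε 0<ε ε<½ large l-def refl 0≤iτ
        MH = proj₁ approx
        isM = proj₁ (proj₂ approx)
        w≤ = proj₂ (proj₂ approx)
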